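{- Let $j,k,r,n$ be positive integers with $j,k\ge2$. Let $\mathcal{G}_{j,k,r}$ be the multigraph whose vertices are the $r\times(k-1)$ integer matrices $A=(A_{i\ell})$ with $j>A_{i,1}\ge A_{i,2}\ge\dots\ge A_{i,k-1}\ge0$ for each $i\in[r]$, and in which the number $e(A,A')$ of undirected edges between $A$ and $A'$ is: $1$ if $A-A'=\pm E_{i\ell}$ or $A-A'=E_{i\ell}-E_{i'\ell'}$ for some $(i,\ell)\ne(i',\ell')$, where $E_{i\ell}$ is the matrix with $1$ in position $(i,\ell)$ and $0$ elsewhere; $1+d_1+\dots+d_r$ loops if $A=A'$, where $d_i$ is the number of distinct entries in row $i$ of $A$ that are less than $j-1$; and $0$ otherwise. Then the number $\mathrm{NCN}_{j,k}(n,r)$ of $r$-colored partitions $\Lambda$ of $[n]$ with $\mathrm{cr}(\Lambda)<j$ and $\mathrm{ne}(\Lambda)<k$ equals the number of $(n-1)$-step walks in $\mathcal{G}_{j,k,r}$ beginning and ending at the zero matrix (walks being sequences of edges, with parallel edges and loops counted as distinct).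
   Context: For a partition $P$ of $[n]=\{1,\dots,n\}$, $\mathrm{Arc}(P)$ is the set of pairs $(i,j)$ with $i,j$ in the same block and $j$ the least element of that block greater than $i$. A $k$-crossing is a sequence of arcs with $i_1<\dots<i_k<j_1<\dots<j_k$, a $k$-nesting one with $i_1<\dots<i_k<j_k<\dots<j_1$. An $r$-colored partition is $\Lambda=(P,\varphi)$ with $\varphi:\mathrm{Arc}(P)\to[r]$; $\mathrm{cr}(\Lambda)$ ($\mathrm{ne}(\Lambda)$) is the largest $k$ such that $P$ has a $k$-crossing ($k$-nesting) whose arcs all have the same color. -}

module Defs where

open import Data.Nat using (ℕ; zero; suc; _+_; _*_; _∸_; _<_; _≤_; _≤ᵇ_; _≡ᵇ_)
open import Data.Fin using (Fin; toℕ)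
open import Data.Vec using (Vec; []; _∷_; lookup; toList; zipWith; replicate)
open import Data.List using (List; []; _∷_; map; concatMap; concat; upTo; allFin; length; filterᵇ)
open import Data.Nat.ListAction using (sum)
open import Data.Bool.ListAction using (any; all)
open import Data.Maybe using (Maybe; just; nothing)
open import Data.Bool using (Bool; true; false; _∧_; if_then_else_)
open import Data.Product using (Σ; ∃; _×_; _,_)
open import Relation.Binary.PropositionalEquality using (_≡_; _≢_)

allVecs : {A : Set} → List A → (m : ℕ) → List (Vec A m)
allVecs xs zero    = [] ∷ []
allVecs xs (suc m) = concatMap (λ x → map (x ∷_) (allVecs xs m)) xs

-- Set partitions of [n] (elements 0..n-1 encoded as Fin n).
-- A partition P is encoded by the map  f : i ↦ (least element of the
-- block of i).  Such maps are exactly those with f i ≤ i and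
-- f (f i) = f i; this is a bijection with set partitions of [n].
-- Two elements are in the same block iff they have the same f-value.

module _ {n : ℕ} (f : Vec (Fin n) n) where

  IsPartition : Set
  IsPartition = ∀ i → (toℕ (lookup f i) ≤ toℕ i) × (lookup f (lookup f i) ≡ lookup f i)

  Arc : Fin n → Fin n → Set
  Arc i j = (toℕ i < toℕ j) × (lookup f i ≡ lookup f j)
          × (∀ m → toℕ i < toℕ m → toℕ m < toℕ j → lookup f m ≢ lookup f i)

-- An r-colouring φ : Arc(P) → [r].  Every i is the left endpoint of at
-- most one arc, so φ is encoded by c : Vec (Maybe (Fin r)) n with
-- c i = just (φ (i , j)) if (i , j) is an arc and c i = nothing if i is
-- not the left endpoint of any arc.
IsArcColouring : {n r : ℕ} → Vec (Fin n) n → Vec (Maybe (Fin r)) n → Set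
IsArcColouring {n} {r} f c =
  ∀ i → ((∃ λ j → Arc f i j) → ∃ λ (col : Fin r) → lookup c i ≡ just col)
      × (∀ (col : Fin r) → lookup c i ≡ just col → ∃ λ j → Arc f i j)

MonoCrossing : {n r : ℕ} → Vec (Fin n) n → Vec (Maybe (Fin r)) n →
               (k : ℕ) → (Fin k → Fin n) → (Fin k → Fin n) → Set
MonoCrossing {n} {r} f c k a b =
    (∀ t → Arc f (a t) (b t))
  × (∀ s t → toℕ s < toℕ t → toℕ (a s) < toℕ (a t))
  × (∀ s t → toℕ s < toℕ t → toℕ (b s) < toℕ (b t))
  × (∀ s t → toℕ (a s) < toℕ (b t))
  × (∃ λ (col : Fin r) → ∀ t → lookup c (a t) ≡ just col)

MonoNesting : {n r : ℕ} → Vec (Fin n) n → Vec (Maybe (Fin r)) n →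
              (k : ℕ) → (Fin k → Fin n) → (Fin k → Fin n) → Set
MonoNesting {n} {r} f c k a b =
    (∀ t → Arc f (a t) (b t))
  × (∀ s t → toℕ s < toℕ t → toℕ (a s) < toℕ (a t))
  × (∀ s t → toℕ s < toℕ t → toℕ (b t) < toℕ (b s))
  × (∀ s t → toℕ (a s) < toℕ (b t))
  × (∃ λ (col : Fin r) → ∀ t → lookup c (a t) ≡ just col)

-- cr(Λ) < j : every monochromatic k-crossing has k < j (cr is the max such k).
CrLess : {n r : ℕ} → Vec (Fin n) n → Vec (Maybe (Fin r)) n → ℕ → Set
CrLess {n} f c j = ∀ k (a b : Fin k → Fin n) → MonoCrossing f c k a b → k < j

NeLess : {n r : ℕ} → Vec (Fin n) n → Vec (Maybe (Fin r)) n → ℕ → Set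
NeLess {n} f c j = ∀ k (a b : Fin k → Fin n) → MonoNesting f c k a b → k < j

Candidate : ℕ → ℕ → Set
Candidate n r = Vec (Fin n) n × Vec (Maybe (Fin r)) n

allCandidates : (n r : ℕ) → List (Candidate n r)
allCandidates n r =
  concatMap (λ f → map (f ,_) (allVecs (nothing ∷ map just (allFin r)) n))
            (allVecs (allFin n) n)

NCNObject : (j k : ℕ) {n r : ℕ} → Candidate n r → Set
NCNObject j k (f , c) = IsPartition f × IsArcColouring f c × CrLess f c j × NeLess f c k

Matrix : ℕ → ℕ → Set
Matrix r m = Vec (Vec ℕ m) r

weaklyDecreasing : {m : ℕ} → Vec ℕ m → Bool
weaklyDecreasing []           = true
weaklyDecreasing (x ∷ [])     = true
weaklyDecreasing (x ∷ y ∷ xs) = (y ≤ᵇ x) ∧ weaklyDecreasing (y ∷ xs)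

allRows : {r m : ℕ} → (Vec ℕ m → Bool) → Matrix r m → Bool
allRows p []       = true
allRows p (x ∷ xs) = p x ∧ allRows p xs

vertices : (j k r : ℕ) → List (Matrix r (k ∸ 1))
vertices j k r = filterᵇ (allRows weaklyDecreasing) (allVecs (allVecs (upTo j) (k ∸ 1)) r)

zeroMatrix : (k r : ℕ) → Matrix r (k ∸ 1)
zeroMatrix k r = replicate r (replicate (k ∸ 1) 0)

data Δ : Set where
  same plus minus big : Δ

cmp : ℕ → ℕ → Δ
cmp a b = if a ≡ᵇ b then same
          else if a ≡ᵇ suc b then plus
          else if b ≡ᵇ suc a then minus
          else big

diffs : {r m : ℕ} → Matrix r m → Matrix r m → List Δ
diffs A B = concat (toList (zipWith (λ u v → toList (zipWith cmp u v)) A B))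

isSame isPlus isMinus isBig : Δ → Bool
isSame same = true
isSame _ = false
isPlus plus = true
isPlus _ = false
isMinus minus = true
isMinus _ = false
isBig big = true
isBig _ = false

count : (Δ → Bool) → List Δ → ℕ
count p xs = length (filterᵇ p xs)

distinctBelow : (j : ℕ) {m : ℕ} → Vec ℕ m → ℕ
distinctBelow j row = length (filterᵇ (λ v → any (λ x → v ≡ᵇ x) (toList row)) (upTo (j ∸ 1)))

loops : (j : ℕ) {r m : ℕ} → Matrix r m → ℕ
loops j A = suc (sum (toList (Data.Vec.map (distinctBelow j) A)))
  where import Data.Vec

-- e(A , A'): 1 + d_1 + ... + d_r if A = A';
-- 1 if A - A' = ± E_iℓ or A - A' = E_iℓ - E_i'ℓ' with (i,ℓ) ≠ (i',ℓ');
-- 0 otherwise.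
edges : (j : ℕ) {r m : ℕ} → Matrix r m → Matrix r m → ℕ
edges j A B =
  let ds = diffs A B
      np = count isPlus ds
      nm = count isMinus ds
      nb = count isBig ds
  in if nb ≡ᵇ 0
     then (if (np ≡ᵇ 0) ∧ (nm ≡ᵇ 0) then loops j A
           else if (np ≤ᵇ 1) ∧ (nm ≤ᵇ 1) then 1 else 0)
     else 0

equalᵇ : {r m : ℕ} → Matrix r m → Matrix r m → Bool
equalᵇ A B = all isSame (diffs A B)

walks : (j k r : ℕ) → ℕ → Matrix r (k ∸ 1) → Matrix r (k ∸ 1) → ℕ
walks j k r zero    A B = if equalᵇ A B then 1 else 0
walks j k r (suc m) A B = sum (map (λ C → edges j A C * walks j k r m C B) (vertices j k r))

{-# OPTIONS --safe #-}
module Submission where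

-- Read a coloured partition from its last vertex down and keep, for each colour, a
-- standard tableau on the left ends of the arcs that cover the current gap: the right
-- end of an arc row inserts its left end, and at its left end the entry, by then the
-- largest one, is deleted (Chen, Deng, Du, Stanley and Yan).  A row insertion can be
-- undone once the corner in which the shape grew is known, so coloured partitions
-- correspond to closed walks of r-tuples of Young diagrams.  By Schensted's theorem the
-- longest row (column) of a tableau is the size of the largest monochromatic nesting
-- (crossing) over the gap; hence cr < j and ne < k say that every diagram fits in a box,
-- and the vertices of the graph are the conjugates of these diagrams.
-- Between two consecutive closings at most one box is added and then at most one is
-- removed, so e(A , C) has to be the number of vertices B that equal or cover both A and
-- C.  For A ≠ C the only candidate is the entrywise maximum; for A = C there are A itself
-- and one B for each corner that can be added, i.e. for each distinct entry < j - 1.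

open import Defs
open import Data.Bool using (Bool; true; false; if_then_else_; T; T?; _∧_)
open import Data.Bool.ListAction using (any)
open import Data.Bool.Properties using (T-∧)
open import Data.Fin using (Fin; zero; suc; toℕ; fromℕ<; opposite)
open import Data.Fin.Properties using (toℕ<n; toℕ-fromℕ<; toℕ-injective; opposite-prop)
open import Data.List using (List; []; _∷_; map; concatMap; _++_; length; filter; upTo; allFin)
open import Data.List.Membership.Propositional using (_∈_; _∉_; find; lose)
open import Data.List.Membership.Propositional.Properties using (∈-concatMap⁺; ∈-concatMap⁻; ∈-∃++; ∈-++⁻; ∈-++⁺ˡ; ∈-++⁺ʳ; ∈-map⁻; ∈-map⁺; ∈-filter⁺; ∈-filter⁻; ∈-upTo⁺; ∈-upTo⁻; ∈-allFin)
open import Data.List.Membership.Propositional.Properties.WithK using (unique∧set⇒bag)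
open import Data.List.Properties using (map-++; length-++; filter-++; length-map; map-tabulate; filter-≐; map-cong)
open import Data.List.Relation.Binary.BagAndSetEquality using (∼bag⇒↭)
open import Data.List.Relation.Unary.Any using (here; there)
open import Data.List.Relation.Unary.Any.Properties using (any⁺; any⁻)
open import Data.List.Relation.Unary.Unique.Propositional using (Unique; []; _∷_)
open import Data.List.Relation.Unary.Unique.Propositional.Properties using (Unique[x∷xs]⇒x∉xs)
open import Data.Maybe using (Maybe; just; nothing)
open import Data.Maybe.Properties using (just-injective)
open import Data.Nat using (ℕ; zero; suc; _+_; _*_; _≤_; _<_; z≤n; s≤s; _>_; _⊔_; _≤ᵇ_; _≡ᵇ_; _≤′_; ≤′-refl; ≤′-step; _∸_)
open import Data.Nat.Induction using (<-rec)
open import Data.Nat.ListAction using (sum)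
open import Data.Nat.ListAction.Properties using (sum-++; sum-↭)
open import Data.Nat.Properties
open import Data.Product using (∃; _×_; _,_; proj₁; proj₂; ∃₂)
open import Data.Sum using (_⊎_; inj₁; inj₂)
open import Data.Unit using (⊤; tt)
open import Data.Vec using (Vec; []; _∷_; replicate; lookup; toList; zipWith; updateAt; tabulate)
open import Data.Vec.Membership.Propositional.Properties using (∈-toList⁺; ∈-toList⁻; ∈-lookup)
open import Data.Vec.Properties using (lookup∘updateAt; lookup∘updateAt′; tabulate∘lookup; tabulate-cong; lookup-zipWith; ∷-injective; lookup∘tabulate; lookup-replicate)
open import Data.Vec.Relation.Unary.Any.Properties using (lookup-index)
open import Function using (_∘_; mk⇔; Equivalence)
open import Relation.Binary using (DecidableEquality; tri<; tri≈; tri>)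
open import Relation.Binary.PropositionalEquality using (_≡_; _≢_; refl; sym; trans; cong; cong₂; subst; module ≡-Reasoning; subst₂)
open import Relation.Nullary using (¬_; Dec; yes; no; does; contradiction; _⊎-dec_; _×-dec_; _→-dec_; ¬?)
open import Relation.Unary using (Decidable)
import Data.Fin.Properties as Fin
import Data.List as List
import Data.List.Properties as List
import Data.List.Relation.Binary.Permutation.Propositional.Properties as Perm
import Data.List.Relation.Unary.All as All
import Data.List.Relation.Unary.All.Properties as AllP
import Data.List.Relation.Unary.AllPairs as AllPairs
import Data.List.Relation.Unary.Unique.Propositional.Properties as Unique
import Data.Maybe as Maybe
import Data.Maybe.Properties as Maybe
import Data.Product.Properties as Product
import Data.Vec as Vec
import Data.Vec.Properties as Vec
import Data.Vec.Relation.Unary.Any as VecAny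
open All using (All)

-- The reading is used in both directions. Downwards an insertion is forced by the arc, and that is
-- where Schensted's argument runs. Upwards from vertex 0 it becomes the removal of a corner; any
-- corner may be chosen, and which ones exist depends on the shape alone. This is why a count of
-- tableaux descends to a count of matrices, although the label that leaves depends on the whole
-- tableau. The obstacle is that entries are deleted on the way down, so Schensted's theorem is
-- needed for a shrinking alphabet. What happens to the labels below a bound never depends on the
-- labels above it; hence the history of a tableau may forget a label as soon as it is deleted, and
-- at every gap it still contains all arcs over that gap. The exponent `n - 1` arises because a step
-- of the walk is an opening at one vertex followed by a closing at the next: vertex 0 closes
-- nothing and the last vertex opens nothing.

-- Duplicate-free lists and finite sums.

module ListSums where

  private variable
    A B : Set
    xs : List A

  ∈-concatMap-∃ : (f : A → List B) {xs : List A} {z : B} → z ∈ concatMap f xs →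
                  ∃ λ x → x ∈ xs × z ∈ f x
  ∈-concatMap-∃ f z∈ = find (∈-concatMap⁻ f z∈)

  ∃-∈-concatMap : (f : A → List B) {xs : List A} {x : A} {z : B} → x ∈ xs → z ∈ f x →
                  z ∈ concatMap f xs
  ∃-∈-concatMap f x∈ z∈ = ∈-concatMap⁺ f (lose x∈ z∈)

  unique-tail : {x : A} → Unique (x ∷ xs) → Unique xs
  unique-tail = AllPairs.tail

  unique-∷ : {x : A} → x ∉ xs → Unique xs → Unique (x ∷ xs)
  unique-∷ x∉ u = All.tabulate (λ y∈ → λ { refl → x∉ y∈ }) AllPairs.∷ u

  unique-concatMap : (f : A → List B) {xs : List A} → Unique xs →
    (∀ {x} → x ∈ xs → Unique (f x)) →
    (∀ {x y z} → x ∈ xs → y ∈ xs → z ∈ f x → z ∈ f y → x ≡ y) → Unique (concatMap f xs)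
  unique-concatMap f {[]} _ _ _ = []
  unique-concatMap f {x ∷ xs} u uf d =
    Unique.++⁺ (uf (here refl))
      (unique-concatMap f (unique-tail u) (uf ∘ there) (λ x∈ y∈ → d (there x∈) (there y∈)))
      λ { (z∈ , z∈′) → let (y , y∈ , z∈″) = ∈-concatMap-∃ f z∈′ in
            Unique[x∷xs]⇒x∉xs u (subst (_∈ xs) (sym (d (here refl) (there y∈) z∈ z∈″)) y∈) }

  unique-map : (f : A → B) {xs : List A} → Unique xs →
    (∀ {x y} → x ∈ xs → y ∈ xs → f x ≡ f y → x ≡ y) → Unique (map f xs)
  unique-map f {[]} _ _ = []
  unique-map f {x ∷ xs} u inj =
    unique-∷ (λ fx∈ → let (y , y∈ , eq) = ∈-map⁻ f fx∈ in
                Unique[x∷xs]⇒x∉xs u (subst (_∈ xs) (sym (inj (here refl) (there y∈) eq)) y∈))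
      (unique-map f (unique-tail u) (λ x∈ y∈ → inj (there x∈) (there y∈)))

  -- The injection is a relation rather than a function, so that one relation between coloured
  -- partitions and label lists serves for both inequalities of the final count.
  injection⇒length≤ : (R : A → B → Set) {xs : List A} {ys : List B} → Unique xs →
    (∀ {x} → x ∈ xs → ∃ λ y → y ∈ ys × R x y) →
    (∀ {x x' y} → x ∈ xs → x' ∈ xs → R x y → R x' y → x ≡ x') → length xs ≤ length ys
  injection⇒length≤ R {[]} _ _ _ = z≤n
  injection⇒length≤ R {x ∷ xs} {ys} u tot inj with tot (here refl)
  ... | y , y∈ , Rxy with ∈-∃++ y∈
  ...   | as , bs , refl = subst (suc (length xs) ≤_) (sym eq)
            (s≤s (injection⇒length≤ R {ys = as ++ bs} (unique-tail u) tot′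
              (λ x∈ x∈′ → inj (there x∈) (there x∈′))))
    where
    eq : length (as ++ y ∷ bs) ≡ suc (length (as ++ bs))
    eq = trans (length-++ as) (trans (+-suc (length as) (length bs)) (cong suc (sym (length-++ as))))
    tot′ : ∀ {x'} → x' ∈ xs → ∃ λ y' → y' ∈ as ++ bs × R x' y'
    tot′ x∈ with tot (there x∈)
    ... | y' , y∈′ , R′ with ∈-++⁻ as y∈′
    ...   | inj₁ p           = y' , ∈-++⁺ˡ p , R′
    ...   | inj₂ (there p)   = y' , ∈-++⁺ʳ as p , R′
    ...   | inj₂ (here refl) = contradiction
              (subst (_∈ xs) (sym (inj (here refl) (there x∈) Rxy R′)) x∈) (Unique[x∷xs]⇒x∉xs u)

  sum-cong : {f g : A → ℕ} → (∀ {x} → x ∈ xs → f x ≡ g x) → sum (map f xs) ≡ sum (map g xs)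
  sum-cong {xs = []}     _  = refl
  sum-cong {xs = x ∷ xs} eq = cong₂ _+_ (eq (here refl)) (sum-cong (eq ∘ there))

  sum-concatMap : (h : B → ℕ) (f : A → List B) (xs : List A) →
    sum (map h (concatMap f xs)) ≡ sum (map (λ x → sum (map h (f x))) xs)
  sum-concatMap h f []       = refl
  sum-concatMap h f (x ∷ xs) = trans (cong sum (map-++ h (f x) (concatMap f xs)))
    (trans (sum-++ (map h (f x)) _) (cong (_ +_) (sum-concatMap h f xs)))

  sum-+ : (f g : A → ℕ) (xs : List A) →
    sum (map (λ x → f x + g x) xs) ≡ sum (map f xs) + sum (map g xs)
  sum-+ f g []       = refl
  sum-+ f g (x ∷ xs) rewrite sum-+ f g xs = +-interchange (f x) (g x) _ _
    where
    +-interchange : ∀ a b c d → (a + b) + (c + d) ≡ (a + c) + (b + d)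
    +-interchange a b c d = trans (+-assoc a b _) (trans (cong (a +_)
      (trans (sym (+-assoc b c d)) (trans (cong (_+ d) (+-comm b c)) (+-assoc c b d)))) (sym (+-assoc a c _)))

  sum-*ˡ : (k : ℕ) (f : A → ℕ) (xs : List A) → sum (map (λ x → k * f x) xs) ≡ k * sum (map f xs)
  sum-*ˡ k f []       = sym (*-zeroʳ k)
  sum-*ˡ k f (x ∷ xs) = trans (cong (k * f x +_) (sum-*ˡ k f xs)) (sym (*-distribˡ-+ k (f x) _))

  sum-swap : (f : A → B → ℕ) (xs : List A) (ys : List B) →
    sum (map (λ x → sum (map (f x) ys)) xs) ≡ sum (map (λ y → sum (map (λ x → f x y) xs)) ys)
  sum-swap f [] ys = sym (zeros ys)
    where zeros : ∀ (ys : List B) → sum (map (λ _ → 0) ys) ≡ 0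
          zeros []       = refl
          zeros (_ ∷ ys) = zeros ys
  sum-swap f (x ∷ xs) ys = trans (cong (_ +_) (sum-swap f xs ys)) (sym (sum-+ (f x) _ ys))

  ι : {P : Set} → Dec P → ℕ
  ι d = if does d then 1 else 0

  ι-yes : {P : Set} (d : Dec P) → P → ι d ≡ 1
  ι-yes (yes _) _ = refl
  ι-yes (no ¬p) p = contradiction p ¬p

  ι-no : {P : Set} (d : Dec P) → ¬ P → ι d ≡ 0
  ι-no (yes p) ¬p = contradiction p ¬p
  ι-no (no _)  _  = refl

  ι-*-0 : {P Q : Set} (d : Dec P) (e : Dec Q) → ¬ (P × Q) → ι d * ι e ≡ 0
  ι-*-0 (yes p) (yes q) ¬pq = contradiction (p , q) ¬pq
  ι-*-0 (yes _) (no _)  _   = refl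
  ι-*-0 (no _)  _       _   = refl

  ι-idem : {P : Set} (d : Dec P) → ι d * ι d ≡ ι d * 1
  ι-idem (yes _) = refl
  ι-idem (no _)  = refl

  sum-filter : {P : A → Set} (P? : Decidable P) (h : A → ℕ) (xs : List A) →
    sum (map h (filter P? xs)) ≡ sum (map (λ x → ι (P? x) * h x) xs)
  sum-filter P? h []       = refl
  sum-filter P? h (x ∷ xs) with P? x
  ... | yes _ = cong₂ _+_ (sym (+-identityʳ (h x))) (sum-filter P? h xs)
  ... | no _  = sum-filter P? h xs

  sum-length : (xs : List A) → sum (map (λ _ → 1) xs) ≡ length xs
  sum-length []       = refl
  sum-length (_ ∷ xs) = cong suc (sum-length xs)

  length-concatMap : (f : A → List B) (xs : List A) →
    length (concatMap f xs) ≡ sum (map (length ∘ f) xs)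
  length-concatMap f []       = refl
  length-concatMap f (x ∷ xs) = trans (length-++ (f x)) (cong (_ +_) (length-concatMap f xs))

  -- Duplicate-free lists with the same members are permutations of each other. This turns the
  -- correspondence between options and neighbouring vertices into an equality of weighted sums.
  sum-set : (h : A → ℕ) {xs ys : List A} → Unique xs → Unique ys →
    (∀ {x} → x ∈ xs → x ∈ ys) → (∀ {x} → x ∈ ys → x ∈ xs) → sum (map h xs) ≡ sum (map h ys)
  sum-set h u v to from = sum-↭ (Perm.map⁺ h (∼bag⇒↭ (unique∧set⇒bag u v (mk⇔ to from))))

open ListSums

-- Tableaux as lattice words, row insertion and its inverse.

module Tableaux where

  private variable
    r i : ℕ

  Key : ℕ → Set
  Key r = Fin r × ℕ

  -- A tableau on the labels 0 … i-1 is a vector read from the largest label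
  -- down, so the label of an entry is the length of the tail behind it.
  Cell : ℕ → Set
  Cell r = Maybe (Key r)

  _≟K_ : DecidableEquality (Key r)
  _≟K_ = Product.≡-dec Fin._≟_ _≟_

  _≟C_ : DecidableEquality (Cell r)
  _≟C_ = Maybe.≡-dec _≟K_

  δ : Cell r → Fin r → ℕ → ℕ
  δ nothing  c q = 0
  δ (just k) c q = if does (k ≟K (c , q)) then 1 else 0

  δ-hit : (c : Fin r) (q : ℕ) → δ (just (c , q)) c q ≡ 1
  δ-hit c q with (c , q) ≟K (c , q)
  ... | yes _ = refl
  ... | no ¬p = contradiction refl ¬p

  δ-miss : {x : Cell r} {c : Fin r} {q : ℕ} → x ≢ just (c , q) → δ x c q ≡ 0
  δ-miss {x = nothing} _ = refl
  δ-miss {x = just k} {c} {q} ne with k ≟K (c , q)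
  ... | yes refl = contradiction refl ne
  ... | no _     = refl

  -- cnt U c q is the length of row q of the tableau of colour c.
  cnt : Vec (Cell r) i → Fin r → ℕ → ℕ
  cnt []      c q = 0
  cnt (x ∷ U) c q = δ x c q + cnt U c q

  AddOK : (Fin r → ℕ → ℕ) → Cell r → Set
  AddOK α nothing            = ⊤
  AddOK α (just (c , zero))  = ⊤
  AddOK α (just (c , suc q)) = α c (suc q) < α c q

  -- The entries with label < b form a Young diagram for every b.
  L : Vec (Cell r) i → Set
  L []      = ⊤
  L (x ∷ U) = AddOK (cnt U) x × L U

  Part : (Fin r → ℕ → ℕ) → Set
  Part α = ∀ c q → α c (suc q) ≤ α c q

  L⇒Part : (U : Vec (Cell r) i) → L U → Part (cnt U)
  L⇒Part []      _        c q = z≤n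
  L⇒Part (x ∷ U) (ok , l) c q with x ≟C just (c , suc q)
  ... | yes refl rewrite δ-hit c (suc q) = ≤-trans ok (m≤n+m _ _)
  ... | no ne    rewrite δ-miss ne = ≤-trans (L⇒Part U l c q) (m≤n+m _ _)

  -- Row insertion of the label p with colour c.  Scanning the labels above p, the
  -- carried row q is the row in which the shape has grown so far.
  data Ins (c : Fin r) : Vec (Cell r) i → ℕ → Vec (Cell r) i → ℕ → Set where
    here : {U : Vec (Cell r) i} → Ins c (nothing ∷ U) i (just (c , 0) ∷ U) 0
    bump : {U T : Vec (Cell r) i} {p q : ℕ} → Ins c U p T q →
           Ins c (just (c , q) ∷ U) p (just (c , suc q) ∷ T) (suc q)
    keep : {U T : Vec (Cell r) i} {p q : ℕ} {x : Cell r} → Ins c U p T q →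
           x ≢ just (c , q) → Ins c (x ∷ U) p (x ∷ T) q

  private variable
    c : Fin r
    p q : ℕ

  Ins-< : {U T : Vec (Cell r) i} → Ins c U p T q → p < i
  Ins-< here       = ≤-refl
  Ins-< (bump d)   = m≤n⇒m≤1+n (Ins-< d)
  Ins-< (keep d _) = m≤n⇒m≤1+n (Ins-< d)

  Ins-functional : {U T T' : Vec (Cell r) i} {q' : ℕ} → Ins c U p T q → Ins c U p T' q' →
                   T ≡ T' × q ≡ q'
  Ins-functional here here = refl , refl
  Ins-functional here (keep e _) = contradiction (Ins-< e) (<-irrefl refl)
  Ins-functional (bump d) (bump e) = let (t , _) = Ins-functional d e in cong (_ ∷_) t , refl
  Ins-functional (bump d) (keep e ne) with Ins-functional d e
  ... | refl , refl = contradiction refl ne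
  Ins-functional (keep d _) here = contradiction (Ins-< d) (<-irrefl refl)
  Ins-functional (keep d ne) (bump e) with Ins-functional d e
  ... | refl , refl = contradiction refl ne
  Ins-functional (keep d _) (keep e _) with Ins-functional d e
  ... | refl , refl = refl , refl

  -- In `bump` the label leaves row `q`, but the smaller labels have just made that row longer by
  -- one, so the net growth is in row `q + 1`.
  Ins-cnt : {U T : Vec (Cell r) i} → Ins c U p T q → ∀ c' q' →
            cnt T c' q' ≡ δ (just (c , q)) c' q' + cnt U c' q'
  Ins-cnt here c' q' = refl
  Ins-cnt {c = c} (bump {U = U} {q = q} d) c' q'
    rewrite Ins-cnt d c' q' = refl
  Ins-cnt {c = c} (keep {U = U} {q = q} {x = x} d _) c' q' rewrite Ins-cnt d c' q' =
    trans (sym (+-assoc a b _)) (trans (cong (_+ cnt U c' q') (+-comm a b)) (+-assoc b a _))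
    where a = δ x c' q'
          b = δ (just (c , q)) c' q'

  Ins-cnt-hit : {U T : Vec (Cell r) i} → Ins c U p T q → cnt T c q ≡ suc (cnt U c q)
  Ins-cnt-hit {c = c} {q = q} {U = U} d = trans (Ins-cnt d c q) (cong (_+ cnt U c q) (δ-hit c q))

  Ins-cnt-miss : {U T : Vec (Cell r) i} → Ins c U p T q → ∀ {c' q'} → (c , q) ≢ (c' , q') →
                 cnt T c' q' ≡ cnt U c' q'
  Ins-cnt-miss {U = U} d {c'} {q'} ne = trans (Ins-cnt d c' q') (cong (_+ cnt U c' q') (δ-miss (ne ∘ just-injective)))

  Ins-cnt-≤ : {U T : Vec (Cell r) i} → Ins c U p T q → ∀ c' q' → cnt U c' q' ≤ cnt T c' q'
  Ins-cnt-≤ d c' q' rewrite Ins-cnt d c' q' = m≤n+m _ _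

  -- A label kept in its row could lose its place only if the smaller labels had grown that same
  -- row. This is exactly the case sent to `bump`, and there row `q` has become longer, which makes
  -- room in row `q + 1`.
  Ins-L : {U T : Vec (Cell r) i} → Ins c U p T q → L U → L T
  Ins-L here (_ , l) = tt , l
  Ins-L {c = c} (bump {U = U} {T} {q = q} d) (ok , l)
    = subst (cnt T c (suc q) <_) (sym (Ins-cnt-hit d))
        (s≤s (subst (_≤ cnt U c q) (sym (Ins-cnt-miss d (λ ()))) (L⇒Part U l c q)))
    , Ins-L d l
  Ins-L (keep {x = nothing} d _) (ok , l) = tt , Ins-L d l
  Ins-L (keep {x = just (_ , zero)} d _) (ok , l) = tt , Ins-L d l
  Ins-L (keep {x = just (c' , suc q')} d ne) (ok , l)
    = <-≤-trans (subst (_< _) (sym (Ins-cnt-miss d (λ { refl → ne refl }))) ok) (Ins-cnt-≤ d c' q')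
    , Ins-L d l

  Removable : (Fin r → ℕ → ℕ) → Fin r → ℕ → Set
  Removable α c q = α c (suc q) < α c q

  -- Reverse row insertion from the corner at the end of row q; the junk value at []
  -- is never reached from a removable corner.
  rev : Fin r → ℕ → Vec (Cell r) i → Vec (Cell r) i × ℕ
  rev c q [] = [] , 0
  rev c q (x ∷ T) with x ≟C just (c , q)
  ... | no _ = let (U , p) = rev c q T in x ∷ U , p
  rev {i = suc i} c zero    (x ∷ T) | yes _ = nothing ∷ T , i
  rev             c (suc q) (x ∷ T) | yes _ = let (U , p) = rev c q T in just (c , q) ∷ U , p

  -- If the largest label ends row `q + 1`, its condition `ok` is literally the removability of row
  -- `q` in the tableau of the smaller labels. If it lies elsewhere, dropping it can only shorten
  -- the row below the corner. So the recursion never loses its corner.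
  rev-Ins : (T : Vec (Cell r) i) → L T → Removable (cnt T) c q →
            let (U , p) = rev c q T in Ins c U p T q × L U
  rev-Ins [] _ ()
  rev-Ins {c = c} {q = q} (x ∷ T) (ok , l) rm with x ≟C just (c , q)
  rev-Ins {c = c} {q = zero}  (x ∷ T) (ok , l) rm | yes refl = here , tt , l
  rev-Ins {c = c} {q = suc q} (x ∷ T) (ok , l) rm | yes refl with rev-Ins {q = q} T l ok
  ... | d , l' = bump d , addOK q d , l'
    where
    addOK : ∀ q → Ins c (proj₁ (rev c q T)) (proj₂ (rev c q T)) T q →
            AddOK (cnt (proj₁ (rev c q T))) (just (c , q))
    addOK zero d = tt
    addOK (suc q) d = subst₂ _≤_ (Ins-cnt-hit d) (Ins-cnt-miss d (λ ())) (L⇒Part T l c q)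
  rev-Ins {c = c} {q = q} (x ∷ T) (ok , l) rm | no ne with rev-Ins {q = q} T l rm'
    where
    rm' : Removable (cnt T) c q
    rm' = ≤-<-trans (m≤n+m _ (δ x c (suc q))) (subst (λ z → δ x c (suc q) + cnt T c (suc q) < z + cnt T c q) (δ-miss ne) rm)
  ... | d , l' = keep d ne , addOK x ok ne rm , l'
    where
    addOK : ∀ x → AddOK (cnt T) x → x ≢ just (c , q) →
            δ x c (suc q) + cnt T c (suc q) < δ x c q + cnt T c q → AddOK (cnt (proj₁ (rev c q T))) x
    addOK nothing _ _ _ = tt
    addOK (just (c' , zero)) _ _ _ = tt
    addOK (just (c' , suc q')) ok ne rm with (c , q) ≟K (c' , q')
    ... | no ne' = ≤-<-trans (Ins-cnt-≤ d c' (suc q')) (subst (_ <_) (Ins-cnt-miss d ne') ok)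
    -- Here `x` lies in the row directly below the corner. Removability counts `x` itself, so the
    -- two rows of `T` differ by more than one box and the loss of the corner is affordable.
    ... | yes refl = ≤-pred (subst₂ (λ a b → suc a < b) (Ins-cnt-miss d (λ ())) (Ins-cnt-hit d)
                       (subst₂ (λ a b → a + cnt T c (suc q) < b + cnt T c q)
                         (δ-hit c (suc q)) (δ-miss ne) rm))

  Ins-injective : {T U U' : Vec (Cell r) i} {p p' : ℕ} → Ins c U p T q → Ins c U' p' T q →
                  U ≡ U' × p ≡ p'
  Ins-injective here here = refl , refl
  Ins-injective here (keep _ ne) = contradiction refl ne
  Ins-injective (bump d) (bump e) with Ins-injective d e
  ... | refl , refl = refl , refl
  Ins-injective (bump d) (keep e ne) = contradiction refl ne
  Ins-injective (keep _ ne) here = contradiction refl ne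
  Ins-injective (keep d ne) (bump e) = contradiction refl ne
  Ins-injective (keep d _) (keep e _) with Ins-injective d e
  ... | refl , refl = refl , refl

open Tableaux

-- Schensted's theorem for a tableau under insertions and deletions.

module Schensted where

  private variable
    r i p q a b q' t u x y n d : ℕ
    c c' : Fin r
    k k' : Key r
    w : Cell r

  infix 4 _∋_↦_

  data _∋_↦_ : Vec (Cell r) i → ℕ → Key r → Set where
    head : {U : Vec (Cell r) i} {k : Key r} → just k ∷ U ∋ i ↦ k
    tail : {U : Vec (Cell r) i} {x : Cell r} {b : ℕ} {k : Key r} → U ∋ b ↦ k → x ∷ U ∋ b ↦ k

  ∋-< : {U : Vec (Cell r) i} → U ∋ b ↦ k → b < i
  ∋-< head     = ≤-refl
  ∋-< (tail e) = m≤n⇒m≤1+n (∋-< e)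

  ∋-tail : {U : Vec (Cell r) i} → w ∷ U ∋ b ↦ k → b < i → U ∋ b ↦ k
  ∋-tail head     lt = contradiction lt (<-irrefl refl)
  ∋-tail (tail e) _  = e

  ∋-functional : {U : Vec (Cell r) i} → U ∋ b ↦ k → U ∋ b ↦ k' → k ≡ k'
  ∋-functional head     head     = refl
  ∋-functional head     (tail e) = contradiction (∋-< e) (<-irrefl refl)
  ∋-functional (tail e) head     = contradiction (∋-< e) (<-irrefl refl)
  ∋-functional (tail e) (tail f) = ∋-functional e f

  ∋⇒cnt : {U : Vec (Cell r) i} → U ∋ b ↦ (c , q) → 0 < cnt U c q
  ∋⇒cnt {c = c} {q = q} (head {U = U}) = subst (λ v → 0 < v + cnt U c q) (sym (δ-hit c q)) (s≤s z≤n)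
  ∋⇒cnt (tail e) = ≤-trans (∋⇒cnt e) (m≤n+m _ _)

  cnt⇒∋ : (U : Vec (Cell r) i) → 0 < cnt U c q → ∃ λ b → U ∋ b ↦ (c , q)
  cnt⇒∋ {c = c} {q = q} (x ∷ U) lt with x ≟C just (c , q)
  ... | yes refl = _ , head
  ... | no ne    = let (b , e) = cnt⇒∋ U (subst (λ v → 0 < v + cnt U c q) (δ-miss ne) lt) in b , tail e

  -- Ev d q b: in the course of the insertion d the label b enters row q.
  data Ev {c : Fin r} : {U T : Vec (Cell r) i} → Ins c U p T q → ℕ → ℕ → Set where
    ev-here  : {U : Vec (Cell r) i} → Ev (here {c = c} {U = U}) 0 i
    ev-bump  : {U T : Vec (Cell r) i} {d : Ins c U p T q} → Ev (bump d) (suc q) i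
    in-bump : {U T : Vec (Cell r) i} {d : Ins c U p T q} → Ev d q' b → Ev (bump d) q' b
    in-keep : {U T : Vec (Cell r) i} {d : Ins c U p T q} {ne : w ≢ just (c , q)} →
               Ev d q' b → Ev (keep d ne) q' b

  Ev-∋ : {U T : Vec (Cell r) i} {d : Ins c U p T q} → Ev d q' b → T ∋ b ↦ (c , q')
  Ev-∋ ev-here      = head
  Ev-∋ ev-bump      = head
  Ev-∋ (in-bump e) = tail (Ev-∋ e)
  Ev-∋ (in-keep e) = tail (Ev-∋ e)

  Ev-0 : {U T : Vec (Cell r) i} {d : Ins c U p T q} → Ev d 0 b → b ≡ p
  Ev-0 ev-here      = refl
  Ev-0 (in-bump e) = Ev-0 e
  Ev-0 (in-keep e) = Ev-0 e

  Ev-inserted : {U T : Vec (Cell r) i} (d : Ins c U p T q) → Ev d 0 p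
  Ev-inserted here        = ev-here
  Ev-inserted (bump d)    = in-bump (Ev-inserted d)
  Ev-inserted (keep d ne) = in-keep (Ev-inserted d)

  -- The insertion ends when an entrant exceeds its whole row; in `keep` a larger label of that row
  -- is excluded by `ne`.
  Ev-final : {U T : Vec (Cell r) i} (d : Ins c U p T q) →
            ∃ λ a → Ev d q a × (∀ {b'} → U ∋ b' ↦ (c , q) → b' < a)
  Ev-final here = _ , ev-here , λ { (tail e) → ∋-< e }
  Ev-final (bump d) = _ , ev-bump , λ { (tail e) → ∋-< e }
  Ev-final (keep d ne) =
    let (a , e , f) = Ev-final d in a , in-keep e , λ { head → contradiction refl ne ; (tail e') → f e' }

  -- This recovers the usual bumping rule from the local one: the label that displaces `b` falls
  -- between `b` and its predecessor in the row.
  Ev-bumped : {U T : Vec (Cell r) i} {d : Ins c U p T q} → Ev d (suc q') b →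
              U ∋ b ↦ (c , q') ×
              (∃ λ a → Ev d q' a × a < b × (∀ {b'} → U ∋ b' ↦ (c , q') → b' < b → b' < a))
  Ev-bumped (ev-bump {d = d}) =
    let (a , e , f) = Ev-final d
    in head , a , in-bump e , ∋-< (Ev-∋ e) , λ e' lt → f (∋-tail e' lt)
  Ev-bumped (in-bump e) =
    let (o , a , e' , lt , f) = Ev-bumped e
    in tail o , a , in-bump e' , lt , λ e'' lt' → f (∋-tail e'' (<-trans lt' (∋-< o))) lt'
  Ev-bumped (in-keep e) =
    let (o , a , e' , lt , f) = Ev-bumped e
    in tail o , a , in-keep e' , lt , λ e'' lt' → f (∋-tail e'' (<-trans lt' (∋-< o))) lt'

  Ev-next : {U T : Vec (Cell r) i} {d : Ins c U p T q} → Ev d q' a →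
            q' ≡ q ⊎ (∃ λ b → Ev d (suc q') b × a < b)
  Ev-next ev-here = inj₁ refl
  Ev-next ev-bump = inj₁ refl
  Ev-next (in-bump e) with Ev-next e
  ... | inj₁ refl          = inj₂ (_ , ev-bump , ∋-< (Ev-∋ e))
  ... | inj₂ (b , e' , lt) = inj₂ (b , in-bump e' , lt)
  Ev-next (in-keep e) with Ev-next e
  ... | inj₁ refl          = inj₁ refl
  ... | inj₂ (b , e' , lt) = inj₂ (b , in-keep e' , lt)

  -- An entrant that does not exceed its whole row must displace something. If `x` is the largest
  -- label and stays, the insertion had already left row `q'` among the smaller labels, so the
  -- displaced label is below `x`.
  Ev-bumps : {U T : Vec (Cell r) i} {d : Ins c U p T q} → Ev d q' a → U ∋ x ↦ (c , q') → a < x →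
             ∃ λ b → Ev d (suc q') b × a < b × b ≤ x
  Ev-bumps ev-here o lt = contradiction (≤-pred (∋-< o)) (<⇒≱ lt)
  Ev-bumps ev-bump o lt = contradiction (≤-pred (∋-< o)) (<⇒≱ lt)
  Ev-bumps (in-bump e) head lt = _ , ev-bump , lt , ≤-refl
  Ev-bumps (in-bump e) (tail o) lt =
    let (b , e' , l , l') = Ev-bumps e o lt in b , in-bump e' , l , l'
  Ev-bumps (in-keep {ne = ne} e) head lt with Ev-next e
  ... | inj₁ refl         = contradiction refl ne
  ... | inj₂ (b , e' , l) = b , in-keep e' , l , <⇒≤ (∋-< (Ev-∋ e'))
  Ev-bumps (in-keep e) (tail o) lt =
    let (b , e' , l , l') = Ev-bumps e o lt in b , in-keep e' , l , l'

  stays-or-bumped : {U T : Vec (Cell r) i} (d : Ins c U p T q) → U ∋ x ↦ (c' , q') →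
                    T ∋ x ↦ (c' , q') ⊎ (c ≡ c' × Ev d (suc q') x)
  stays-or-bumped here (tail o) = inj₁ (tail o)
  stays-or-bumped (bump d) head = inj₂ (refl , ev-bump)
  stays-or-bumped (bump d) (tail o) with stays-or-bumped d o
  ... | inj₁ o'         = inj₁ (tail o')
  ... | inj₂ (refl , e) = inj₂ (refl , in-bump e)
  stays-or-bumped (keep d ne) head = inj₁ head
  stays-or-bumped (keep d ne) (tail o) with stays-or-bumped d o
  ... | inj₁ o'         = inj₁ (tail o')
  ... | inj₂ (refl , e) = inj₂ (refl , in-keep e)

  old-or-entered : {U T : Vec (Cell r) i} (d : Ins c U p T q) → T ∋ x ↦ (c' , q') →
                   U ∋ x ↦ (c' , q') ⊎ (c ≡ c' × Ev d q' x)
  old-or-entered here head = inj₂ (refl , ev-here)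
  old-or-entered here (tail o) = inj₁ (tail o)
  old-or-entered (bump d) head = inj₂ (refl , ev-bump)
  old-or-entered (bump d) (tail o) with old-or-entered d o
  ... | inj₁ o'         = inj₁ (tail o')
  ... | inj₂ (refl , e) = inj₂ (refl , in-bump e)
  old-or-entered (keep d ne) head = inj₁ head
  old-or-entered (keep d ne) (tail o) with old-or-entered d o
  ... | inj₁ o'         = inj₁ (tail o')
  ... | inj₂ (refl , e) = inj₂ (refl , in-keep e)

  -- The vertices n-1, n-2, … are processed in this order; the state of length i has
  -- absorbed the arcs with right end ≥ i and restricts to left ends < i.
  data Rev {r : ℕ} (n : ℕ) : {i : ℕ} → Vec (Cell r) i → Set where
    top  : Rev n (replicate n nothing)
    skip : {U : Vec (Cell r) i} → Rev n (w ∷ U) → Rev n U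
    ins  : {U T : Vec (Cell r) i} → Rev n (w ∷ U) → Ins c U p T q → Rev n T

  -- X h c q t b: at time t the label b entered row q of colour c.
  data X {r n : ℕ} : {T : Vec (Cell r) i} → Rev n T → Fin r → ℕ → ℕ → ℕ → Set where
    old-skip : {U : Vec (Cell r) i} {h : Rev n (w ∷ U)} →
               X h c q t b → b < i → X (skip h) c q t b
    old-ins  : {U T : Vec (Cell r) i} {h : Rev n (w ∷ U)} {d : Ins c' U p T q'} →
               X h c q t b → b < i → X (ins h d) c q t b
    new      : {U T : Vec (Cell r) i} {h : Rev n (w ∷ U)} {d : Ins c U p T q'} →
               Ev d q b → X (ins h d) c q i b

  X-time : {T : Vec (Cell r) i} {h : Rev n T} → X h c q t b → i ≤ t
  X-time (old-skip e _) = ≤-trans (n≤1+n _) (X-time e)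
  X-time (old-ins e _)  = ≤-trans (n≤1+n _) (X-time e)
  X-time (new _)        = ≤-refl

  X-label : {T : Vec (Cell r) i} {h : Rev n T} → X h c q t b → b < i
  X-label (old-skip _ lt) = lt
  X-label (old-ins _ lt)  = lt
  X-label (new e)         = ∋-< (Ev-∋ e)

  replicate-∌ : ∀ n → ¬ (replicate n nothing ∋ b ↦ k)
  replicate-∌ (suc n) (tail e) = replicate-∌ n e

  Rev-L : {T : Vec (Cell r) i} → Rev n T → L T
  Rev-L {n = n} top = go n
    where go : ∀ n → L (replicate n nothing)
          go zero    = tt
          go (suc n) = tt , go n
  Rev-L (skip h)  = proj₂ (Rev-L h)
  Rev-L (ins h d) = Ins-L d (proj₂ (Rev-L h))

  entered : {T : Vec (Cell r) i} (h : Rev n T) → T ∋ b ↦ (c , q) → ∃ λ t → X h c q t b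
  entered {n = n} top o = contradiction o (replicate-∌ n)
  entered (skip h) o = let (t , e) = entered h (tail o) in t , old-skip e (∋-< o)
  entered (ins h d) o with old-or-entered d o
  ... | inj₁ o'         = let (t , e) = entered h (tail o') in t , old-ins e (∋-< o')
  ... | inj₂ (refl , e) = _ , new e

  -- Deletion takes only the largest label, and `X` forgets that label at the same moment. Hence a
  -- recorded label can leave its row only by being bumped.
  left : {T : Vec (Cell r) i} {h : Rev n T} → X h c q t x →
         T ∋ x ↦ (c , q) ⊎ (∃ λ u → X h c (suc q) u x × u < t)
  left (old-skip e lt) with left e
  ... | inj₁ o            = inj₁ (∋-tail o lt)
  ... | inj₂ (u , e' , l) = inj₂ (u , old-skip e' lt , l)
  left (old-ins {d = d} e lt) with left e
  ... | inj₂ (u , e' , l) = inj₂ (u , old-ins e' lt , l)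
  ... | inj₁ o with stays-or-bumped d (∋-tail o lt)
  ...   | inj₁ o'          = inj₁ o'
  ...   | inj₂ (refl , e') = inj₂ (_ , new e' , X-time e)
  left (new e) = inj₁ (Ev-∋ e)

  -- A label is bumped out of a row only by a smaller one that takes its place.
  occupied : {T : Vec (Cell r) i} {h : Rev n T} → X h c q t x →
             ∃ λ b → T ∋ b ↦ (c , q) × b ≤ x
  occupied (old-skip e lt) =
    let (b , o , l) = occupied e in b , ∋-tail o (≤-<-trans l lt) , l
  occupied (old-ins {d = d} e lt) with occupied e
  ... | b , o , l with stays-or-bumped d (∋-tail o (≤-<-trans l lt))
  ...   | inj₁ o'          = b , o' , l
  ...   | inj₂ (refl , e') = let (_ , a , e'' , l' , _) = Ev-bumped e'
                             in a , Ev-∋ e'' , ≤-trans (<⇒≤ l') l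
  occupied (new e) = _ , Ev-∋ e , ≤-refl

  -- Smaller times are later. Either `x` was bumped before `y` came, or it is still in the row at
  -- that moment and the arrival of `y` bumps some label above `y` and at most `x`.
  between-down : {T : Vec (Cell r) i} {h : Rev n T} → X h c q t x → X h c q u y → u < t → y < x →
                 ∃₂ λ v b → X h c (suc q) v b × u ≤ v × v < t × y < b × b ≤ x
  between-down (old-skip e l) (old-skip f _) lt lt' =
    let (v , b , g , l₁ , l₂ , l₃ , l₄) = between-down e f lt lt'
    in v , b , old-skip g (≤-<-trans l₄ l) , l₁ , l₂ , l₃ , l₄
  between-down (old-ins e l) (old-ins f _) lt lt' =
    let (v , b , g , l₁ , l₂ , l₃ , l₄) = between-down e f lt lt'
    in v , b , old-ins g (≤-<-trans l₄ l) , l₁ , l₂ , l₃ , l₄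
  between-down (old-ins e l) (new f) lt lt' with left e
  ... | inj₂ (v , g , l') = v , _ , old-ins g l , ≤-trans (n≤1+n _) (X-time g) , l' , lt' , ≤-refl
  ... | inj₁ o = let (b , g , l₁ , l₂) = Ev-bumps f (∋-tail o l) lt'
                 in _ , b , new g , ≤-refl , X-time e , l₁ , l₂
  between-down (new e) (old-ins f _) lt lt' = contradiction (X-time f) (<⇒≱ (<-trans lt ≤-refl))
  between-down (new e) (new f) lt lt' = contradiction lt (<-irrefl refl)

  -- At time `t` some `a` displaced `x`. If `y` was already in row `q`, the bumping rule puts `y`
  -- below `a`; otherwise `y` itself entered that row no earlier than `a`.
  between-up′ : {T : Vec (Cell r) i} {h : Rev n T} → X h c (suc q) t x → T ∋ y ↦ (c , q) → y < x →
                ∃₂ λ v b → X h c q v b × v ≤ t × y ≤ b × b < x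
  between-up′ (old-skip e l) o lt =
    let (v , b , g , l₁ , l₂ , l₃) = between-up′ e (tail o) lt
    in v , b , old-skip g (<-trans l₃ l) , l₁ , l₂ , l₃
  between-up′ (old-ins {d = d} e l) o lt with old-or-entered d o
  ... | inj₂ (refl , f) = _ , _ , new f , ≤-trans (n≤1+n _) (X-time e) , ≤-refl , lt
  ... | inj₁ o' = let (v , b , g , l₁ , l₂ , l₃) = between-up′ e (tail o') lt
                  in v , b , old-ins g (<-trans l₃ l) , l₁ , l₂ , l₃
  between-up′ (new {d = d} e) o lt with old-or-entered d o
  ... | inj₂ (refl , f) = _ , _ , new f , ≤-refl , ≤-refl , lt
  ... | inj₁ o' = let (_ , a , f , l , g) = Ev-bumped e
                  in _ , a , new f , ≤-refl , <⇒≤ (g o' lt) , l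

  between-up : {T : Vec (Cell r) i} {h : Rev n T} →
               X h c (suc q) t x → X h c (suc q) u y → u < t → y < x →
               ∃₂ λ v b → X h c q v b × u < v × v ≤ t × y ≤ b × b < x
  between-up (old-skip e l) (old-skip f _) lt lt' =
    let (v , b , g , l₁ , l₂ , l₃ , l₄) = between-up e f lt lt'
    in v , b , old-skip g (<-trans l₄ l) , l₁ , l₂ , l₃ , l₄
  between-up (old-ins e l) (old-ins f _) lt lt' =
    let (v , b , g , l₁ , l₂ , l₃ , l₄) = between-up e f lt lt'
    in v , b , old-ins g (<-trans l₄ l) , l₁ , l₂ , l₃ , l₄
  -- Just before `f` moves `y` into row `q + 1`, it still sits in row `q`.
  between-up (old-ins e l) (new f) lt lt' =
    let (v , b , g , l₁ , l₂ , l₃) = between-up′ e (tail (proj₁ (Ev-bumped f))) lt'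
    in v , b , old-ins g (<-trans l₃ l) , X-time g , l₁ , l₂ , l₃
  between-up (new e) (old-ins f _) lt lt' = contradiction (X-time f) (<⇒≱ (<-trans lt ≤-refl))
  between-up (new e) (new f) lt lt' = contradiction lt (<-irrefl refl)

  bumped : {T : Vec (Cell r) i} {h : Rev n T} → X h c (suc q) t x →
           (∃ λ s → X h c q s x × t < s) × (∃ λ a → X h c q t a × a < x)
  bumped (old-skip e l) =
    let ((s , f , l₁) , (a , g , l₂)) = bumped e
    in (s , old-skip f l , l₁) , (a , old-skip g (<-trans l₂ l) , l₂)
  bumped (old-ins e l) =
    let ((s , f , l₁) , (a , g , l₂)) = bumped e
    in (s , old-ins f l , l₁) , (a , old-ins g (<-trans l₂ l) , l₂)
  bumped (new {h = h} e) =
    let (o , a , f , l , _) = Ev-bumped e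
        (s , g) = entered h (tail o)
    in (s , old-ins g (∋-< o) , X-time g) , (a , new f , l)

  -- The indices describe the last link. Times fall along a chain because later vertices are
  -- processed first; so a chain in row 0 that decreases in its labels is a crossing, and one that
  -- increases is a nesting.
  data Chain (_≺_ : ℕ → ℕ → Set) (R : ℕ → ℕ → Set) : ℕ → ℕ → ℕ → Set where
    one  : R t y → Chain _≺_ R 1 t y
    more : Chain _≺_ R d t x → R u y → u < t → x ≺ y → Chain _≺_ R (suc d) u y

  Dec-Chain Inc-Chain : (ℕ → ℕ → Set) → ℕ → ℕ → ℕ → Set
  Dec-Chain = Chain _>_
  Inc-Chain = Chain _<_

  Chain-last : {_≺_ R : ℕ → ℕ → Set} → Chain _≺_ R d t y → R t y
  Chain-last (one e)        = e
  Chain-last (more _ e _ _) = e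

  -- Viennot's shadow lines: the labels bumped out of row q are the input of row q + 1, and
  -- passing to them shortens the longest decreasing chain by exactly one.
  dec-down : {T : Vec (Cell r) i} {h : Rev n T} → Dec-Chain (X h c q) (suc (suc d)) t y →
             ∃₂ λ u b → Dec-Chain (X h c (suc q)) (suc d) u b × t ≤ u × y < b
  dec-down (more (one e) f lt lt') =
    let (v , b , g , l₁ , l₂ , l₃ , l₄) = between-down e f lt lt' in v , b , one g , l₁ , l₃
  dec-down {d = zero} (more (more () _ _ _) f lt lt')
  dec-down {d = suc _} (more ch f lt lt') =
    let (u , b' , ch' , m₁ , m₂) = dec-down ch
        (v , b , g , l₁ , l₂ , l₃ , l₄) = between-down (Chain-last ch) f lt lt'
    in v , b , more ch' g (<-≤-trans l₂ m₁) (≤-<-trans l₄ m₂) , l₁ , l₃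

  -- The first link is traced back to its earlier entry into row `q`, and every further link is
  -- found between two consecutive ones of row `q + 1`. The chain obtained ends before time `t`,
  -- which leaves room for one more link.
  dec-up′ : {T : Vec (Cell r) i} {h : Rev n T} → Dec-Chain (X h c (suc q)) d t y →
            ∃₂ λ u b → Dec-Chain (X h c q) d u b × t < u × y ≤ b
  dec-up′ (one e) = let ((s , f , l) , _) = bumped e in s , _ , one f , l , ≤-refl
  dec-up′ (more ch f lt lt') =
    let (u , b' , ch' , m₁ , m₂) = dec-up′ ch
        (v , b , g , l₁ , l₂ , l₃ , l₄) = between-up (Chain-last ch) f lt lt'
    in v , b , more ch' g (≤-<-trans l₂ m₁) (<-≤-trans l₄ m₂) , l₁ , l₃

  -- The additional link is the smaller label that pushed the last one out of row `q`, at the same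
  -- time.
  dec-up : {T : Vec (Cell r) i} {h : Rev n T} → Dec-Chain (X h c (suc q)) d t y →
           ∃₂ λ u b → Dec-Chain (X h c q) (suc d) u b
  dec-up ch =
    let (u , b , ch' , m₁ , m₂) = dec-up′ ch
        (_ , (a , g , l)) = bumped (Chain-last ch)
    in _ , a , more ch' g m₁ (<-≤-trans l m₂)

  dec⇒row : {T : Vec (Cell r) i} {h : Rev n T} → ∀ q' → Dec-Chain (X h c q) (suc (q' + d)) t y →
            0 < cnt T c (q' + q)
  dec⇒row zero ch with occupied (Chain-last ch)
  ... | _ , o , _ = ∋⇒cnt o
  dec⇒row {c = c} {q = q} {T = T} (suc q') ch =
    subst (λ v → 0 < cnt T c v) (+-suc q' q) (dec⇒row q' (proj₁ (proj₂ (proj₂ (dec-down ch)))))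

  row⇒dec : {T : Vec (Cell r) i} (h : Rev n T) → ∀ q → 0 < cnt T c q →
            ∃₂ λ t y → Dec-Chain (X h c 0) (suc q) t y
  row⇒dec {c = c} h q lt =
    let (b , o) = cnt⇒∋ _ lt
        (t , e) = entered h o
    in subst (λ v → ∃₂ λ t y → Dec-Chain (X h c 0) v t y) (+-comm q 1) (climb q (one e))
    where
    climb : ∀ q → Dec-Chain (X h c q) d t y → ∃₂ λ t y → Dec-Chain (X h c 0) (q + d) t y
    climb zero    ch = _ , _ , ch
    climb {d = d} (suc q) ch with dec-up ch
    ... | _ , _ , ch' = subst (λ v → ∃₂ λ t y → Dec-Chain (X h c 0) v t y) (+-suc q d) (climb q ch')

  -- Schensted's invariant for row 0: its `d`-th entry is the least last label of an increasing
  -- chain of length `d`. `inc⇒rowChain` and `rowChain⇒inc` are the two halves.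
  data Row-Chain (T : Vec (Cell r) i) (c : Fin r) : ℕ → ℕ → Set where
    one  : T ∋ y ↦ (c , 0) → Row-Chain T c 1 y
    more : Row-Chain T c d x → T ∋ y ↦ (c , 0) → x < y → Row-Chain T c (suc d) y

  Row-last : {T : Vec (Cell r) i} → Row-Chain T c d y → T ∋ y ↦ (c , 0)
  Row-last (one o)      = o
  Row-last (more _ o _) = o

  Row-weaken : {U : Vec (Cell r) i} → Row-Chain U c d y → Row-Chain (w ∷ U) c d y
  Row-weaken (one o)       = one (tail o)
  Row-weaken (more ch o l) = more (Row-weaken ch) (tail o) l

  Row-tail : {U : Vec (Cell r) i} → Row-Chain (w ∷ U) c d y → y < i → Row-Chain U c d y
  Row-tail (one o)       lt = one (∋-tail o lt)
  Row-tail (more ch o l) lt = more (Row-tail ch (<-trans l lt)) (∋-tail o lt) l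

  Row-insert : {U T : Vec (Cell r) i} → Ins c' U p T q → Row-Chain U c d y →
               ∃ λ y' → y' ≤ y × Row-Chain T c d y'
  Row-insert d (one o) with stays-or-bumped d o
  ... | inj₁ o'         = _ , ≤-refl , one o'
  ... | inj₂ (refl , e) = let (_ , a , f , l , _) = Ev-bumped e in a , <⇒≤ l , one (Ev-∋ f)
  Row-insert d (more ch o l) with stays-or-bumped d o | Row-insert d ch
  ... | inj₁ o'         | (x' , l' , ch') = _ , ≤-refl , more ch' o' (≤-<-trans l' l)
  ... | inj₂ (refl , e) | (x' , l' , ch') =
    let (_ , a , f , m , g) = Ev-bumped e
    in a , <⇒≤ m , more ch' (Ev-∋ f) (≤-<-trans l' (g (Row-last ch) l))

  -- Only one label of the chain can be new in row 0, the inserted one. If `y` lies above it, it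
  -- displaced some label not exceeding `y`, and that label takes its place in `U`.
  Row-uninsert : {U T : Vec (Cell r) i} → Ins c' U p T q → Row-Chain T c d y → U ∋ y ↦ (c , 0) →
                 Row-Chain U c d y
  -- The label x just inserted is replaced by the label b that it bumped.
  Row-unbump : {U T : Vec (Cell r) i} (e : Ins c U p T q) → Row-Chain T c d x → Ev e 0 x →
               Ev e 1 b → x < b → Row-Chain U c d b

  Row-uninsert e (one _) o = one o
  Row-uninsert e (more ch o' l) o with old-or-entered e (Row-last ch)
  ... | inj₁ o'' = more (Row-uninsert e ch o'') o l
  ... | inj₂ (refl , f) with Ev-bumps f o l
  ...   | b , g , l₁ , l₂ = more (Row-unbump e ch f g l₁) o
    -- The displaced `b` is now in row 1 whereas `y` is still in row 0, so they differ.
    (≤∧≢⇒< l₂ (λ { refl → contradiction (∋-functional (Ev-∋ g) o') (λ ()) }))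

  Row-unbump e (one _) f g l = one (proj₁ (Ev-bumped g))
  Row-unbump e (more ch _ l') f g l with old-or-entered e (Row-last ch)
  ... | inj₁ o        = more (Row-uninsert e ch o) (proj₁ (Ev-bumped g)) (<-trans l' l)
  ... | inj₂ (_ , f') = contradiction (trans (Ev-0 f') (sym (Ev-0 f))) (<⇒≢ l')

  inc⇒rowChain : {T : Vec (Cell r) i} (h : Rev n T) → Inc-Chain (X h c 0) d t y →
                 ∃ λ y' → y' ≤ y × Row-Chain T c d y'
  inc⇒rowChain top (one ())
  inc⇒rowChain top (more _ () _ _)
  -- The row chain ends at `y' ≤ y < i`, so it avoids the label that is deleted here.
  inc⇒rowChain (skip h) ch =
    let (y' , l , rc) = inc⇒rowChain h (old ch)
    in y' , l , Row-tail rc (≤-<-trans l (X-label (Chain-last ch)))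
    where
    old : Inc-Chain (X (skip h) _ 0) d t y → Inc-Chain (X h _ 0) d t y
    old (one (old-skip e _)) = one e
    old (more ch (old-skip e _) l l') = more (old ch) e l l'
  inc⇒rowChain {i = i} {c = c} (ins h d) ch = go ch
    where
    old : ∀ {k} → Inc-Chain (X (ins h d) c 0) k t y → i < t → Inc-Chain (X h c 0) k t y
    old (one (old-ins e _)) _ = one e
    old (one (new _)) lt = contradiction lt (<-irrefl refl)
    old (more ch (old-ins e _) l l') lt = more (old ch (<-trans lt l)) e l l'
    old (more ch (new _) l l') lt = contradiction lt (<-irrefl refl)
    step : ∀ {k} → Inc-Chain (X (ins h d) c 0) k t y → i < t → y < i →
           ∃ λ y' → y' ≤ y × Row-Chain _ c k y'
    step ch lt lt' with inc⇒rowChain h (old ch lt)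
    ... | x' , l , rc with Row-insert d (Row-tail rc (≤-<-trans l lt'))
    ...   | x'' , l' , rc' = x'' , ≤-trans l' l , rc'
    go : ∀ {k} → Inc-Chain (X (ins h d) c 0) k t y → ∃ λ y' → y' ≤ y × Row-Chain _ c k y'
    go (one (new e)) = _ , ≤-refl , one (Ev-∋ e)
    go (more ch (new e) l l') with step ch l (<-trans l' (∋-< (Ev-∋ e)))
    ... | x' , m , rc = _ , ≤-refl , more rc (Ev-∋ e) (≤-<-trans m l')
    go ch@(one (old-ins e lt)) = step ch (X-time e) lt
    go ch@(more _ (old-ins e lt) _ _) = step ch (X-time e) lt

  -- If the last label was already in row 0 before the insertion, `Row-uninsert` leads back to the
  -- earlier tableau. If it is the inserted one, its predecessor in the row is old, and the chain of
  -- that one is extended by the new arc.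
  rowChain⇒inc : {T : Vec (Cell r) i} (h : Rev n T) → Row-Chain T c d y →
                 ∃ λ t → Inc-Chain (X h c 0) d t y
  rowChain⇒inc {n = n} top ch = contradiction (Row-last ch) (replicate-∌ n)
  rowChain⇒inc {c = c} (skip h) ch =
    let (t , ic) = rowChain⇒inc h (Row-weaken ch) in t , lift ic (∋-< (Row-last ch))
    where
    lift : Inc-Chain (X h c 0) d t y → y < _ → Inc-Chain (X (skip h) c 0) d t y
    lift (one e) lt = one (old-skip e lt)
    lift (more ch e l l') lt = more (lift ch (<-trans l' lt)) (old-skip e lt) l l'
  rowChain⇒inc {i = i} {c = c} (ins {U = U} h d) ch = go ch
    where
    lift : ∀ {k} → Inc-Chain (X h c 0) k t y → y < i → Inc-Chain (X (ins h d) c 0) k t y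
    lift (one e) lt = one (old-ins e lt)
    lift (more ch e l l') lt = more (lift ch (<-trans l' lt)) (old-ins e lt) l l'
    step : ∀ {k} → Row-Chain _ c k y → U ∋ y ↦ (c , 0) →
           ∃ λ t → Inc-Chain (X h c 0) k t y × Inc-Chain (X (ins h d) c 0) k t y
    step ch o = let (t , ic) = rowChain⇒inc h (Row-weaken (Row-uninsert d ch o))
                in t , ic , lift ic (∋-< o)
    go : ∀ {k} → Row-Chain _ c k y → ∃ λ t → Inc-Chain (X (ins h d) c 0) k t y
    go ch with old-or-entered d (Row-last ch)
    ... | inj₁ o = let (t , _ , ic) = step ch o in t , ic
    go (one _) | inj₂ (refl , e) = _ , one (new e)
    go (more ch _ l) | inj₂ (refl , e) with old-or-entered d (Row-last ch)
    ... | inj₂ (_ , e') = contradiction (trans (Ev-0 e') (sym (Ev-0 e))) (<⇒≢ l)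
    ... | inj₁ o with step ch o
    ...   | t , ic , ic' = _ , more ic' (new e) (X-time (Chain-last ic)) l

  rowChain⇒cnt : {T : Vec (Cell r) i} → Row-Chain T c d y → d ≤ cnt T c 0
  rowChain⇒cnt {T = []} (one ())
  rowChain⇒cnt {T = []} (more _ () _)
  rowChain⇒cnt {c = c} {T = _ ∷ T} (one head) = subst (λ v → 1 ≤ v + cnt T c 0) (sym (δ-hit c 0)) (s≤s z≤n)
  rowChain⇒cnt (one (tail o)) = ≤-trans (rowChain⇒cnt (one o)) (m≤n+m _ _)
  rowChain⇒cnt {c = c} {T = _ ∷ T} (more ch head l) =
    subst (λ v → _ ≤ v + cnt T c 0) (sym (δ-hit c 0)) (s≤s (rowChain⇒cnt (Row-tail ch l)))
  rowChain⇒cnt (more ch (tail o) l) =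
    ≤-trans (rowChain⇒cnt (more (Row-tail ch (<-trans l (∋-< o))) o l)) (m≤n+m _ _)

  cnt⇒rowChain : (T : Vec (Cell r) i) → suc d ≡ cnt T c 0 → ∃ λ y → Row-Chain T c (suc d) y
  cnt⇒rowChain {d = d} {c = c} (x ∷ T) eq with x ≟C just (c , 0)
  ... | no ne = let (y , ch) = cnt⇒rowChain T (trans eq (cong (_+ cnt T c 0) (δ-miss ne)))
                in y , Row-weaken ch
  cnt⇒rowChain {d = zero} {c = c} (x ∷ T) eq | yes refl = _ , one head
  cnt⇒rowChain {d = suc d} {c = c} (x ∷ T) eq | yes refl =
    let (y , ch) = cnt⇒rowChain T (suc-injective (trans eq (cong (_+ cnt T c 0) (δ-hit c 0))))
    in _ , more (Row-weaken ch) head (∋-< (Row-last ch))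

  inc⇒cnt : {T : Vec (Cell r) i} (h : Rev n T) → Inc-Chain (X h c 0) d t y → d ≤ cnt T c 0
  inc⇒cnt h ch = rowChain⇒cnt (proj₂ (proj₂ (inc⇒rowChain h ch)))

  cnt⇒inc : {T : Vec (Cell r) i} (h : Rev n T) → suc d ≡ cnt T c 0 →
            ∃₂ λ t y → Inc-Chain (X h c 0) (suc d) t y
  cnt⇒inc h eq = let (y , rc) = cnt⇒rowChain _ eq
                     (t , ic) = rowChain⇒inc h rc
                 in t , y , ic

open Schensted

-- Vertices of the graph, and edges as common upper neighbours.

module Matrices where

  module _ {A : Set} {xs : List A} where

    ∈-allVecs⁺ : ∀ {n} (v : Vec A n) → (∀ t → lookup v t ∈ xs) → v ∈ allVecs xs n
    ∈-allVecs⁺ []      _  = here refl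
    ∈-allVecs⁺ {suc n} (x ∷ v) v∈ =
      ∃-∈-concatMap (λ x → map (x ∷_) (allVecs xs n)) (v∈ zero) (∈-map⁺ (x ∷_) (∈-allVecs⁺ v (v∈ ∘ suc)))

    ∈-allVecs⁻ : ∀ {n} {v : Vec A n} → v ∈ allVecs xs n → ∀ t → lookup v t ∈ xs
    ∈-allVecs⁻ {suc n} {v} v∈ t with ∈-concatMap-∃ (λ x → map (x ∷_) (allVecs xs n)) {xs} v∈
    ... | x , x∈ , v∈′ with ∈-map⁻ (x ∷_) v∈′
    ∈-allVecs⁻ {suc n} v∈ zero    | x , x∈ , v∈′ | w , w∈ , refl = x∈
    ∈-allVecs⁻ {suc n} v∈ (suc t) | x , x∈ , v∈′ | w , w∈ , refl = ∈-allVecs⁻ w∈ t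

    allVecs-unique : Unique xs → ∀ n → Unique (allVecs xs n)
    allVecs-unique u zero    = All.[] AllPairs.∷ AllPairs.[]
    allVecs-unique u (suc n) = unique-concatMap (λ x → map (x ∷_) (allVecs xs n)) u
      (λ _ → Unique.map⁺ (proj₂ ∘ ∷-injective) (allVecs-unique u n)) disjoint
      where
      disjoint : ∀ {x y z} → x ∈ xs → y ∈ xs → z ∈ map (x ∷_) (allVecs xs n) → z ∈ map (y ∷_) (allVecs xs n) → x ≡ y
      disjoint _ _ z∈ z∈′ with ∈-map⁻ _ z∈ | ∈-map⁻ _ z∈′
      ... | _ , _ , refl | _ , _ , eq = proj₁ (∷-injective eq)

  private variable
    R m s t : ℕ
    A B C : Matrix R m

  entry : Matrix R m → Fin R → Fin m → ℕ
  entry A c ℓ = lookup (lookup A c) ℓ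

  lookup-ext : {X : Set} {n : ℕ} {v w : Vec X n} → (∀ t → lookup v t ≡ lookup w t) → v ≡ w
  lookup-ext {v = v} {w} eq = trans (sym (tabulate∘lookup v)) (trans (tabulate-cong eq) (tabulate∘lookup w))

  entry-ext : (∀ c ℓ → entry A c ℓ ≡ entry B c ℓ) → A ≡ B
  entry-ext eq = lookup-ext (λ c → lookup-ext (eq c))

  Antitone : Vec ℕ m → Set
  Antitone u = ∀ s t → toℕ s ≤ toℕ t → lookup u t ≤ lookup u s

  Vertex : ℕ → Matrix R m → Set
  Vertex j A = (∀ c ℓ → entry A c ℓ < j) × (∀ c → Antitone (lookup A c))

  decreasing⇒antitone : (u : Vec ℕ m) → T (weaklyDecreasing u) → Antitone u
  decreasing⇒antitone (x ∷ [])     _  zero    zero    _       = ≤-refl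
  decreasing⇒antitone (x ∷ y ∷ u)  tr zero    zero    _       = ≤-refl
  decreasing⇒antitone (x ∷ y ∷ u)  tr zero    (suc t) _       =
    let (p , q) = Equivalence.to T-∧ tr
    in ≤-trans (decreasing⇒antitone (y ∷ u) q zero t z≤n) (≤ᵇ⇒≤ y x p)
  decreasing⇒antitone (x ∷ y ∷ u)  tr (suc s) (suc t) (s≤s l) =
    decreasing⇒antitone (y ∷ u) (proj₂ (Equivalence.to T-∧ tr)) s t l

  antitone⇒decreasing : (u : Vec ℕ m) → Antitone u → T (weaklyDecreasing u)
  antitone⇒decreasing []          _ = tt
  antitone⇒decreasing (x ∷ [])    _ = tt
  antitone⇒decreasing (x ∷ y ∷ u) a = Equivalence.from T-∧
    (≤⇒≤ᵇ (a zero (suc zero) z≤n) , antitone⇒decreasing (y ∷ u) (λ s t l → a (suc s) (suc t) (s≤s l)))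

  allRows⁻ : {p : Vec ℕ m → Bool} (A : Matrix R m) → T (allRows p A) → ∀ c → T (p (lookup A c))
  allRows⁻ (u ∷ A) tr zero    = proj₁ (Equivalence.to T-∧ tr)
  allRows⁻ (u ∷ A) tr (suc c) = allRows⁻ A (proj₂ (Equivalence.to T-∧ tr)) c

  allRows⁺ : {p : Vec ℕ m → Bool} (A : Matrix R m) → (∀ c → T (p (lookup A c))) → T (allRows p A)
  allRows⁺ []      _ = tt
  allRows⁺ (u ∷ A) f = Equivalence.from T-∧ (f zero , allRows⁺ A (f ∘ suc))

  ∈-vertices⁺ : ∀ j {A : Matrix R m} → Vertex j A → A ∈ vertices j (suc m) R
  ∈-vertices⁺ {R} {m} j {A} (lt , anti) = ∈-filter⁺ (T? ∘ allRows weaklyDecreasing)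
    (∈-allVecs⁺ A (λ c → ∈-allVecs⁺ (lookup A c) (λ ℓ → ∈-upTo⁺ (lt c ℓ))))
    (allRows⁺ A (λ c → antitone⇒decreasing (lookup A c) (anti c)))

  ∈-vertices⁻ : ∀ j {A : Matrix R m} → A ∈ vertices j (suc m) R → Vertex j A
  ∈-vertices⁻ {R} {m} j {A} A∈ with ∈-filter⁻ (T? ∘ allRows weaklyDecreasing) {xs = allVecs (allVecs (upTo j) m) R} A∈
  ... | A∈′ , tr = (λ c ℓ → ∈-upTo⁻ (∈-allVecs⁻ (∈-allVecs⁻ A∈′ c) ℓ))
                 , (λ c → decreasing⇒antitone (lookup A c) (allRows⁻ A tr c))

  vertices-unique : ∀ j R m → Unique (vertices j (suc m) R)
  vertices-unique j R m = Unique.filter⁺ (T? ∘ allRows weaklyDecreasing)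
    (allVecs-unique (allVecs-unique (Unique.upTo⁺ j) m) R)

  incr : Matrix R m → Fin R → Fin m → Matrix R m
  incr A c ℓ = updateAt A c (λ u → updateAt u ℓ suc)

  entry-incr : (A : Matrix R m) (c : Fin R) (ℓ : Fin m) → entry (incr A c ℓ) c ℓ ≡ suc (entry A c ℓ)
  entry-incr A c ℓ = trans (cong (λ u → lookup u ℓ) (lookup∘updateAt c A)) (lookup∘updateAt ℓ (lookup A c))

  entry-incr-≢ : (A : Matrix R m) {c c' : Fin R} {ℓ ℓ' : Fin m} → (c , ℓ) ≢ (c' , ℓ') →
                 entry (incr A c ℓ) c' ℓ' ≡ entry A c' ℓ'
  entry-incr-≢ A {c} {c'} {ℓ} {ℓ'} ne with c' Fin.≟ c
  ... | no c≢    = cong (λ u → lookup u ℓ') (lookup∘updateAt′ c' c c≢ A)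
  ... | yes refl = trans (cong (λ u → lookup u ℓ') (lookup∘updateAt c A))
                     (lookup∘updateAt′ ℓ' ℓ (λ { refl → ne refl }) (lookup A c))

  incr-injective : {c : Fin R} {ℓ : Fin m} → incr A c ℓ ≡ incr B c ℓ → A ≡ B
  incr-injective {A = A} {B} {c} {ℓ} eq = entry-ext go
    where
    go : ∀ c' ℓ' → entry A c' ℓ' ≡ entry B c' ℓ'
    go c' ℓ' with c Fin.≟ c' | ℓ Fin.≟ ℓ'
    ... | yes refl | yes refl = suc-injective
      (trans (sym (entry-incr A c ℓ)) (trans (cong (λ M → entry M c ℓ) eq) (entry-incr B c ℓ)))
    ... | no ne | _ = trans (sym (entry-incr-≢ A (λ { refl → ne refl })))
      (trans (cong (λ M → entry M c' ℓ') eq) (entry-incr-≢ B (λ { refl → ne refl })))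
    ... | yes _ | no ne = trans (sym (entry-incr-≢ A (λ { refl → ne refl })))
      (trans (cong (λ M → entry M c' ℓ') eq) (entry-incr-≢ B (λ { refl → ne refl })))

  Up : Matrix R m → Matrix R m → Set
  Up A B = A ≡ B ⊎ (∃₂ λ c ℓ → B ≡ incr A c ℓ)

  _≟M_ : (A B : Matrix R m) → Dec (A ≡ B)
  _≟M_ = Vec.≡-dec (Vec.≡-dec _≟_)

  up? : (A B : Matrix R m) → Dec (Up A B)
  up? A B = (A ≟M B) ⊎-dec Fin.any? (λ c → Fin.any? (λ ℓ → B ≟M incr A c ℓ))

  cmp-refl : ∀ x → cmp x x ≡ same
  cmp-refl zero    = refl
  cmp-refl (suc x) = cmp-refl x

  cmp-plus : ∀ x → cmp (suc x) x ≡ plus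
  cmp-plus zero    = refl
  cmp-plus (suc x) = cmp-plus x

  cmp-minus : ∀ x → cmp x (suc x) ≡ minus
  cmp-minus zero    = refl
  cmp-minus (suc x) = cmp-minus x

  data CmpView : ℕ → ℕ → Set where
    v-same  : ∀ x → CmpView x x
    v-plus  : ∀ x → CmpView (suc x) x
    v-minus : ∀ x → CmpView x (suc x)
    v-big   : ∀ {x y} → cmp x y ≡ big → CmpView x y

  cmpView : ∀ x y → CmpView x y
  cmpView zero          zero          = v-same 0
  cmpView zero          (suc zero)    = v-minus 0
  cmpView zero          (suc (suc y)) = v-big refl
  cmpView (suc zero)    zero          = v-plus 0
  cmpView (suc (suc x)) zero          = v-big refl
  cmpView (suc x)       (suc y) with cmpView x y
  ... | v-same  .x = v-same _
  ... | v-plus  .y = v-plus _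
  ... | v-minus .x = v-minus _
  ... | v-big eq   = v-big eq

  count-++ : (p : Δ → Bool) (xs ys : List Δ) → count p (xs ++ ys) ≡ count p xs + count p ys
  count-++ p xs ys = trans (cong length (filter-++ (T? ∘ p) xs ys)) (length-++ (filter (T? ∘ p) xs))

  diffsV : Vec ℕ m → Vec ℕ m → List Δ
  diffsV u v = toList (zipWith cmp u v)

  data Bit : ℕ → ℕ → ℕ → Set where
    stay : ∀ {x} → Bit 0 x x
    inc  : ∀ {x} → Bit 1 x (suc x)

  -- Le s u v: v arises from u by adding 1 to s of the entries.
  data Le : ℕ → Vec ℕ m → Vec ℕ m → Set where
    []  : Le 0 [] []
    _∷_ : ∀ {x y} {u v : Vec ℕ m} → Bit s x y → Le t u v → Le (s + t) (x ∷ u) (y ∷ v)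

  data LeM {m : ℕ} : ℕ → Matrix R m → Matrix R m → Set where
    []  : LeM 0 [] []
    _∷_ : {u v : Vec ℕ m} {A B : Matrix R m} → Le s u v → LeM t A B → LeM (s + t) (u ∷ A) (v ∷ B)

  Le-refl : (u : Vec ℕ m) → Le 0 u u
  Le-refl []      = []
  Le-refl (x ∷ u) = stay ∷ Le-refl u

  LeM-refl : (A : Matrix R m) → LeM 0 A A
  LeM-refl []      = []
  LeM-refl (u ∷ A) = Le-refl u ∷ LeM-refl A

  Le-updateAt : (u : Vec ℕ m) (ℓ : Fin m) → Le 1 u (updateAt u ℓ suc)
  Le-updateAt (x ∷ u) zero    = inc ∷ Le-refl u
  Le-updateAt (x ∷ u) (suc ℓ) = stay ∷ Le-updateAt u ℓ

  LeM-incr : (A : Matrix R m) (c : Fin R) (ℓ : Fin m) → LeM 1 A (incr A c ℓ)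
  LeM-incr (u ∷ A) zero    ℓ = Le-updateAt u ℓ ∷ LeM-refl A
  LeM-incr (u ∷ A) (suc c) ℓ = Le-refl u ∷ LeM-incr A c ℓ

  Up⇒LeM : Up A B → ∃ λ s → s ≤ 1 × LeM s A B
  Up⇒LeM {A = A} (inj₁ refl)           = 0 , z≤n , LeM-refl A
  Up⇒LeM {A = A} (inj₂ (c , ℓ , refl)) = 1 , ≤-refl , LeM-incr A c ℓ

  Le⇒updateAt : {u v : Vec ℕ m} → Le s u v →
                (s ≡ 0 → u ≡ v) × (s ≡ 1 → ∃ λ ℓ → v ≡ updateAt u ℓ suc)
  Le⇒updateAt [] = (λ _ → refl) , λ ()
  Le⇒updateAt (stay ∷ l) = (λ eq → cong (_ ∷_) (proj₁ (Le⇒updateAt l) eq))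
    , (λ eq → let (ℓ , e) = proj₂ (Le⇒updateAt l) eq in suc ℓ , cong (_ ∷_) e)
  Le⇒updateAt (inc ∷ l)  = (λ ())
    , (λ eq → zero , cong (_ ∷_) (sym (proj₁ (Le⇒updateAt l) (suc-injective eq))))

  LeM⇒incr : {A B : Matrix R m} → LeM s A B →
             (s ≡ 0 → A ≡ B) × (s ≡ 1 → ∃₂ λ c ℓ → B ≡ incr A c ℓ)
  LeM⇒incr [] = (λ _ → refl) , λ ()
  LeM⇒incr (_∷_ {s = zero} l ls) = (λ eq → cong₂ _∷_ (proj₁ (Le⇒updateAt l) refl) (proj₁ (LeM⇒incr ls) eq))
    , (λ eq → let (c , ℓ , e) = proj₂ (LeM⇒incr ls) eq
              in suc c , ℓ , cong₂ _∷_ (sym (proj₁ (Le⇒updateAt l) refl)) e)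
  LeM⇒incr (_∷_ {s = suc s} {t} l ls) = (λ ())
    , (λ eq → let (ℓ , e) = proj₂ (Le⇒updateAt l) (cong suc (m+n≡0⇒m≡0 s (suc-injective eq)))
              in zero , ℓ , cong₂ _∷_ e (sym (proj₁ (LeM⇒incr ls) (m+n≡0⇒n≡0 s (suc-injective eq)))))

  LeM⇒Up : {A B : Matrix R m} → LeM s A B → s ≤ 1 → Up A B
  LeM⇒Up {s = zero}        l _ = inj₁ (proj₁ (LeM⇒incr l) refl)
  LeM⇒Up {s = suc zero}    l _ = inj₂ (proj₂ (LeM⇒incr l) refl)
  LeM⇒Up {s = suc (suc _)} l (s≤s ())

  sup : Matrix R m → Matrix R m → Matrix R m
  sup = zipWith (zipWith _⊔_)

  -- Comparison of a and c below a common b, where b exceeds a in s places and c in t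
  -- places by 1: either these places are disjoint and b = sup a c, or some are shared.
  Trip : (s t np nm nb : ℕ) → Set → Set
  Trip s t np nm nb E = nb ≡ 0 × ((np ≡ t × nm ≡ s × E) ⊎ (np < t × nm < s))

  Trip-+ : ∀ {s t np nm nb s' t' np' nm' nb' E E' F} → (E → E' → F) → Trip s t np nm nb E →
           Trip s' t' np' nm' nb' E' → Trip (s + s') (t + t') (np + np') (nm + nm') (nb + nb') F
  Trip-+ f (refl , inj₁ (refl , refl , e)) (refl , inj₁ (refl , refl , e')) = refl , inj₁ (refl , refl , f e e')
  Trip-+ {s} {t} f (refl , inj₁ (refl , refl , _)) (refl , inj₂ (p , q)) = refl , inj₂ (+-monoʳ-< t p , +-monoʳ-< s q)
  Trip-+ f (refl , inj₂ (p , q)) (refl , inj₁ (refl , refl , _)) = refl , inj₂ (+-monoˡ-< _ p , +-monoˡ-< _ q)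
  Trip-+ f (refl , inj₂ (p , q)) (refl , inj₂ (p' , q')) = refl , inj₂ (+-mono-< p p' , +-mono-< q q')

  DTrip : ℕ → ℕ → List Δ → Set → Set
  DTrip s t ds = Trip s t (count isPlus ds) (count isMinus ds) (count isBig ds)

  DTrip-++ : ∀ {s t s' t' E E' F} {ds ds' : List Δ} → (E → E' → F) → DTrip s t ds E → DTrip s' t' ds' E' →
             DTrip (s + s') (t + t') (ds ++ ds') F
  DTrip-++ {ds = ds} {ds'} f x y
    rewrite count-++ isPlus ds ds' | count-++ isMinus ds ds' | count-++ isBig ds ds' = Trip-+ f x y

  bit-trip : ∀ {x y z} → Bit s x y → Bit t z y → DTrip s t (cmp x z ∷ []) (y ≡ x ⊔ z)
  bit-trip {x = x} stay stay rewrite cmp-refl x = refl , inj₁ (refl , refl , sym (⊔-idem x))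
  bit-trip {z = x} stay inc rewrite cmp-plus x = refl , inj₁ (refl , refl , sym (m≥n⇒m⊔n≡m (n≤1+n x)))
  bit-trip {x = x} inc stay rewrite cmp-minus x = refl , inj₁ (refl , refl , sym (m≤n⇒m⊔n≡n (n≤1+n x)))
  bit-trip {x = x} inc inc rewrite cmp-refl x = refl , inj₂ (s≤s z≤n , s≤s z≤n)

  Le-trip : {u v w : Vec ℕ m} → Le s u v → Le t w v → DTrip s t (diffsV u w) (v ≡ zipWith _⊔_ u w)
  Le-trip [] [] = refl , inj₁ (refl , refl , refl)
  Le-trip {u = x ∷ u} {w = z ∷ w} (b ∷ l) (b' ∷ l') =
    DTrip-++ {ds = cmp x z ∷ []} {diffsV u w} (cong₂ _∷_) (bit-trip b b') (Le-trip l l')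

  LeM-trip : {A B C : Matrix R m} → LeM s A B → LeM t C B → DTrip s t (diffs A C) (B ≡ sup A C)
  LeM-trip [] [] = refl , inj₁ (refl , refl , refl)
  LeM-trip {A = u ∷ A} {C = w ∷ C} (l ∷ ls) (l' ∷ ls') =
    DTrip-++ {ds = diffsV u w} {diffs A C} (cong₂ _∷_) (Le-trip l l') (LeM-trip ls ls')

  Le-sup : (u w : Vec ℕ m) → count isBig (diffsV u w) ≡ 0 →
           Le (count isMinus (diffsV u w)) u (zipWith _⊔_ u w) × Le (count isPlus (diffsV u w)) w (zipWith _⊔_ u w)
  Le-sup [] [] _ = [] , []
  Le-sup (x ∷ u) (z ∷ w) nb with cmpView x z
  ... | v-same .x rewrite cmp-refl x | ⊔-idem x =
    let (l , l') = Le-sup u w nb in stay ∷ l , stay ∷ l'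
  ... | v-plus .z rewrite cmp-plus z | m≥n⇒m⊔n≡m (n≤1+n z) =
    let (l , l') = Le-sup u w nb in stay ∷ l , inc ∷ l'
  ... | v-minus .x rewrite cmp-minus x | m≤n⇒m⊔n≡n (n≤1+n x) =
    let (l , l') = Le-sup u w nb in inc ∷ l , stay ∷ l'
  ... | v-big eq rewrite eq = contradiction nb λ ()

  -- Without a `big` difference, `A` lies below the maximum by one exactly at the `minus` places and
  -- `C` exactly at the `plus` places. So the maximum is a common upper neighbour as soon as both
  -- numbers are at most 1.
  LeM-sup : (A C : Matrix R m) → count isBig (diffs A C) ≡ 0 →
            LeM (count isMinus (diffs A C)) A (sup A C) × LeM (count isPlus (diffs A C)) C (sup A C)
  LeM-sup [] [] _ = [] , []
  LeM-sup (u ∷ A) (w ∷ C) nb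
    rewrite count-++ isBig (diffsV u w) (diffs A C) | count-++ isMinus (diffsV u w) (diffs A C)
          | count-++ isPlus (diffsV u w) (diffs A C) =
    let (l , l')   = Le-sup u w (m+n≡0⇒m≡0 (count isBig (diffsV u w)) nb)
        (ls , ls') = LeM-sup A C (m+n≡0⇒n≡0 (count isBig (diffsV u w)) nb)
    in l ∷ ls , l' ∷ ls'

  entry-sup : (A C : Matrix R m) → ∀ c ℓ → entry (sup A C) c ℓ ≡ entry A c ℓ ⊔ entry C c ℓ
  entry-sup A C c ℓ = trans (cong (λ u → lookup u ℓ) (lookup-zipWith (zipWith _⊔_) c A C))
                        (lookup-zipWith _⊔_ ℓ (lookup A c) (lookup C c))

  Vertex-sup : ∀ {j} {A C : Matrix R m} → Vertex j A → Vertex j C → Vertex j (sup A C)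
  Vertex-sup {A = A} {C} (lt , an) (lt' , an') =
      (λ c ℓ → subst (_< _) (sym (entry-sup A C c ℓ)) (⊔-lub (lt c ℓ) (lt' c ℓ)))
    , (λ c s t l → subst₂ _≤_ (sym (entry-sup A C c t)) (sym (entry-sup A C c s)) (⊔-mono-≤ (an c s t l) (an' c s t l)))

  sum-zero : {X : Set} {xs : List X} {f : X → ℕ} → (∀ {x} → x ∈ xs → f x ≡ 0) → sum (map f xs) ≡ 0
  sum-zero {xs = []}     _  = refl
  sum-zero {xs = x ∷ xs} eq = cong₂ _+_ (eq (here refl)) (sum-zero (eq ∘ there))

  sum-single : {X : Set} {xs : List X} {f : X → ℕ} {z : X} → Unique xs → z ∈ xs → f z ≡ 1 →
               (∀ {x} → x ∈ xs → x ≢ z → f x ≡ 0) → sum (map f xs) ≡ 1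
  sum-single u (here refl) e e' = cong₂ _+_ e
    (sum-zero (λ x∈ → e' (there x∈) (λ { refl → Unique.Unique[x∷xs]⇒x∉xs u x∈ })))
  sum-single u (there z∈) e e' = cong₂ _+_ (e' (here refl) (λ { refl → Unique.Unique[x∷xs]⇒x∉xs u z∈ }))
    (sum-single (unique-tail u) z∈ e (e' ∘ there))

  -- The body of `edges` with its counts abstracted; `edges` unfolds to it, so the case analysis
  -- needs only numbers.
  edgeValue : (nb np nm l : ℕ) → ℕ
  edgeValue nb np nm l = if nb ≡ᵇ 0
    then (if (np ≡ᵇ 0) ∧ (nm ≡ᵇ 0) then l else if (np ≤ᵇ 1) ∧ (nm ≤ᵇ 1) then 1 else 0)
    else 0

  edgeValue-1 : ∀ {nb np nm l} → nb ≡ 0 → np ≤ 1 → nm ≤ 1 → ¬ (np ≡ 0 × nm ≡ 0) → edgeValue nb np nm l ≡ 1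
  edgeValue-1 {np = zero}  {zero}  refl _ _ ne = contradiction (refl , refl) ne
  edgeValue-1 {np = zero}  {suc .0} refl _ (s≤s z≤n) _ = refl
  edgeValue-1 {np = suc .0} {zero}  refl (s≤s z≤n) _ _ = refl
  edgeValue-1 {np = suc .0} {suc .0} refl (s≤s z≤n) (s≤s z≤n) _ = refl

  edgeValue-0 : ∀ {nb np nm l} → ¬ (nb ≡ 0 × np ≤ 1 × nm ≤ 1) → edgeValue nb np nm l ≡ 0
  edgeValue-0 {suc nb} _ = refl
  edgeValue-0 {zero} {suc (suc np)} _ = refl
  edgeValue-0 {zero} {zero} {suc (suc nm)} _ = refl
  edgeValue-0 {zero} {suc zero} {suc (suc nm)} _ = refl
  edgeValue-0 {zero} {zero} {zero} ne = contradiction (refl , z≤n , z≤n) ne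
  edgeValue-0 {zero} {zero} {suc zero} ne = contradiction (refl , z≤n , ≤-refl) ne
  edgeValue-0 {zero} {suc zero} {zero} ne = contradiction (refl , ≤-refl , z≤n) ne
  edgeValue-0 {zero} {suc zero} {suc zero} ne = contradiction (refl , ≤-refl , ≤-refl) ne

  edges-refl : ∀ j (A : Matrix R m) → edges j A A ≡ loops j A
  edges-refl j A with LeM-trip (LeM-refl A) (LeM-refl A)
  ... | nb , inj₁ (np , nm , _) rewrite nb | np | nm = refl
  ... | _ , inj₂ (() , _)

  edges-≢ : ∀ j {A C : Matrix R m} → Vertex j A → Vertex j C → A ≢ C →
            edges j A C ≡ sum (map (λ B → ι (up? A B) * ι (up? C B)) (vertices j (suc m) R))
  edges-≢ {R} {m} j {A} {C} vA vC A≢C =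
    by-cases ((nb ≟ 0) ×-dec ((np ≤? 1) ×-dec (nm ≤? 1)))
    where
    ds = diffs A C
    nb = count isBig ds
    np = count isPlus ds
    nm = count isMinus ds

    not-both-0 : nb ≡ 0 → ¬ (np ≡ 0 × nm ≡ 0)
    not-both-0 e (e₁ , e₂) = let (l , l') = LeM-sup A C e in
      A≢C (trans (proj₁ (LeM⇒incr l) e₂) (sym (proj₁ (LeM⇒incr l') e₁)))

    below : ∀ {B} → Up A B → Up C B → (nb ≡ 0 × np ≤ 1 × nm ≤ 1) × B ≡ sup A C
    below ab cb with Up⇒LeM ab | Up⇒LeM cb
    ... | s , s≤ , l | t , t≤ , l' with LeM-trip l l'
    ...   | e , inj₁ (refl , refl , eq) = (e , t≤ , s≤) , eq
    -- As `s` and `t` are at most 1, a place raised for both `A` and `C` would use up both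
    -- increments and leave `A` equal to `C`.
    ...   | e , inj₂ (p , q) = contradiction
              (n<1⇒n≡0 (<-≤-trans p t≤) , n<1⇒n≡0 (<-≤-trans q s≤)) (not-both-0 e)

    value-0 : ∀ {B} → ¬ (Up A B × Up C B) → ι (up? A B) * ι (up? C B) ≡ 0
    value-0 {B} = ι-*-0 (up? A B) (up? C B)

    by-cases : Dec (nb ≡ 0 × np ≤ 1 × nm ≤ 1) →
      edges j A C ≡ sum (map (λ B → ι (up? A B) * ι (up? C B)) (vertices j (suc m) R))
    by-cases (no ne) = trans (edgeValue-0 ne)
      (sym (sum-zero {xs = vertices j (suc m) R} (λ {B} _ → value-0 (λ { (a , c) → ne (proj₁ (below a c)) }))))
    by-cases (yes (e , p , q)) = trans (edgeValue-1 e p q (not-both-0 e))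
      (sym (sum-single (vertices-unique j R m) (∈-vertices⁺ j (Vertex-sup {A = A} {C} vA vC)) value-1
        (λ _ ne → value-0 (λ { (a , c) → ne (proj₂ (below a c)) }))))
      where
      value-1 : ι (up? A (sup A C)) * ι (up? C (sup A C)) ≡ 1
      value-1 = let (l , l') = LeM-sup A C e in
        cong₂ _*_ (ι-yes (up? A (sup A C)) (LeM⇒Up l q)) (ι-yes (up? C (sup A C)) (LeM⇒Up l' p))

open Matrices

-- Sequences of tableaux inside the box, read upwards from vertex 0.

module Paths (J m R : ℕ) where

  private variable
    i : ℕ

  Tab : ℕ → Set
  Tab i = Vec (Cell R) i

  -- The label of a vertex: the left end and the colour of the arc arriving there.
  Label : Set
  Label = Maybe (ℕ × Fin R)

  -- Here `J` is `j - 1` and `m` is `k - 1`. Rows are numbered from 0, so an empty row `J` means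
  -- fewer than `j` rows.
  Box : (Fin R → ℕ → ℕ) → Set
  Box α = ∀ c → α c 0 ≤ m × α c J ≡ 0

  Good : Tab i → Set
  Good U = L U × Box (cnt U)

  module _ {P : Fin R → ℕ → Set} (P? : ∀ c q → Dec (P c q)) where

    options-of : Fin R → List (Cell R)
    options-of c = map (λ q → just (c , q)) (filter (P? c) (upTo J))

    -- Serves for both moves: a cell names the box that is added or the corner that is removed, and
    -- `nothing` is the choice to leave the shape alone.
    options : List (Cell R)
    options = nothing ∷ concatMap options-of (allFin R)

    ∈-options-of⁻ : ∀ {c x} → x ∈ options-of c → ∃ λ q → x ≡ just (c , q) × q < J × P c q
    ∈-options-of⁻ {c} x∈ with ∈-map⁻ _ x∈
    ... | q , q∈ , refl = let (q∈′ , pq) = ∈-filter⁻ (P? c) q∈ in q , refl , ∈-upTo⁻ q∈′ , pq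

    ∈-options⁻ : ∀ {x} → x ∈ options →
                 x ≡ nothing ⊎ (∃₂ λ c q → x ≡ just (c , q) × q < J × P c q)
    ∈-options⁻ (here refl) = inj₁ refl
    ∈-options⁻ (there x∈) with ∈-concatMap-∃ options-of {allFin R} x∈
    ... | c , _ , x∈′ = inj₂ (c , ∈-options-of⁻ x∈′)

    ∈-options⁺ : ∀ {c q} → q < J → P c q → just (c , q) ∈ options
    ∈-options⁺ {c} lt pq =
      there (∃-∈-concatMap options-of (∈-allFin c) (∈-map⁺ _ (∈-filter⁺ (P? c) (∈-upTo⁺ lt) pq)))

    options-unique : Unique options
    options-unique = unique-∷ nothing∉
      (unique-concatMap options-of (Unique.allFin⁺ R)
        (λ {c} _ → unique-map _ (Unique.filter⁺ (P? c) (Unique.upTo⁺ J)) λ { _ _ refl → refl })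
        disjoint)
      where
      nothing∉ : nothing ∉ concatMap options-of (allFin R)
      nothing∉ x∈ with ∈-concatMap-∃ options-of {allFin R} x∈
      ... | c , _ , x∈′ with ∈-options-of⁻ x∈′
      ... | _ , () , _
      disjoint : ∀ {c c' x} → c ∈ allFin R → c' ∈ allFin R → x ∈ options-of c → x ∈ options-of c' → c ≡ c'
      disjoint _ _ x∈ x∈′ with ∈-options-of⁻ x∈ | ∈-options-of⁻ x∈′
      ... | _ , refl , _ | _ , refl , _ = refl

  -- The box acts as a row of length m above row 0.
  above : (ℕ → ℕ) → ℕ → ℕ
  above α zero    = m
  above α (suc q) = α q

  Addable : (Fin R → ℕ → ℕ) → Fin R → ℕ → Set
  Addable α c q = α c q < above (α c) q

  addable? : ∀ α c q → Dec (Addable α c q)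
  addable? α c q = suc (α c q) ≤? above (α c) q

  removable? : ∀ α c q → Dec (Removable {R} α c q)
  removable? α c q = suc (α c (suc q)) ≤? α c q

  opens : Tab i → List (Cell R)
  opens U = options (addable? (cnt U))

  uninsert : Tab i → Cell R → Tab i × Label
  uninsert T nothing        = T , nothing
  uninsert T (just (c , q)) = let (U , p) = rev c q T in U , just (p , c)

  corners : Tab i → List (Cell R)
  corners T = options (removable? (cnt T))

  Part-antitone : {α : Fin R → ℕ → ℕ} → Part α → ∀ c {q q'} → q ≤ q' → α c q' ≤ α c q
  Part-antitone {α} part c {q} {q'} le = go (≤⇒≤′ le)
    where
    go : ∀ {q'} → q ≤′ q' → α c q' ≤ α c q
    go ≤′-refl      = ≤-refl
    go (≤′-step le) = ≤-trans (part c _) (go le)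

  Good-Part : {U : Tab i} → Good U → Part (cnt U)
  Good-Part {U = U} (l , _) = L⇒Part U l

  row<J : {α : Fin R → ℕ → ℕ} → Part α → Box α → ∀ {c q} → 0 < α c q → q < J
  row<J part box {c} {q} lt with suc q ≤? J
  ... | yes q<J = q<J
  ... | no q≮J  = contradiction
    (subst (0 <_) (proj₂ (box c)) (≤-trans lt (Part-antitone part c (≮⇒≥ q≮J)))) (λ ())

  Good-row< : {U : Tab i} {c : Fin R} {q : ℕ} → Good U → 0 < cnt U c q → q < J
  Good-row< {U = U} g = row<J (Good-Part {U = U} g) (proj₂ g)

  Good-addable : {U : Tab i} {c : Fin R} {q : ℕ} → Good (just (c , q) ∷ U) → q < J × Addable (cnt U) c q
  Good-addable {U = U} {c} {q} g@((ok , l) , box) = Good-row< {U = just (c , q) ∷ U} {c = c} g (∋⇒cnt {c = c} {q = q} (head {U = U})) , go q g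
    where
    go : ∀ q → Good (just (c , q) ∷ U) → Addable (cnt U) c q
    go zero    (_ , box)        = subst (λ v → v + cnt U c 0 ≤ m) (δ-hit c 0) (proj₁ (box c))
    go (suc q) ((ok , _) , _) = ok

  addable-Good : {U : Tab i} {c : Fin R} {q : ℕ} → Good U → q < J → Addable (cnt U) c q →
                 Good (just (c , q) ∷ U)
  addable-Good {U = U} {c} {q} (l , box) lt ad = (addOK q ad , l) , λ c' → first c' q ad
      , trans (cong (_+ cnt U c' J) (δ-miss {x = just (c , q)} (λ { refl → <-irrefl refl lt }))) (proj₂ (box c'))
    where
    addOK : ∀ q → Addable (cnt U) c q → AddOK (cnt U) (just (c , q))
    addOK zero    _  = tt
    addOK (suc q) ad = ad
    first : ∀ c' q → Addable (cnt U) c q → δ (just (c , q)) c' 0 + cnt U c' 0 ≤ m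
    first c' q ad with (c , q) ≟K (c' , 0)
    ... | no ne    = proj₁ (box c')
    ... | yes refl = ad

  ∈-opens⁻ : {U : Tab i} {x : Cell R} → Good U → x ∈ opens U → Good (x ∷ U)
  ∈-opens⁻ {U = U} g x∈ with ∈-options⁻ (addable? (cnt U)) x∈
  ... | inj₁ refl                     = (tt , proj₁ g) , proj₂ g
  ... | inj₂ (c , q , refl , lt , ad) = addable-Good g lt ad

  ∈-opens⁺ : {U : Tab i} (x : Cell R) → Good (x ∷ U) → x ∈ opens U
  ∈-opens⁺ nothing        g = here refl
  ∈-opens⁺ {U = U} (just (c , q)) g = let (lt , ad) = Good-addable g in ∈-options⁺ (addable? (cnt U)) lt ad

  Good-uninsert : {U T : Tab i} {c : Fin R} {p q : ℕ} → Good T → L U → Ins c U p T q → Good U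
  Good-uninsert (_ , box) l d = l , λ c →
      ≤-trans (Ins-cnt-≤ d c 0) (proj₁ (box c))
    , n≤0⇒n≡0 (subst (_ ≤_) (proj₂ (box c)) (Ins-cnt-≤ d c J))

  Good-removable : {U T : Tab i} {c : Fin R} {p q : ℕ} → Good T → Good U → Ins c U p T q →
                   just (c , q) ∈ corners T
  Good-removable {U = U} {T} {c} {q = q} gT gU d =
    ∈-options⁺ (removable? (cnt T)) (Good-row< {U = T} gT (≤-trans (s≤s z≤n) rm)) rm
    where
    rm : Removable (cnt T) c q
    rm = subst₂ _<_ (sym (Ins-cnt-miss d (λ ()))) (sym (Ins-cnt-hit d)) (s≤s (Good-Part {U = U} gU c q))

  ∈-corners⁻ : {T : Tab i} {x : Cell R} → Good T → x ∈ corners T →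
    (x ≡ nothing × uninsert T x ≡ (T , nothing)) ⊎
    (∃₂ λ c q → x ≡ just (c , q) × (∃₂ λ U p → uninsert T x ≡ (U , just (p , c)) × Ins c U p T q × Good U))
  ∈-corners⁻ {T = T} g x∈ with ∈-options⁻ (removable? (cnt T)) x∈
  ... | inj₁ refl = inj₁ (refl , refl)
  ... | inj₂ (c , q , refl , lt , rm) = let (d , l) = rev-Ins T (proj₁ g) rm
    in inj₂ (c , q , refl , _ , _ , refl , d , Good-uninsert g l d)

  Ins⇒uninsert : {U T : Tab i} {c : Fin R} {p q : ℕ} → Good T → Good U → Ins c U p T q →
                 uninsert T (just (c , q)) ≡ (U , just (p , c))
  Ins⇒uninsert {T = T} gT gU d with ∈-corners⁻ gT (Good-removable gT gU d)
  ... | inj₁ (() , _)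
  ... | inj₂ (c , q , refl , U , p , eq , d' , _) with Ins-injective d d'
  ...   | refl , refl = eq

  State : ℕ → Set
  State i = Tab i × List Label

  closings : State i → Cell R → List (State (suc i))
  closings (U , s) x = map (λ o → let (U' , l) = uninsert (x ∷ U) o in U' , l ∷ s) (corners (x ∷ U))

  next : State i → List (State (suc i))
  next (U , s) = concatMap (closings (U , s)) (opens U)

  -- U is the tableau right after the arc arriving at vertex i has been closed; pairing
  -- this with the next opening aligns the states with the vertices of the walk.
  states : ∀ i → List (State i)
  states zero    = ([] , nothing ∷ []) ∷ []
  states (suc i) = concatMap next (states i)

  -- `Rev` read backwards: `x` is the opening at one vertex, and `close` undoes a row insertion at
  -- the next. In `start` the single label is that of vertex 0, where no arc arrives.
  data Path : Tab i → List Label → Set where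
    start : Path [] (nothing ∷ [])
    skip  : ∀ {U : Tab i} {s x} → Path U s → Good (x ∷ U) → Path (x ∷ U) (nothing ∷ s)
    close : ∀ {U : Tab i} {U' s x c p q} → Path U s → Good (x ∷ U) → Good U' →
            Ins c U' p (x ∷ U) q → Path U' (just (p , c) ∷ s)

  Path-Good : {U : Tab i} {s : List Label} → Path U s → Good U
  Path-Good start           = tt , λ _ → z≤n , refl
  Path-Good (skip _ g)      = g
  Path-Good (close _ _ g _) = g

  -- Keeps the tableau `V` over the gap visible. It can be recovered from `z`, by inserting the
  -- label again if there is one, and this gives the disjointness needed in `states-unique`.
  data Came {i} (z : State (suc i)) (V : Tab (suc i)) (s : List Label) : Set where
    by-skip  : z ≡ (V , nothing ∷ s) → Came z V s
    by-close : ∀ {U' p c q} → z ≡ (U' , just (p , c) ∷ s) → Good U' → Ins c U' p V q → Came z V s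

  ∈-closings⁻ : {U : Tab i} {s : List Label} {x : Cell R} {z : State (suc i)} → Good (x ∷ U) →
                z ∈ closings (U , s) x → Came z (x ∷ U) s
  ∈-closings⁻ {U = U} {s} {x} g z∈
    with ∈-map⁻ (λ o → proj₁ (uninsert (x ∷ U) o) , proj₂ (uninsert (x ∷ U) o) ∷ s) {xs = corners (x ∷ U)} z∈
  ... | o , o∈ , refl with ∈-corners⁻ g o∈
  ...   | inj₁ (_ , eq) = by-skip (cong (λ u → proj₁ u , proj₂ u ∷ s) eq)
  ...   | inj₂ (c , q , _ , U' , p , eq , d , g') =
            by-close (cong (λ u → proj₁ u , proj₂ u ∷ s) eq) g' d

  ∈-next⁻ : {U : Tab i} {s : List Label} {z : State (suc i)} → Path U s → z ∈ next (U , s) →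
            ∃ λ x → Good (x ∷ U) × Came z (x ∷ U) s
  ∈-next⁻ {U = U} {s} P z∈ with ∈-concatMap-∃ (closings (U , s)) z∈
  ... | x , x∈ , z∈′ = let g = ∈-opens⁻ (Path-Good P) x∈ in x , g , ∈-closings⁻ g z∈′

  states⇒Path : {U : Tab i} {s : List Label} → (U , s) ∈ states i → Path U s
  states⇒Path {zero} (here refl) = start
  states⇒Path {suc i} z∈ with ∈-concatMap-∃ next z∈
  ... | (U , s) , us∈ , z∈′ with ∈-next⁻ (states⇒Path us∈) z∈′
  ...   | x , g , by-skip refl       = skip (states⇒Path us∈) g
  ...   | x , g , by-close refl g' d = close (states⇒Path us∈) g g' d

  Path⇒states : {U : Tab i} {s : List Label} → Path U s → (U , s) ∈ states i
  Path⇒states start = here refl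
  Path⇒states (skip {x = x} P g) =
    ∃-∈-concatMap next (Path⇒states P)
      (∃-∈-concatMap (closings _) (∈-opens⁺ x g) (here refl))
  Path⇒states (close {U = U} {U'} {s} {x} {c} {p} {q} P g g' d) =
    ∃-∈-concatMap next (Path⇒states P)
      (∃-∈-concatMap (closings _) (∈-opens⁺ x g)
        (subst (λ v → (proj₁ v , proj₂ v ∷ s) ∈ closings (U , s) x) (Ins⇒uninsert g g' d)
          (∈-map⁺ _ (Good-removable g g' d))))

  Came-unique : {z : State (suc i)} {V V' : Tab (suc i)} {s s' : List Label} → Came z V s → Came z V' s' →
                V ≡ V' × s ≡ s'
  Came-unique (by-skip refl) (by-skip refl) = refl , refl
  Came-unique (by-skip refl) (by-close () _ _)
  Came-unique (by-close refl _ _) (by-skip ())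
  Came-unique (by-close refl _ d) (by-close refl _ d') = proj₁ (Ins-functional d d') , refl

  corner-unique : {T : Tab i} {o o' : Cell R} → Good T → o ∈ corners T → o' ∈ corners T →
                  uninsert T o ≡ uninsert T o' → o ≡ o'
  corner-unique {T = T} {o} {o'} g o∈ o∈′ eq with ∈-corners⁻ g o∈ | ∈-corners⁻ g o∈′
  ... | inj₁ (refl , _) | inj₁ (refl , _) = refl
  ... | inj₁ (refl , _) | inj₂ (_ , _ , refl , _ , _ , e , _) = contradiction (cong proj₂ eq) λ ()
  ... | inj₂ (_ , _ , refl , _ , _ , e , _) | inj₁ (refl , _) = contradiction (cong proj₂ eq) λ ()
  ... | inj₂ (c , q , refl , U , p , e , d , _) | inj₂ (c' , q' , refl , U' , p' , e' , d' , _)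
        with trans (sym e) (trans eq e')
  ...   | refl with Ins-functional d d'
  ...     | _ , refl = refl

  uncons-injective : {A B : Set} {U U' : A} {l l' : B} {s s' : List B} →
                     (U , l ∷ s) ≡ (U' , l' ∷ s') → (U , l) ≡ (U' , l')
  uncons-injective refl = refl

  states-unique : ∀ i → Unique (states i)
  states-unique zero    = All.[] AllPairs.∷ AllPairs.[]
  states-unique (suc i) = unique-concatMap next (states-unique i)
    (λ { {U , s} us∈ → let g = Path-Good (states⇒Path us∈) in
         unique-concatMap (closings (U , s)) (options-unique (addable? (cnt U)))
           (λ {x} x∈ → unique-map _ (options-unique (removable? (cnt (x ∷ U))))
              λ o∈ o∈′ eq → corner-unique (∈-opens⁻ g x∈) o∈ o∈′ (uncons-injective eq))
           λ x∈ y∈ z∈ z∈′ → cong Vec.head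
              (proj₁ (Came-unique (∈-closings⁻ (∈-opens⁻ g x∈) z∈) (∈-closings⁻ (∈-opens⁻ g y∈) z∈′))) })
    λ { {U , s} {U' , s'} us∈ us∈′ z∈ z∈′ →
      let (_ , _ , c)  = ∈-next⁻ (states⇒Path us∈) z∈
          (_ , _ , c') = ∈-next⁻ (states⇒Path us∈′) z∈′
          (e , e') = Came-unique c c'
      in cong₂ _,_ (cong Vec.tail e) e' }

-- From tableaux to shapes: the transfer to walks in the graph.

module Counting (J m R : ℕ) where

  open Paths J m R

  private variable
    i : ℕ

  record Shape (α : Fin R → ℕ → ℕ) : Set where
    constructor mkShape
    field
      part : Part α
      box  : Box α
  open Shape

  shape : {U : Tab i} → Good U → Shape (cnt U)
  shape {U = U} g = mkShape (Good-Part {U = U} g) (proj₂ g)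

  -- Row c of the matrix lists the column lengths of the Young diagram α c.
  record Conj (α : Fin R → ℕ → ℕ) (A : Matrix R m) : Set where
    constructor mkConj
    field
      at : ∀ c ℓ q → (q < entry A c ℓ → toℕ ℓ < α c q) × (toℕ ℓ < α c q → q < entry A c ℓ)
  open Conj

  -- For a partition `β` with at most `n` rows this is the length of column `ℓ`.
  height : (ℕ → ℕ) → ℕ → ℕ → ℕ
  height β ℓ zero    = 0
  height β ℓ (suc n) with suc ℓ ≤? β 0
  ... | yes _ = suc (height (β ∘ suc) ℓ n)
  ... | no _  = 0

  conj : (Fin R → ℕ → ℕ) → Matrix R m
  conj α = tabulate (λ c → tabulate (λ ℓ → height (α c) (toℕ ℓ) J))

  height⁻ : ∀ β ℓ n q → q < height β ℓ n → ℓ < β q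
  height⁻ β ℓ (suc n) q lt with suc ℓ ≤? β 0
  height⁻ β ℓ (suc n) zero    lt       | yes p = p
  height⁻ β ℓ (suc n) (suc q) (s≤s lt) | yes p = height⁻ (β ∘ suc) ℓ n q lt

  height⁺ : ∀ β ℓ n q → (∀ q' → q' ≤ q → ℓ < β q') → q < n → q < height β ℓ n
  height⁺ β ℓ (suc n) q       lt q<n with suc ℓ ≤? β 0
  height⁺ β ℓ (suc n) zero    lt q<n       | yes p = s≤s z≤n
  height⁺ β ℓ (suc n) (suc q) lt (s≤s q<n) | yes p =
    s≤s (height⁺ (β ∘ suc) ℓ n q (λ q' l → lt (suc q') (s≤s l)) q<n)
  height⁺ β ℓ (suc n) q       lt q<n | no ¬p = contradiction (lt 0 z≤n) ¬p

  row≤m : {α : Fin R → ℕ → ℕ} → Shape α → ∀ c q → α c q ≤ m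
  row≤m (mkShape part box) c q = ≤-trans (Part-antitone part c z≤n) (proj₁ (box c))

  conj-Conj : {α : Fin R → ℕ → ℕ} → Shape α → Conj α (conj α)
  conj-Conj {α} s@(mkShape part box) = mkConj λ c ℓ q → subst (λ v → (q < v → toℕ ℓ < α c q) × (toℕ ℓ < α c q → q < v))
    (sym (trans (cong (λ u → lookup u ℓ) (lookup∘tabulate _ c)) (lookup∘tabulate _ ℓ)))
    ( height⁻ (α c) (toℕ ℓ) J q
    , λ lt → height⁺ (α c) (toℕ ℓ) J q (λ q' l → <-≤-trans lt (Part-antitone part c l))
               (row<J part box (≤-trans (s≤s z≤n) lt)))

  Conj-Vertex : {α : Fin R → ℕ → ℕ} {A : Matrix R m} → Shape α → Conj α A → Vertex (suc J) A
  Conj-Vertex {α} {A} (mkShape part box) cj = small , anti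
    where
    small : ∀ c ℓ → entry A c ℓ < suc J
    small c ℓ = s≤s (≮⇒≥ λ lt → contradiction (subst (toℕ ℓ <_) (proj₂ (box c)) (proj₁ (at cj c ℓ J) lt)) λ ())
    anti : ∀ c → Antitone (lookup A c)
    anti c s t l = ≮⇒≥ λ lt →
      <-irrefl refl (proj₂ (at cj c s _) (≤-<-trans l (proj₁ (at cj c t _) lt)))

  Conj-functional : {α : Fin R → ℕ → ℕ} {A B : Matrix R m} → Conj α A → Conj α B → A ≡ B
  Conj-functional ca cb = entry-ext λ c ℓ → ≤-antisym
    (≮⇒≥ λ lt → <-irrefl refl (proj₂ (at cb c ℓ _) (proj₁ (at ca c ℓ _) lt)))
    (≮⇒≥ λ lt → <-irrefl refl (proj₂ (at ca c ℓ _) (proj₁ (at cb c ℓ _) lt)))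

  Conj-≤ : {α β : Fin R → ℕ → ℕ} {A : Matrix R m} → Shape β → Conj α A → Conj β A → ∀ c q → β c q ≤ α c q
  Conj-≤ {α} {β} sb ca cb c q = ≮⇒≥ λ lt →
    let α<m = <-≤-trans lt (row≤m sb c q)
        ℓ   = fromℕ< α<m
        eq  = toℕ-fromℕ< α<m
    in <-irrefl eq (proj₁ (at ca c ℓ q) (proj₂ (at cb c ℓ q) (subst (_< β c q) (sym eq) lt)))

  Conj-injective : {α β : Fin R → ℕ → ℕ} {A : Matrix R m} → Shape α → Shape β → Conj α A → Conj β A →
                   ∀ c q → α c q ≡ β c q
  Conj-injective sa sb ca cb c q = ≤-antisym (Conj-≤ sa cb ca c q) (Conj-≤ sb ca cb c q)

  record Plus (α β : Fin R → ℕ → ℕ) (c : Fin R) (q : ℕ) : Set where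
    constructor mkPlus
    field
      plus-δ : ∀ c' q' → β c' q' ≡ δ (just (c , q)) c' q' + α c' q'
  open Plus

  module _ {α β : Fin R → ℕ → ℕ} {c : Fin R} {q : ℕ} (pl : Plus α β c q) where

    Plus-hit : β c q ≡ suc (α c q)
    Plus-hit = trans (plus-δ pl c q) (cong (_+ α c q) (δ-hit c q))

    Plus-miss : ∀ {c' q'} → (c , q) ≢ (c' , q') → β c' q' ≡ α c' q'
    Plus-miss {c'} {q'} ne = trans (plus-δ pl c' q') (cong (_+ α c' q') (δ-miss {x = just (c , q)} (λ { refl → ne refl })))

    Plus-column : Shape β → α c q < m
    Plus-column sb = subst (_≤ m) Plus-hit (row≤m sb c q)

  -- The box added at the end of row `q` lands in column `α c q`, which row `q` of `α` does not
  -- reach. As `β` is a partition, all rows above it do.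
  Conj-entry : {α β : Fin R → ℕ → ℕ} {A : Matrix R m} → Conj α A → Shape β → ∀ c q → Plus α β c q →
               ∀ ℓ → toℕ ℓ ≡ α c q → entry A c ℓ ≡ q
  Conj-entry {α} {β} {A} ca sb c q pl ℓ eq = ≤-antisym
    (≮⇒≥ λ lt → <-irrefl eq (proj₁ (at ca c ℓ q) lt)) (lower q pl eq)
    where
    lower : ∀ q → Plus α β c q → toℕ ℓ ≡ α c q → q ≤ entry A c ℓ
    lower zero    _  _  = z≤n
    lower (suc q) pl eq = proj₂ (at ca c ℓ q) (subst (_< α c q) (sym eq)
      (subst₂ _≤_ (Plus-hit pl) (Plus-miss pl (λ ())) (part sb c q)))

  Conj-incr : {α β : Fin R → ℕ → ℕ} {A : Matrix R m} → Shape α → Conj α A → Shape β →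
              ∀ c q → Plus α β c q → ∀ ℓ → toℕ ℓ ≡ α c q → Conj β (incr A c ℓ)
  Conj-incr {α} {β} {A} sa ca sb c q pl ℓ eq = mkConj conj-at
    where
    conj-at : ∀ c' ℓ' q' → (q' < entry (incr A c ℓ) c' ℓ' → toℕ ℓ' < β c' q') ×
                           (toℕ ℓ' < β c' q' → q' < entry (incr A c ℓ) c' ℓ')
    conj-at c' ℓ' q' with c Fin.≟ c' | ℓ Fin.≟ ℓ'
    ... | yes refl | yes refl = subst (λ v → (q' < v → toℕ ℓ < β c q') × (toℕ ℓ < β c q' → q' < v))
            (sym (trans (entry-incr A c ℓ) (cong suc (Conj-entry ca sb c q pl ℓ eq)))) (to , from)
      where
      to : q' < suc q → toℕ ℓ < β c q'
      to (s≤s l) = ≤-trans (subst₂ _≤_ (cong suc (sym eq)) (sym (Plus-hit pl)) ≤-refl) (Part-antitone (part sb) c l)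
      from : toℕ ℓ < β c q' → q' < suc q
      from lt with suc q' ≤? suc q
      ... | yes p = p
      ... | no ¬p = contradiction
        (≤-trans (subst (_< β c q') eq lt)
          (subst (_≤ α c q) (sym (Plus-miss pl (λ { refl → ¬p ≤-refl })))
            (Part-antitone (part sa) c (≤-trans (n≤1+n q) (≤-pred (≰⇒> ¬p))))))
        (<-irrefl refl)
    ... | no c≢ | _ = subst₂ (λ v w → (q' < v → toℕ ℓ' < w) × (toℕ ℓ' < w → q' < v))
            (sym (entry-incr-≢ A (λ { refl → c≢ refl }))) (sym (Plus-miss pl (λ { refl → c≢ refl }))) (at ca c' ℓ' q')
    ... | yes refl | no ℓ≢ with q ≟ q'
    ...   | no q≢ = subst₂ (λ v w → (q' < v → toℕ ℓ' < w) × (toℕ ℓ' < w → q' < v))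
            (sym (entry-incr-≢ A (λ { refl → ℓ≢ refl }))) (sym (Plus-miss pl (λ { refl → q≢ refl }))) (at ca c' ℓ' q')
    ...   | yes refl = subst₂ (λ v w → (q < v → toℕ ℓ' < w) × (toℕ ℓ' < w → q < v))
            (sym (entry-incr-≢ A (λ { refl → ℓ≢ refl }))) (sym (Plus-hit pl))
            ( (λ lt → m≤n⇒m≤1+n (proj₁ (at ca c ℓ' q) lt))
            , (λ lt → proj₂ (at ca c ℓ' q) (≤∧≢⇒< (≤-pred lt) (λ e → ℓ≢ (toℕ-injective (trans eq (sym e)))))))

  conj-incr : {α β : Fin R → ℕ → ℕ} → Shape α → Shape β → ∀ c q → Plus α β c q →
              ∀ ℓ → toℕ ℓ ≡ α c q → conj β ≡ incr (conj α) c ℓ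
  conj-incr sa sb c q pl ℓ eq = Conj-functional (conj-Conj sb) (Conj-incr sa (conj-Conj sa) sb c q pl ℓ eq)

  conj-Up : {α β : Fin R → ℕ → ℕ} → Shape α → Shape β → ∀ c q → Plus α β c q → Up (conj α) (conj β)
  conj-Up sa sb c q pl = inj₂ (c , fromℕ< (Plus-column pl sb) ,
    conj-incr sa sb c q pl _ (toℕ-fromℕ< (Plus-column pl sb)))

  -- Weak decrease of the incremented row makes `ℓ` the first column of height `q`: were row `q` to
  -- end before `ℓ`, the column `α c q` would have to be at least as high as the incremented one.
  -- The bound on the entries gives `q < J`.
  addable-corner : {α : Fin R → ℕ → ℕ} {A : Matrix R m} → Shape α → Conj α A → ∀ c ℓ →
    Vertex (suc J) (incr A c ℓ) → let q = entry A c ℓ in q < J × Addable α c q × toℕ ℓ ≡ α c q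
  addable-corner {α} {A} sa ca c ℓ (small , anti) = q<J , ad , ℓ≡
    where
    q = entry A c ℓ
    q<J : q < J
    q<J = ≤-pred (subst (_< suc J) (entry-incr A c ℓ) (small c ℓ))
    α≤ℓ : α c q ≤ toℕ ℓ
    α≤ℓ = ≮⇒≥ λ lt → <-irrefl refl (proj₂ (at ca c ℓ q) lt)
    ℓ≤α : toℕ ℓ ≤ α c q
    ℓ≤α = ≮⇒≥ λ lt →
      let lt′ = <-trans lt (toℕ<n ℓ)
          ℓ′  = fromℕ< lt′
          e   = toℕ-fromℕ< lt′
          q<  = subst₂ _≤_ (entry-incr A c ℓ)
                  (entry-incr-≢ A (λ eq → <-irrefl (trans (sym e) (cong (toℕ ∘ proj₂) (sym eq))) lt))
                  (anti c ℓ′ ℓ (subst (_≤ toℕ ℓ) (sym e) (<⇒≤ lt)))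
      in <-irrefl e (proj₁ (at ca c ℓ′ q) q<)
    ℓ≡ : toℕ ℓ ≡ α c q
    ℓ≡ = ≤-antisym ℓ≤α α≤ℓ
    above-q : ∀ q' → q' ≡ q → α c q' < above (α c) q'
    above-q zero     e = subst (_< m) (trans ℓ≡ (cong (α c) (sym e))) (toℕ<n ℓ)
    above-q (suc q') e = subst (_< α c q') (trans ℓ≡ (cong (α c) (sym e))) (proj₁ (at ca c ℓ q') (≤-reflexive e))
    ad : Addable α c q
    ad = above-q q refl

  -- Dually, weak decrease of `C` keeps every column to the right of `ℓ` at height at most `q`, so
  -- the incremented column carries the last box of row `q`.
  removable-corner : {α : Fin R → ℕ → ℕ} {C : Matrix R m} → Shape α → ∀ c ℓ → Conj α (incr C c ℓ) →
    Vertex (suc J) C → let q = entry C c ℓ in q < J × Removable α c q × α c q ≡ suc (toℕ ℓ)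
  removable-corner {α} {C} sa c ℓ ca (small , anti) =
    row<J (part sa) (box sa) (≤-trans (s≤s z≤n) ℓ<) , <-≤-trans (s≤s next≤) ℓ< , ≤-antisym ≤ℓ ℓ<
    where
    q = entry C c ℓ
    ℓ< : toℕ ℓ < α c q
    ℓ< = proj₁ (at ca c ℓ q) (≤-reflexive (sym (entry-incr C c ℓ)))
    next≤ : α c (suc q) ≤ toℕ ℓ
    next≤ = ≮⇒≥ λ lt → <-irrefl (sym (entry-incr C c ℓ)) (proj₂ (at ca c ℓ (suc q)) lt)
    ≤ℓ : α c q ≤ suc (toℕ ℓ)
    ≤ℓ = ≮⇒≥ λ lt →
      let lt′ = <-≤-trans lt (row≤m sa c q)
          ℓ′  = fromℕ< lt′
          e   = toℕ-fromℕ< lt′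
          q<  = proj₂ (at ca c ℓ′ q) (subst (_< α c q) (sym e) lt)
      in <-irrefl refl (<-≤-trans q< (subst (_≤ q)
           (sym (entry-incr-≢ C (λ eq → <-irrefl (trans (cong (toℕ ∘ proj₂) eq) e) ≤-refl)))
           (anti c ℓ ℓ′ (subst (toℕ ℓ ≤_) (sym e) (n≤1+n _)))))

  V : List (Matrix R m)
  V = vertices (suc J) (suc m) R

  matrix : Tab i → Matrix R m
  matrix U = conj (cnt U)

  matrix-Conj : {U : Tab i} → Good U → Conj (cnt U) (matrix U)
  matrix-Conj {U = U} g = conj-Conj (shape {U = U} g)

  matrix-Vertex : {U : Tab i} → Good U → Vertex (suc J) (matrix U)
  matrix-Vertex {U = U} g = Conj-Vertex (shape {U = U} g) (matrix-Conj {U = U} g)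

  matrix-cnt : {n : ℕ} {U : Tab i} {W : Tab n} → Good U → Good W → matrix U ≡ matrix W → ∀ c q → cnt U c q ≡ cnt W c q
  matrix-cnt {U = U} {W} g g' eq = Conj-injective (shape {U = U} g) (shape {U = W} g')
    (matrix-Conj {U = U} g) (subst (Conj (cnt W)) (sym eq) (matrix-Conj {U = W} g'))

  δ-injective : {x y : Cell R} → (∀ c q → δ x c q ≡ δ y c q) → x ≡ y
  δ-injective {nothing} {nothing} eq = refl
  δ-injective {nothing} {just (c , q)} eq = contradiction (trans (eq c q) (δ-hit c q)) λ ()
  δ-injective {just (c , q)} {y} eq with y ≟C just (c , q)
  ... | yes e = sym e
  ... | no ne = contradiction (trans (sym (δ-hit c q)) (trans (eq c q) (δ-miss ne))) λ ()

  -- The opened cell can be read off from the change of shape, by `δ-injective`; hence the options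
  -- correspond bijectively to the vertices that equal or cover `matrix U`.
  open-sum : (h : Matrix R m → ℕ) {U : Tab i} → Good U →
    sum (map (λ x → h (matrix (x ∷ U))) (opens U)) ≡ sum (map (λ B → ι (up? (matrix U) B) * h B) V)
  open-sum h {U} g = begin
    sum (map (λ x → h (matrix (x ∷ U))) (opens U))      ≡⟨ cong sum (List.map-∘ (opens U)) ⟩
    sum (map h (map (λ x → matrix (x ∷ U)) (opens U)))  ≡⟨ sum-set h unique-left
                                                             (Unique.filter⁺ (up? (matrix U)) (vertices-unique (suc J) R m)) to from ⟩
    sum (map h (filter (up? (matrix U)) V))             ≡⟨ sum-filter (up? (matrix U)) h V ⟩
    sum (map (λ B → ι (up? (matrix U) B) * h B) V)      ∎
    where
    open ≡-Reasoning
    unique-left : Unique (map (λ x → matrix (x ∷ U)) (opens U))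
    unique-left = unique-map _ (options-unique (addable? (cnt U))) λ {x} {y} x∈ y∈ eq →
      δ-injective λ c q → +-cancelʳ-≡ (cnt U c q) (δ x c q) (δ y c q)
        (matrix-cnt {U = x ∷ U} {y ∷ U} (∈-opens⁻ g x∈) (∈-opens⁻ g y∈) eq c q)
    to : ∀ {B} → B ∈ map (λ x → matrix (x ∷ U)) (opens U) → B ∈ filter (up? (matrix U)) V
    to B∈ with ∈-map⁻ _ B∈
    ... | x , x∈ , refl = ∈-filter⁺ (up? (matrix U)) (∈-vertices⁺ (suc J) (matrix-Vertex {U = x ∷ U} g')) (up x g')
      where
      g' = ∈-opens⁻ g x∈
      up : ∀ x → Good (x ∷ U) → Up (matrix U) (matrix (x ∷ U))
      up nothing        _  = inj₁ refl
      up (just (c , q)) g' = conj-Up (shape {U = U} g) (shape {U = just (c , q) ∷ U} g') c q (mkPlus λ _ _ → refl)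
    from : ∀ {B} → B ∈ filter (up? (matrix U)) V → B ∈ map (λ x → matrix (x ∷ U)) (opens U)
    from B∈ with ∈-filter⁻ (up? (matrix U)) {xs = V} B∈
    ... | _   , inj₁ refl           = ∈-map⁺ (λ x → matrix (x ∷ U)) {x = nothing} (here refl)
    ... | B∈′ , inj₂ (c , ℓ , refl) with addable-corner (shape {U = U} g) (matrix-Conj {U = U} g) c ℓ (∈-vertices⁻ (suc J) B∈′)
    ...   | lt , ad , e = subst (_∈ map (λ x → matrix (x ∷ U)) (opens U))
              (conj-incr (shape {U = U} g) (shape {U = just _ ∷ U} (addable-Good g lt ad)) c _ (mkPlus λ _ _ → refl) ℓ e)
              (∈-map⁺ (λ x → matrix (x ∷ U)) (∈-options⁺ (addable? (cnt U)) lt ad))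

  -- Every corner of `T` comes from exactly one insertion. So the shapes after a closing depend only
  -- on the shape of `T`, although the label that leaves depends on `T` itself.
  close-sum : (h : Matrix R m → ℕ) {T : Tab i} → Good T →
    sum (map (λ o → h (matrix (proj₁ (uninsert T o)))) (corners T)) ≡ sum (map (λ C → ι (up? C (matrix T)) * h C) V)
  close-sum h {T} g = begin
    sum (map (λ o → h (after o)) (corners T))           ≡⟨ cong sum (List.map-∘ (corners T)) ⟩
    sum (map h (map after (corners T)))                 ≡⟨ sum-set h unique-left
                                                             (Unique.filter⁺ up′? (vertices-unique (suc J) R m)) to from ⟩
    sum (map h (filter up′? V))                         ≡⟨ sum-filter up′? h V ⟩
    sum (map (λ C → ι (up? C (matrix T)) * h C) V)      ∎
    where
    open ≡-Reasoning
    after : Cell R → Matrix R m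
    after o = matrix (proj₁ (uninsert T o))
    up′? : ∀ C → Dec (Up C (matrix T))
    up′? C = up? C (matrix T)

    spec : ∀ {o} → o ∈ corners T → Good (proj₁ (uninsert T o)) ×
           (∀ c q → cnt T c q ≡ δ o c q + cnt (proj₁ (uninsert T o)) c q)
    spec o∈ with ∈-corners⁻ g o∈
    ... | inj₁ (refl , _) = g , λ _ _ → refl
    ... | inj₂ (c , q , refl , U , p , eq , d , g') =
      subst Good (sym (cong proj₁ eq)) g' , λ c' q' →
        subst (λ W → cnt T c' q' ≡ δ (just (c , q)) c' q' + cnt W c' q') (sym (cong proj₁ eq)) (Ins-cnt d c' q')

    unique-left : Unique (map after (corners T))
    unique-left = unique-map _ (options-unique (removable? (cnt T))) λ {o} {o'} o∈ o∈′ eq →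
      let (g₁ , e₁) = spec o∈
          (g₂ , e₂) = spec o∈′
      in δ-injective λ c q → +-cancelʳ-≡ (cnt (proj₁ (uninsert T o)) c q) (δ o c q) (δ o' c q)
           (trans (sym (e₁ c q)) (trans (e₂ c q) (cong (δ o' c q +_)
             (sym (matrix-cnt {U = proj₁ (uninsert T o)} {proj₁ (uninsert T o')} g₁ g₂ eq c q)))))

    to : ∀ {C} → C ∈ map after (corners T) → C ∈ filter up′? V
    to C∈ with ∈-map⁻ _ C∈
    ... | o , o∈ , refl with spec o∈
    ...   | g' , e = ∈-filter⁺ up′? (∈-vertices⁺ (suc J) (matrix-Vertex {U = proj₁ (uninsert T o)} g')) (up o g' e)
      where
      up : ∀ o → Good (proj₁ (uninsert T o)) → (∀ c q → cnt T c q ≡ δ o c q + cnt (proj₁ (uninsert T o)) c q) →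
           Up (after o) (matrix T)
      up nothing        _  _ = inj₁ refl
      up (just (c , q)) g' e = conj-Up (shape {U = proj₁ (uninsert T (just (c , q)))} g') (shape {U = T} g) c q (mkPlus e)

    from : ∀ {C} → C ∈ filter up′? V → C ∈ map after (corners T)
    from {C} C∈ with ∈-filter⁻ up′? {xs = V} C∈
    ... | _   , inj₁ refl         = ∈-map⁺ after {x = nothing} (here refl)
    ... | C∈′ , inj₂ (c , ℓ , eq) with removable-corner (shape {U = T} g) c ℓ
                                         (subst (Conj (cnt T)) eq (matrix-Conj {U = T} g)) (∈-vertices⁻ (suc J) C∈′)
    ...   | lt , rm , e = subst (_∈ map after (corners T)) same-C (∈-map⁺ after o∈)
      where
      q  = entry C c ℓ
      o∈ : just (c , q) ∈ corners T
      o∈ = ∈-options⁺ (removable? (cnt T)) lt rm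
      same-C : after (just (c , q)) ≡ C
      same-C with spec o∈
      ... | g' , e' = incr-injective (trans (sym (conj-incr
            (shape {U = proj₁ (uninsert T (just (c , q)))} g') (shape {U = T} g) c q (mkPlus e') ℓ
            (suc-injective (trans (sym e) (Plus-hit {α = cnt (proj₁ (uninsert T (just (c , q))))} {β = cnt T} (mkPlus e')))))) eq)

  toList-sum : {X : Set} {n : ℕ} (f : X → ℕ) (v : Vec X n) →
               sum (toList (Vec.map f v)) ≡ sum (map (λ t → f (lookup v t)) (allFin n))
  toList-sum f v = cong sum (trans (go v) (sym (map-tabulate (λ t → t) (f ∘ lookup v))))
    where
    go : ∀ {n} (v : Vec _ n) → toList (Vec.map f v) ≡ List.tabulate (f ∘ lookup v)
    go []      = refl
    go (x ∷ v) = cong (f x ∷_) (go v)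

  -- Row `q` can be extended if and only if some column has height exactly `q`, and the first such
  -- column receives the box. The restriction `q < J` selects the entries less than `j - 1`; the
  -- option `nothing` is the extra loop.
  length-opens : {U : Tab i} → Good U → length (opens U) ≡ loops (suc J) (matrix U)
  length-opens {U = U} g = cong suc (begin
    length (concatMap (options-of (addable? (cnt U))) (allFin R))
      ≡⟨ length-concatMap (options-of (addable? (cnt U))) (allFin R) ⟩
    sum (map (length ∘ options-of (addable? (cnt U))) (allFin R))
      ≡⟨ cong sum (map-cong per-row (allFin R)) ⟩
    sum (map (λ c → distinctBelow (suc J) (lookup (matrix U) c)) (allFin R))
      ≡⟨ sym (toList-sum (distinctBelow (suc J)) (matrix U)) ⟩
    sum (toList (Vec.map (distinctBelow (suc J)) (matrix U))) ∎)
    where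
    open ≡-Reasoning
    A = matrix U
    ca = matrix-Conj {U = U} g
    occurs : Fin R → ℕ → Bool
    occurs c v = any (λ x → v ≡ᵇ x) (toList (lookup A c))

    to : ∀ c {q} → Addable (cnt U) c q → T (occurs c q)
    to c {q} ad = any⁺ _ (lose (∈-toList⁺ (∈-lookup ℓ (lookup A c))) (≡⇒≡ᵇ q _ (sym e)))
      where
      lt : cnt U c q < m
      lt = <-≤-trans ad (above≤ q)
        where above≤ : ∀ q → above (cnt U c) q ≤ m
              above≤ zero    = ≤-refl
              above≤ (suc q) = row≤m (shape {U = U} g) c q
      ℓ = fromℕ< lt
      ℓ≡ = toℕ-fromℕ< lt
      e : entry A c ℓ ≡ q
      e = ≤-antisym (≮⇒≥ λ l → <-irrefl ℓ≡ (proj₁ (at ca c ℓ q) l)) (lower q ad ℓ≡)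
        where lower : ∀ q → Addable (cnt U) c q → toℕ ℓ ≡ cnt U c q → q ≤ entry A c ℓ
              lower zero    _  _  = z≤n
              lower (suc q) ad ℓ≡ = proj₂ (at ca c ℓ q) (subst (_< cnt U c q) (sym ℓ≡) ad)

    from : ∀ c {q} → T (occurs c q) → Addable (cnt U) c q
    from c {q} tr with find (any⁻ _ (toList (lookup A c)) tr)
    ... | x , x∈ , t with ≡ᵇ⇒≡ q x t
    ...   | refl = go q (lookup-index (∈-toList⁻ x∈))
      where
      ℓ = VecAny.index (∈-toList⁻ x∈)
      go : ∀ q → q ≡ entry A c ℓ → Addable (cnt U) c q
      go zero    e = ≤-<-trans (≮⇒≥ λ l → <-irrefl e (proj₂ (at ca c ℓ 0) l)) (toℕ<n ℓ)
      go (suc q) e = ≤-<-trans (≮⇒≥ λ l → <-irrefl e (proj₂ (at ca c ℓ (suc q)) l)) (proj₁ (at ca c ℓ q) (≤-reflexive e))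

    per-row : ∀ c → length (options-of (addable? (cnt U)) c) ≡ distinctBelow (suc J) (lookup A c)
    per-row c = trans (length-map (λ q → just (c , q)) (filter (addable? (cnt U) c) (upTo J)))
      (cong length (filter-≐ (addable? (cnt U) c) (T? ∘ occurs c) (to c , from c) (upTo J)))

  edges-sum : {U : Tab i} {C : Matrix R m} → Good U → Vertex (suc J) C →
    edges (suc J) (matrix U) C ≡ sum (map (λ B → ι (up? (matrix U) B) * ι (up? C B)) V)
  edges-sum {U = U} {C} g vC with matrix U ≟M C
  ... | no ne    = edges-≢ (suc J) (matrix-Vertex {U = U} g) vC ne
  ... | yes refl = begin
    edges (suc J) (matrix U) (matrix U)                              ≡⟨ edges-refl (suc J) (matrix U) ⟩
    loops (suc J) (matrix U)                                         ≡⟨ sym (length-opens g) ⟩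
    length (opens U)                                                 ≡⟨ sym (sum-length (opens U)) ⟩
    sum (map (λ _ → 1) (opens U))                                    ≡⟨ open-sum (λ _ → 1) g ⟩
    sum (map (λ B → ι (up? (matrix U) B) * 1) V)                     ≡⟨ sum-cong {xs = V} (λ {B} _ → sym (ι-idem (up? (matrix U) B))) ⟩
    sum (map (λ B → ι (up? (matrix U) B) * ι (up? (matrix U) B)) V)  ∎
    where open ≡-Reasoning

  -- With the edge number written as a sum over a middle vertex `B`, the order of summation is
  -- exchanged: the sum over `B` becomes the sum over openings and the sum over `C` the one over
  -- closings.
  next-sum : (h : Matrix R m → ℕ) {U : Tab i} (s : List Label) → Good U →
    sum (map (λ C → edges (suc J) (matrix U) C * h C) V) ≡ sum (map (λ z → h (matrix (proj₁ z))) (next (U , s)))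
  next-sum h {U} s g = begin
    sum (map (λ C → edges (suc J) A C * h C) V)
      ≡⟨ sum-cong {xs = V} (λ {C} C∈ → trans (cong (_* h C) (edges-sum {U = U} g (∈-vertices⁻ (suc J) C∈)))
           (trans (*-comm _ (h C)) (trans (sym (sum-*ˡ (h C) _ V)) (sum-cong {xs = V} (λ {B} _ → *-comm-assoc (h C) (ι (up? A B)) _))))) ⟩
    sum (map (λ C → sum (map (λ B → ι (up? A B) * (ι (up? C B) * h C)) V)) V)
      ≡⟨ sum-swap (λ C B → ι (up? A B) * (ι (up? C B) * h C)) V V ⟩
    sum (map (λ B → sum (map (λ C → ι (up? A B) * (ι (up? C B) * h C)) V)) V)
      ≡⟨ sum-cong {xs = V} (λ {B} _ → sum-*ˡ (ι (up? A B)) _ V) ⟩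
    sum (map (λ B → ι (up? A B) * sum (map (λ C → ι (up? C B) * h C) V)) V)
      ≡⟨ sym (open-sum (λ B → sum (map (λ C → ι (up? C B) * h C) V)) g) ⟩
    sum (map (λ x → sum (map (λ C → ι (up? C (matrix (x ∷ U))) * h C) V)) (opens U))
      ≡⟨ sum-cong {xs = opens U} (λ {x} x∈ → trans (sym (close-sum h (∈-opens⁻ g x∈))) (cong sum (List.map-∘ (corners (x ∷ U))))) ⟩
    sum (map (λ x → sum (map (λ z → h (matrix (proj₁ z))) (closings (U , s) x))) (opens U))
      ≡⟨ sym (sum-concatMap (λ z → h (matrix (proj₁ z))) (closings (U , s)) (opens U)) ⟩
    sum (map (λ z → h (matrix (proj₁ z))) (next (U , s))) ∎
    where
    open ≡-Reasoning
    A = matrix U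
    *-comm-assoc : ∀ a b c → a * (b * c) ≡ b * (c * a)
    *-comm-assoc a b c = trans (*-comm a (b * c)) (*-assoc b c a)

  Z : Matrix R m
  Z = zeroMatrix (suc m) R

  empty? : (U : Tab i) → Dec (U ≡ replicate i nothing)
  empty? U = Vec.≡-dec _≟C_ U (replicate _ nothing)

  -- Each round trades one step of the remaining walk for one more vertex of the partition.
  states-walks : ∀ t i → sum (map (λ z → walks (suc J) (suc m) R t (matrix (proj₁ z)) Z) (states i)) ≡
                 sum (map (λ z → walks (suc J) (suc m) R 0 (matrix (proj₁ z)) Z) (states (t + i)))
  states-walks zero    i = refl
  states-walks (suc t) i = trans
    (sum-cong {xs = states i} (λ { {U , s} us∈ → next-sum (λ C → walks (suc J) (suc m) R t C Z) s (Path-Good (states⇒Path us∈)) }))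
    (trans (sym (sum-concatMap (λ z → walks (suc J) (suc m) R t (matrix (proj₁ z)) Z) next (states i)))
      (trans (states-walks t (suc i))
        (cong (λ v → sum (map (λ z → walks (suc J) (suc m) R 0 (matrix (proj₁ z)) Z) (states v))) (+-suc t i))))

  equalᵇ-sound : {r n : ℕ} (A B : Matrix r n) → T (equalᵇ A B) → A ≡ B
  equalᵇ-sound A B tr = go A B (AllP.all⁺ isSame (diffs A B) tr)
    where
    goV : ∀ {n} (u v : Vec ℕ n) → All (T ∘ isSame) (diffsV u v) → u ≡ v
    goV []      []      _          = refl
    goV (x ∷ u) (y ∷ v) (p All.∷ ps) with cmpView x y
    ... | v-same .x  = cong (x ∷_) (goV u v ps)
    ... | v-plus .y  = contradiction p (subst (λ d → ¬ T (isSame d)) (sym (cmp-plus y)) λ ())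
    ... | v-minus .x = contradiction p (subst (λ d → ¬ T (isSame d)) (sym (cmp-minus x)) λ ())
    ... | v-big eq   = contradiction p (subst (λ d → ¬ T (isSame d)) (sym eq) λ ())
    go : ∀ {r n} (A B : Matrix r n) → All (T ∘ isSame) (diffs A B) → A ≡ B
    go []      []      _  = refl
    go (u ∷ A) (v ∷ B) ps = cong₂ _∷_ (goV u v (AllP.++⁻ˡ (diffsV u v) ps)) (go A B (AllP.++⁻ʳ (diffsV u v) ps))

  equalᵇ-refl : {r n : ℕ} (A : Matrix r n) → T (equalᵇ A A)
  equalᵇ-refl A = AllP.all⁻ isSame (go A)
    where
    goV : ∀ {n} (u : Vec ℕ n) → All (T ∘ isSame) (diffsV u u)
    goV []      = All.[]
    goV (x ∷ u) = subst (T ∘ isSame) (sym (cmp-refl x)) tt All.∷ goV u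
    go : ∀ {r n} (A : Matrix r n) → All (T ∘ isSame) (diffs A A)
    go []      = All.[]
    go (u ∷ A) = AllP.++⁺ (goV u) (go A)

  zero-Shape : Shape (λ _ _ → 0)
  zero-Shape = mkShape (λ _ _ → z≤n) (λ _ → z≤n , refl)

  zero-Conj : Conj (λ _ _ → 0) Z
  zero-Conj = mkConj λ c ℓ q → (λ lt → contradiction (subst (q <_) (entry-Z c ℓ) lt) λ ()) , λ ()
    where
    entry-Z : ∀ c ℓ → entry Z c ℓ ≡ 0
    entry-Z c ℓ = trans (cong (λ u → lookup u ℓ) (lookup-replicate c (replicate m 0))) (lookup-replicate ℓ 0)

  cnt-empty : ∀ n c q → cnt {R} (replicate n nothing) c q ≡ 0
  cnt-empty zero    c q = refl
  cnt-empty (suc n) c q = cnt-empty n c q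

  cnt-0⇒empty : (U : Tab i) → (∀ c q → cnt U c q ≡ 0) → U ≡ replicate i nothing
  cnt-0⇒empty []            _  = refl
  cnt-0⇒empty (nothing ∷ U) eq = cong (nothing ∷_) (cnt-0⇒empty U eq)
  cnt-0⇒empty (just (c , q) ∷ U) eq =
    contradiction (trans (sym (δ-hit c q)) (m+n≡0⇒m≡0 (δ (just (c , q)) c q) (eq c q))) λ ()

  matrix-empty : (U : Tab i) → (∀ c q → cnt U c q ≡ 0) → matrix U ≡ Z
  matrix-empty U eq = Conj-functional
    (mkConj λ c ℓ q → subst (λ v → (q < entry (matrix U) c ℓ → toℕ ℓ < v) × (toℕ ℓ < v → q < entry (matrix U) c ℓ)) (eq c q)
      (at (conj-Conj (mkShape (λ c q → subst (_≤ cnt U c q) (sym (eq c (suc q))) z≤n)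
                              (λ c → subst (_≤ m) (sym (eq c 0)) z≤n , eq c J))) c ℓ q))
    zero-Conj

  walks-0 : {U : Tab i} → Good U → walks (suc J) (suc m) R 0 (matrix U) Z ≡ ι (empty? U) * 1
  walks-0 {i} {U} g with equalᵇ (matrix U) Z in eq
  ... | true  = sym (cong (_* 1) (ι-yes (empty? U) (cnt-0⇒empty U
                  (Conj-injective (shape {U = U} g) zero-Shape (subst (Conj (cnt U)) same-Z (matrix-Conj {U = U} g)) zero-Conj))))
    where
    same-Z : matrix U ≡ Z
    same-Z = equalᵇ-sound (matrix U) Z (subst T (sym eq) tt)
  ... | false = sym (cong (_* 1) (ι-no (empty? U) λ { refl →
                  subst T (trans (sym (cong (λ A → equalᵇ A Z) (matrix-empty (replicate i nothing) (cnt-empty i)))) eq) (equalᵇ-refl Z) }))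

  empty-states : ∀ i → length (filter (empty? ∘ proj₁) (states i)) ≡ walks (suc J) (suc m) R i Z Z
  empty-states i = begin
    length (filter (empty? ∘ proj₁) (states i))                     ≡⟨ sym (sum-length (filter (empty? ∘ proj₁) (states i))) ⟩
    sum (map (λ _ → 1) (filter (empty? ∘ proj₁) (states i)))        ≡⟨ sum-filter (empty? ∘ proj₁) (λ _ → 1) (states i) ⟩
    sum (map (λ z → ι (empty? (proj₁ z)) * 1) (states i))           ≡⟨ sum-cong {xs = states i} (λ { {U , s} us∈ →
                                                                         sym (walks-0 (Path-Good (states⇒Path us∈))) }) ⟩
    sum (map (λ z → w 0 (matrix (proj₁ z))) (states i))             ≡⟨ cong (λ v → sum (map (λ z → w 0 (matrix (proj₁ z))) (states v))) (sym (+-identityʳ i)) ⟩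
    sum (map (λ z → w 0 (matrix (proj₁ z))) (states (i + 0)))       ≡⟨ sym (states-walks i 0) ⟩
    w i (matrix []) + 0                                             ≡⟨ +-identityʳ _ ⟩
    w i (matrix [])                                                 ≡⟨ cong (w i) (matrix-empty [] (λ _ _ → refl)) ⟩
    w i Z                                                           ∎
    where
    open ≡-Reasoning
    w : ℕ → Matrix R m → ℕ
    w t A = walks (suc J) (suc m) R t A Z

-- Label lists as arc diagrams, and their translation into paths.

module Labels (J m R : ℕ) where

  open Paths J m R

  private variable
    i n t t' p p' : ℕ
    c c' : Fin R
    l : Label
    s : List Label

  -- Has s t p c: the label of vertex t is the arc (p , t) of colour c.  Labels are listed
  -- from the last vertex down, so vertex t is the one followed by t labels.
  data Has : List Label → ℕ → ℕ → Fin R → Set where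
    here  : Has (just (p , c) ∷ s) (length s) p c
    there : Has s t p c → Has (l ∷ s) t p c

  Has-< : Has s t p c → t < length s
  Has-< here      = ≤-refl
  Has-< (there e) = m≤n⇒m≤1+n (Has-< e)

  -- A vertex has a single label, so at most one arc arrives there; `distinct` says that at most one
  -- leaves. `Decode` shows that nothing more is needed for a coloured partition.
  record WF (s : List Label) : Set where
    constructor mkWF
    field
      forward  : ∀ {t p c} → Has s t p c → p < t
      distinct : ∀ {t t' p c c'} → Has s t p c → Has s t' p c' → t ≡ t'
  open WF

  WF-tail : WF (l ∷ s) → WF s
  WF-tail wf = mkWF (forward wf ∘ there) (λ e f → distinct wf (there e) (there f))

  Free : Tab i → ℕ → Set
  Free U p = ∀ {k} → ¬ (U ∋ p ↦ k)

  Ins-free : {U T : Tab i} {q : ℕ} → Ins c U p T q → Free U p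
  Ins-free here       (tail o) = <-irrefl refl (∋-< o)
  Ins-free (bump d)   head     = <-irrefl refl (Ins-< d)
  Ins-free (bump d)   (tail o) = Ins-free d o
  Ins-free (keep d _) head     = <-irrefl refl (Ins-< d)
  Ins-free (keep d _) (tail o) = Ins-free d o

  Ins-occupied : {U T : Tab i} {q b : ℕ} {k : Key R} → Ins c U p T q → U ∋ b ↦ k → ∃ λ k' → T ∋ b ↦ k'
  Ins-occupied d o with stays-or-bumped d o
  ... | inj₁ o'      = _ , o'
  ... | inj₂ (_ , e) = _ , Ev-∋ e

  Ins-free-others : {U T : Tab i} {q b : ℕ} → Ins c U p T q → b ≢ p → Free U b → Free T b
  Ins-free-others here       ne fr head     = ne refl
  Ins-free-others here       ne fr (tail o) = fr (tail o)
  Ins-free-others (bump d)   ne fr head     = fr head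
  Ins-free-others (bump d)   ne fr (tail o) = Ins-free-others d ne (fr ∘ tail) o
  Ins-free-others (keep d _) ne fr head     = fr head
  Ins-free-others (keep d _) ne fr (tail o) = Ins-free-others d ne (fr ∘ tail) o

  Ins-total : ∀ c (U : Tab i) p → p < i → Free U p → ∃₂ λ T q → Ins c U p T q
  Ins-total {suc i} c (x ∷ U) p lt fr with p ≟ i
  Ins-total {suc i} c (nothing ∷ U) p lt fr | yes refl = _ , _ , here
  Ins-total {suc i} c (just _ ∷ U)  p lt fr | yes refl = contradiction head fr
  ... | no ne with Ins-total c U p (≤∧≢⇒< (≤-pred lt) ne) (fr ∘ tail)
  ...   | T , q , d with x ≟C just (c , q)
  ...     | yes refl = _ , _ , bump d
  ...     | no x≢    = _ , _ , keep d x≢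

  Path-length : {U : Tab i} → Path U s → length s ≡ suc i
  Path-length start           = refl
  Path-length (skip P _)      = cong suc (Path-length P)
  Path-length (close P _ _ _) = cong suc (Path-length P)

  -- Once the arc from `p` has been closed, only larger labels are opened, and undoing an insertion
  -- brings in no label.
  Path-free : {U : Tab i} → Path U s → Has s t p c → p < t × Free U p
  Path-free (skip P _) (there e) =
    let (lt , fr) = Path-free P e
        p<i = <-≤-trans lt (≤-pred (subst (_ <_) (Path-length P) (Has-< e)))
    in lt , λ o → fr (∋-tail o p<i)
  Path-free (close P _ _ d) here = subst (_ <_) (sym (Path-length P)) (Ins-< d) , Ins-free d
  Path-free (close P _ _ d) (there e) =
    let (lt , fr) = Path-free P e
        p<i = <-≤-trans lt (≤-pred (subst (_ <_) (Path-length P) (Has-< e)))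
    in lt , λ o → fr (∋-tail (proj₂ (Ins-occupied d o)) p<i)
  Path-free start (there ())

  Path-distinct : {U : Tab i} → Path U s → Has s t p c → Has s t' p c' → t ≡ t'
  Path-distinct start (there ()) _
  Path-distinct (skip P _) (there e) (there f) = Path-distinct P e f
  Path-distinct (close P _ _ d) here here = refl
  Path-distinct (close P _ _ d) (there e) (there f) = Path-distinct P e f
  Path-distinct (close P _ _ d) here (there f) = contradiction f (reopened P d)
    where
    reopened : ∀ {i s t c p q c'} {U : Tab i} {U' : Tab (suc i)} {x} →
               Path U s → Ins c U' p (x ∷ U) q → ¬ Has s t p c'
    reopened P d e =
      let (lt , fr) = Path-free P e
          p<i = <-≤-trans lt (≤-pred (subst (_ <_) (Path-length P) (Has-< e)))
      in fr (∋-tail (Ev-∋ (Ev-inserted d)) p<i)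
  Path-distinct (close P g g' d) (there e) here = sym (Path-distinct (close P g g' d) here (there e))

  Path-WF : {U : Tab i} → Path U s → WF s
  Path-WF P = mkWF (λ e → proj₁ (Path-free P e)) (Path-distinct P)

  -- The insertions are carried out downwards along `s`. The set `arcs` stays fixed and contains the
  -- arcs already inserted as well as those still to come, so that `bound` applies at every gap; the
  -- last hypothesis keeps the left ends still to come free for insertion.
  WF⇒Path : (arcs : ℕ → ℕ → Fin R → Set) →
    (∀ {i} {T : Tab i} (h : Rev n T) → (∀ {c t b} → X h c 0 t b → arcs t b c) → Box (cnt T)) →
    ∀ s → WF s → (∀ {t p c} → Has s t p c → arcs t p c) →
    ∀ {i w} {U : Tab i} (h : Rev n (w ∷ U)) → length s ≡ suc i →
    (∀ {c t b} → X h c 0 t b → arcs t b c) → (∀ {t p c} → Has s t p c → Free U p) → Path U s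
  WF⇒Path arcs bound (nothing ∷ []) wf sub {U = []} h refl old fr = start
  WF⇒Path arcs bound (just (p , c) ∷ []) wf sub {U = []} h refl old fr = contradiction (forward wf here) λ ()
  WF⇒Path arcs bound (nothing ∷ s) wf sub {U = x ∷ U} h eq old fr =
    skip (WF⇒Path arcs bound s (WF-tail wf) (sub ∘ there) h' (suc-injective eq) old' (λ e o → fr (there e) (tail o)))
         (Rev-L h' , bound h' old')
    where
    h' = skip h
    old' : ∀ {c t b} → X h' c 0 t b → arcs t b c
    old' (old-skip e _) = old e
  WF⇒Path arcs bound (just (p , c) ∷ s) wf sub {i = suc i} {U = U} h eq old fr
    with Ins-total c U p (subst (p <_) (suc-injective eq) (forward wf here)) (fr here)
  WF⇒Path {n} arcs bound (just (p , c) ∷ s) wf sub {i = suc i} {U = U} h eq old fr | x ∷ T , q , d =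
    close (WF⇒Path arcs bound s (WF-tail wf) (sub ∘ there) h' (suc-injective eq) old' free) good
          (Good-uninsert good (proj₂ (Rev-L h)) d) d
    where
    h' : Rev n (x ∷ T)
    h' = ins h d
    old' : ∀ {c t b} → X h' c 0 t b → arcs t b c
    old' (old-ins e _) = old e
    old' (new e) = subst₂ (λ t b → arcs t b c) (suc-injective eq) (sym (Ev-0 e)) (sub here)
    good : Good (x ∷ T)
    good = Rev-L h' , bound h' old'
    free : ∀ {t p c} → Has s t p c → Free T p
    -- A remaining arc with the left end just inserted would contradict `distinct`.
    free e o = Ins-free-others d (λ { refl → <-irrefl (distinct wf (there e) here) (Has-< e) })
                 (fr (there e)) (tail o)

  -- Replays a path downwards as far as the gap before vertex `g`. There the history contains every
  -- arc over the gap, so chains of such arcs can be compared with the shape of a `Good` tableau.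
  gap-state : ∀ {w} {U : Tab i} → Path U s → (h : Rev n (w ∷ U)) → ∀ g → g ≤ i →
    ∃₂ λ (T : Tab g) (h' : Rev n T) → Good T ×
      (∀ {c t b} → X h c 0 t b → b < g → X h' c 0 t b) ×
      (∀ {c t p} → Has s t p c → g ≤ t → p < g → X h' c 0 t p)
  gap-state start h zero z≤n = [] , skip h , (tt , λ _ → z≤n , refl) , old-skip , λ _ _ ()
  gap-state {suc i} {nothing ∷ s} {n} (skip {U = U} {x = x} P good) h g g≤ with g ≟ suc i
  ... | yes refl = x ∷ U , skip h , good , old-skip ,
          λ { (there e) g≤t _ → contradiction (subst (_ <_) (Path-length P) (Has-< e)) (≤⇒≯ g≤t) }
  ... | no ne with gap-state P (skip h) g (≤-pred (≤∧≢⇒< g≤ ne))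
  ...   | T , h' , g' , lift , has = T , h' , g'
        , (λ e lt → lift (old-skip e (<-≤-trans lt g≤)) lt)
        , λ { (there e) → has e }
  gap-state {suc i} {_ ∷ s} {n} (close {U = U} {x = x} P good _ d) h g g≤ with g ≟ suc i
  ... | yes refl = x ∷ U , ins h d , good , old-ins , arrived
    where
    arrived : ∀ {c t p} → Has (_ ∷ s) t p c → suc i ≤ t → p < suc i → X (ins h d) c 0 t p
    arrived here g≤t _ = subst (λ v → X (ins h d) _ 0 v _) (sym (Path-length P)) (new (Ev-inserted d))
    arrived (there e) g≤t _ = contradiction (subst (_ <_) (Path-length P) (Has-< e)) (≤⇒≯ g≤t)
  ... | no ne with gap-state P (ins h d) g (≤-pred (≤∧≢⇒< g≤ ne))
  ...   | T , h' , g' , lift , has = T , h' , g' , (λ e lt → lift (old-ins e (<-≤-trans lt g≤)) lt) , arrived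
    where
    arrived : ∀ {c t p} → Has (_ ∷ s) t p c → g ≤ t → p < g → X h' c 0 t p
    arrived here _ p<g = lift (subst (λ v → X (ins h d) _ 0 v _) (sym (Path-length P)) (new (Ev-inserted d))) p<g
    arrived (there e) g≤t p<g = has e g≤t p<g

-- Chains of arcs versus monochromatic crossings and nestings.

module Families (J m R : ℕ) where

  open Paths J m R
  open Labels J m R

  open WF

  private variable
    n : ℕ

  module _ {P : ℕ → Set} (P? : ∀ x → Dec (P x)) where

    greatest : ∀ n → (∃ λ x → x < n × P x) → ∃ λ x → x < n × P x × (∀ y → x < y → y < n → ¬ P y)
    greatest (suc n) (x , x<n , px) with P? n
    ... | yes pn = n , ≤-refl , pn , λ y n<y y<n _ → <-irrefl refl (<-≤-trans n<y (≤-pred y<n))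
    ... | no ¬pn with greatest n (x , ≤∧≢⇒< (≤-pred x<n) (λ { refl → ¬pn px }) , px)
    ...   | z , z<n , pz , max = z , m≤n⇒m≤1+n z<n , pz , λ y z<y y<n py →
              max y z<y (≤∧≢⇒< (≤-pred y<n) (λ { refl → ¬pn py })) py

    least : ∀ n → (∃ λ x → x < n × P x) → ∃ λ x → x < n × P x × (∀ y → y < x → ¬ P y)
    least (suc n) (x , x<n , px) with anyUpTo? P? n
    ... | yes w = let (z , z<n , pz , min) = least n w in z , m≤n⇒m≤1+n z<n , pz , min
    ... | no ¬w = x , x<n , px , λ y y<x py → ¬w (y , <-≤-trans y<x (≤-pred x<n) , py)

  opposite-anti : {k : ℕ} (s t : Fin k) → toℕ s < toℕ t → toℕ (opposite t) < toℕ (opposite s)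
  opposite-anti {k} s t lt = subst₂ _<_ (sym (opposite-prop t)) (sym (opposite-prop s))
    (∸-monoʳ-< (s≤s lt) (toℕ<n t))

  family⇒chain : {_≺_ S : ℕ → ℕ → Set} {k : ℕ} (a b : Fin (suc k) → ℕ) → (∀ s → S (b s) (a s)) →
    (∀ s t → toℕ s < toℕ t → b s < b t) → (∀ s t → toℕ s < toℕ t → a t ≺ a s) →
    Chain _≺_ S (suc k) (b zero) (a zero)
  family⇒chain {k = zero}  a b all mb ma = one (all zero)
  family⇒chain {k = suc k} a b all mb ma =
    more (family⇒chain (a ∘ suc) (b ∘ suc) (all ∘ suc) (λ s t → mb (suc s) (suc t) ∘ s≤s) (λ s t → ma (suc s) (suc t) ∘ s≤s))
         (all zero) (mb zero (suc zero) (s≤s z≤n)) (ma zero (suc zero) (s≤s z≤n))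

  record Family (_≺_ : ℕ → ℕ → Set) (Q : Fin n → Fin n → Set) (d t y : ℕ) : Set where
    constructor mkFamily
    field
      lefts rights : Fin d → Fin n
      related      : ∀ s → Q (lefts s) (rights s)
      lefts-mono   : ∀ s t → toℕ s < toℕ t → toℕ (lefts t) ≺ toℕ (lefts s)
      rights-mono  : ∀ s t → toℕ s < toℕ t → toℕ (rights s) < toℕ (rights t)
      lefts-first  : ∀ s → toℕ (lefts s) ≡ y ⊎ toℕ (lefts s) ≺ y
      rights-first : ∀ s → t ≤ toℕ (rights s)

  -- The last link gets index 0, because times fall along the chain whereas the right ends of a
  -- family rise with the index.
  chain⇒family : {_≺_ S : ℕ → ℕ → Set} {Q : Fin n → Fin n → Set} → (∀ {x y z} → x ≺ y → y ≺ z → x ≺ z) →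
    (∀ {t y} → S t y → ∃₂ λ a b → toℕ a ≡ y × toℕ b ≡ t × Q a b) →
    ∀ {d t y} → Chain _≺_ S d t y → Family _≺_ Q d t y
  chain⇒family tr realise (one e) with realise e
  ... | a , b , refl , refl , q = mkFamily (λ _ → a) (λ _ → b) (λ _ → q)
          (λ { zero zero () }) (λ { zero zero () }) (λ _ → inj₁ refl) (λ _ → ≤-refl)
  chain⇒family {_≺_ = _≺_} tr realise (more ch e u<t x≺y) with realise e | chain⇒family tr realise ch
  ... | a , b , refl , refl , q | mkFamily as bs rel ma mb fa fb = mkFamily
    (λ { zero → a ; (suc s) → as s }) (λ { zero → b ; (suc s) → bs s })
    (λ { zero → q ; (suc s) → rel s })
    (λ { zero (suc t) _ → before t ; (suc s) (suc t) (s≤s lt) → ma s t lt })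
    (λ { zero (suc t) _ → <-≤-trans u<t (fb t) ; (suc s) (suc t) (s≤s lt) → mb s t lt })
    (λ { zero → inj₁ refl ; (suc s) → inj₂ (before s) })
    (λ { zero → ≤-refl ; (suc s) → ≤-trans (<⇒≤ u<t) (fb s) })
    where
    before : ∀ s → toℕ (as s) ≺ toℕ a
    before s with fa s
    ... | inj₁ eq = subst (_≺ toℕ a) (sym eq) x≺y
    ... | inj₂ lt = tr lt x≺y

  record Rel (f : Vec (Fin n) n) (c : Vec (Maybe (Fin R)) n) (s : List Label) : Set where
    constructor mkRel
    field
      sound    : ∀ {t p col} → Has s t p col →
                 ∃₂ λ a b → toℕ a ≡ p × toℕ b ≡ t × Arc f a b × lookup c a ≡ just col
      complete : ∀ {a b col} → Arc f a b → lookup c a ≡ just col → Has s (toℕ b) (toℕ a) col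
  open Rel

  module _ {f : Vec (Fin n) n} {c : Vec (Maybe (Fin R)) n} {s : List Label} (rel : Rel f c s) where

    -- All arcs in the history of `T` cover the gap before vertex `i`; this supplies the condition
    -- that every left end precedes every right end.
    Rel-Box : CrLess f c (suc J) → NeLess f c (suc m) →
              ∀ {i} {T : Tab i} (h : Rev n T) → (∀ {col t b} → X h col 0 t b → Has s t b col) → Box (cnt T)
    Rel-Box cr ne {i} {T} h sub col = ≮⇒≥ too-long , n≤0⇒n≡0 (≮⇒≥ too-tall)
      where
      Q : Fin n → Fin n → Set
      Q a b = (Arc f a b × lookup c a ≡ just col) × (toℕ a < i × i ≤ toℕ b)
      realise : ∀ {t y} → X h col 0 t y → ∃₂ λ a b → toℕ a ≡ y × toℕ b ≡ t × Q a b
      realise e with sound rel (sub e)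
      ... | a , b , refl , refl , arc , eq = a , b , refl , refl , (arc , eq) , X-label e , X-time e
      too-tall : ¬ (0 < cnt T col J)
      too-tall lt with row⇒dec h J lt
      ... | t , y , ch with chain⇒family (λ x>y y>z → <-trans y>z x>y) realise ch
      ...   | mkFamily as bs all ma mb _ _ = <-irrefl refl (cr (suc J) as bs
                ( (λ s → proj₁ (proj₁ (all s))) , ma , mb
                , (λ s t → <-≤-trans (proj₁ (proj₂ (all s))) (proj₂ (proj₂ (all t))))
                , col , λ s → proj₂ (proj₁ (all s))))
      too-long : ¬ (m < cnt T col 0)
      too-long lt with cnt T col 0 in eq
      ... | suc d with cnt⇒inc h (sym eq)
      ...   | t , y , ch with chain⇒family <-trans realise ch
      -- In an increasing chain index 0 is the innermost arc, while `MonoNesting` lists the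
      -- outermost first; hence the reversal.
      ...     | mkFamily as bs all ma mb _ _ = <-irrefl refl (<-≤-trans (ne (suc d) (as ∘ opposite) (bs ∘ opposite)
                  ( (λ s → proj₁ (proj₁ (all (opposite s))))
                  , (λ s t l → ma _ _ (opposite-anti s t l))
                  , (λ s t l → mb _ _ (opposite-anti s t l))
                  , (λ s t → <-≤-trans (proj₁ (proj₂ (all (opposite s)))) (proj₂ (proj₂ (all (opposite t)))))
                  , col , λ s → proj₂ (proj₁ (all (opposite s))))) lt)

  module _ {i : ℕ} {f : Vec (Fin (suc i)) (suc i)} {c : Vec (Maybe (Fin R)) (suc i)} {s : List Label}
           (rel : Rel f c s) (P : Path (replicate i nothing) s) where

    Path-CrLess : CrLess f c (suc J)
    Path-CrLess zero a b _ = s≤s z≤n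
    Path-CrLess (suc k) a b (arcs , ma , mb , ab , col , cols) = s≤s (≰⇒> impossible)
      where
      b₀≤ : ∀ s → toℕ (b zero) ≤ toℕ (b s)
      b₀≤ zero    = ≤-refl
      b₀≤ (suc s) = <⇒≤ (mb zero (suc s) (s≤s z≤n))
      impossible : ¬ (J ≤ k)
      -- All arcs of the crossing cover the gap before its first right end.
      impossible J≤k with gap-state P top (toℕ (b zero)) (≤-pred (toℕ<n (b zero)))
      ... | T , h , good , _ , has = contradiction
        (dec⇒row {d = k ∸ J} J (subst (λ v → Dec-Chain (X h col 0) (suc v) (toℕ (b zero)) (toℕ (a zero))) (sym (m+[n∸m]≡n J≤k))
          (family⇒chain (toℕ ∘ a) (toℕ ∘ b)
            (λ s → has (complete rel (arcs s) (cols s)) (b₀≤ s) (ab s zero)) mb ma)))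
        (subst (λ v → ¬ (0 < v)) (sym (trans (cong (cnt T col) (+-identityʳ J)) (proj₂ (proj₂ good col)))) λ ())

    Path-NeLess : NeLess f c (suc m)
    Path-NeLess zero a b _ = s≤s z≤n
    -- In a nesting the first right end belongs to the innermost arc, which has the last index.
    Path-NeLess (suc k) a b (arcs , ma , mb , ab , col , cols) with
      gap-state P top (toℕ (b (opposite zero))) (≤-pred (toℕ<n (b (opposite zero))))
    ... | T , h , good , _ , has = s≤s (≤-trans (inc⇒cnt h
        (family⇒chain (toℕ ∘ a ∘ opposite) (toℕ ∘ b ∘ opposite)
          (λ s → has (complete rel (arcs (opposite s)) (cols (opposite s))) (b₀≤ s) (ab (opposite s) (opposite zero)))
          (λ s t l → mb _ _ (opposite-anti s t l)) (λ s t l → ma _ _ (opposite-anti s t l))))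
        (proj₁ (proj₂ good col)))
      where
      b₀≤ : ∀ s → toℕ (b (opposite zero)) ≤ toℕ (b (opposite s))
      b₀≤ zero    = ≤-refl
      b₀≤ (suc s) = <⇒≤ (mb _ _ (opposite-anti zero (suc s) (s≤s z≤n)))

  Has-ext : (s s' : List Label) → length s ≡ length s' → (∀ {t p c} → Has s t p c → Has s' t p c) →
            (∀ {t p c} → Has s' t p c → Has s t p c) → s ≡ s'
  Has-ext [] [] _ _ _ = refl
  Has-ext (l ∷ s) (l' ∷ s') eq to from = cong₂ _∷_ (heads l l' to from) (Has-ext s s' eq' (tails eq' to) (tails (sym eq') from))
    where
    eq' = suc-injective eq
    tails : ∀ {l l' s s'} → length s ≡ length s' → (∀ {t p c} → Has (l ∷ s) t p c → Has (l' ∷ s') t p c) →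
            ∀ {t p c} → Has s t p c → Has s' t p c
    tails eq to e with to (there e)
    ... | here    = contradiction (subst (_ <_) eq (Has-< e)) (<-irrefl refl)
    ... | there f = f
    at-head : ∀ {l s t p c} → Has (l ∷ s) t p c → t ≡ length s → l ≡ just (p , c)
    at-head here      _  = refl
    at-head (there e) eq = contradiction (Has-< e) (<-irrefl eq)
    heads : ∀ l l' → (∀ {t p c} → Has (l ∷ s) t p c → Has (l' ∷ s') t p c) →
            (∀ {t p c} → Has (l' ∷ s') t p c → Has (l ∷ s) t p c) → l ≡ l'
    heads (just _) l' to _     = sym (at-head (to here) eq')
    heads nothing (just _) _ from = at-head (from here) (sym eq')
    heads nothing nothing _ _ = refl

  Rel-functional : {f : Vec (Fin n) n} {c : Vec (Maybe (Fin R)) n} {s s' : List Label} →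
    length s ≡ length s' → Rel f c s → Rel f c s' → s ≡ s'
  Rel-functional {s = s} {s'} eq rel rel' = Has-ext s s' eq (go rel rel') (go rel' rel)
    where
    go : ∀ {s s'} → Rel _ _ s → Rel _ _ s' → ∀ {t p c} → Has s t p c → Has s' t p c
    go rel rel' e with sound rel e
    ... | a , b , refl , refl , arc , eq = complete rel' arc eq

-- Coloured partitions versus label lists.

module Encoding (J m R : ℕ) where

  open Paths J m R
  open Labels J m R
  open Families J m R

  open WF
  open Rel

  private variable
    n : ℕ

  module _ {f : Vec (Fin n) n} where

    arc? : ∀ a b → Dec (Arc f a b)
    arc? a b = (suc (toℕ a) ≤? toℕ b) ×-dec (lookup f a Fin.≟ lookup f b) ×-dec
      Fin.all? (λ x → (suc (toℕ a) ≤? toℕ x) →-dec (suc (toℕ x) ≤? toℕ b) →-dec ¬? (lookup f x Fin.≟ lookup f a))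

    Arc-left-unique : ∀ {a a' b} → Arc f a b → Arc f a' b → a ≡ a'
    Arc-left-unique {a} {a'} (l , e , g) (l' , e' , g') with <-cmp (toℕ a) (toℕ a')
    ... | tri< lt _ _ = contradiction (trans e' (sym e)) (g a' lt l')
    ... | tri≈ _ eq _ = toℕ-injective eq
    ... | tri> _ _ gt = contradiction (trans e (sym e')) (g' a gt l)

    Arc-right-unique : ∀ {a b b'} → Arc f a b → Arc f a b' → b ≡ b'
    Arc-right-unique {a} {b} {b'} (l , e , g) (l' , e' , g') with <-cmp (toℕ b) (toℕ b')
    ... | tri< lt _ _ = contradiction (sym e) (g' b l lt)
    ... | tri≈ _ eq _ = toℕ-injective eq
    ... | tri> _ _ gt = contradiction (sym e') (g b' l' gt)

    pred-arc : ∀ {a b} → toℕ a < toℕ b → lookup f a ≡ lookup f b → ∃ λ a' → Arc f a' b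
    pred-arc {a} {b} lt eq with greatest P? (toℕ b) (toℕ a , lt , a , refl , eq)
      where
      P? : ∀ x → Dec (∃ λ a' → toℕ a' ≡ x × lookup f a' ≡ lookup f b)
      P? x = Fin.any? λ a' → (toℕ a' ≟ x) ×-dec (lookup f a' Fin.≟ lookup f b)
    ... | x , x<b , (a' , refl , eq') , max =
      a' , x<b , eq' , λ y a'<y y<b e → max (toℕ y) a'<y y<b (y , refl , trans e eq')

    root? : IsPartition f → ∀ b → lookup f b ≡ b ⊎ (∃ λ a → Arc f a b)
    root? part b with lookup f b Fin.≟ b
    ... | yes eq = inj₁ eq
    ... | no ne  = inj₂ (pred-arc (≤∧≢⇒< (proj₁ (part b)) (ne ∘ toℕ-injective)) (proj₂ (part b)))

    root-no-arc : IsPartition f → ∀ {a b} → lookup f b ≡ b → ¬ Arc f a b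
    root-no-arc part {a} {b} root (lt , eq , _) =
      <-irrefl refl (<-≤-trans lt (subst (λ v → toℕ v ≤ toℕ a) (trans eq root) (proj₁ (part a))))

  coloured : {f : Vec (Fin n) n} {c : Vec (Maybe (Fin R)) n} {s : List Label} → IsArcColouring f c → Rel f c s →
             ∀ {a b} → Arc f a b → ∃ λ col → lookup c a ≡ just col × Has s (toℕ b) (toℕ a) col
  coloured col rel {a} arc = let (k , eq) = proj₁ (col a) (_ , arc) in k , eq , complete rel arc eq

  transfer : {f f' : Vec (Fin n) n} {c c' : Vec (Maybe (Fin R)) n} {s : List Label} → IsArcColouring f c →
    Rel f c s → Rel f' c' s → ∀ {a b} → Arc f a b → Arc f' a b × lookup c' a ≡ lookup c a
  transfer {f' = f'} {c' = c'} col rel rel' {a} {b} arc with coloured col rel arc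
  ... | k , eq , e with sound rel' e
  ...   | a' , b' , a≡ , b≡ , arc' , eq' with toℕ-injective a≡ | toℕ-injective b≡
  ...     | refl | refl = arc' , trans eq' (sym eq)

  -- A vertex at which no arc arrives is the minimum of its block, and any other one shares its
  -- minimum with the vertex before it in the block. So the arcs determine the partition by
  -- induction on the vertex.
  Rel-injective : {f f' : Vec (Fin n) n} {c c' : Vec (Maybe (Fin R)) n} {s : List Label} →
    IsPartition f → IsArcColouring f c → IsPartition f' → IsArcColouring f' c' →
    Rel f c s → Rel f' c' s → (f , c) ≡ (f' , c')
  Rel-injective {n} {f} {f'} {c} {c'} {s} part col part' col' rel rel' =
    cong₂ _,_ (lookup-ext λ b → same-root (toℕ b) b refl) (lookup-ext same-colour)
    where
    same-root : ∀ t (b : Fin n) → toℕ b ≡ t → lookup f b ≡ lookup f' b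
    same-root = <-rec _ go
      where
      go : ∀ t → (∀ {u} → u < t → (b : Fin n) → toℕ b ≡ u → lookup f b ≡ lookup f' b) →
           (b : Fin n) → toℕ b ≡ t → lookup f b ≡ lookup f' b
      go t ih b refl with root? {f = f} part b | root? {f = f'} part' b
      ... | inj₁ e | inj₁ e' = trans e (sym e')
      ... | inj₁ e | inj₂ (a , arc') = contradiction (proj₁ (transfer col' rel' rel arc')) (root-no-arc {f = f} part e)
      ... | inj₂ (a , arc) | _ with transfer col rel rel' arc
      ...   | arc' , _ = trans (sym (proj₁ (proj₂ arc))) (trans (ih (proj₁ arc) a refl) (proj₁ (proj₂ arc')))
    same-colour : ∀ a → lookup c a ≡ lookup c' a
    same-colour a with lookup c a in eq | lookup c' a in eq'
    ... | nothing | nothing = refl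
    ... | just k | _ = let (b , arc) = proj₂ (col a) k eq
                       in trans (sym eq) (trans (sym (proj₂ (transfer col rel rel' arc))) eq')
    ... | nothing | just k = let (b , arc) = proj₂ (col' a) k eq'
                             in trans (sym eq) (trans (proj₂ (transfer col' rel' rel arc)) eq')

  module _ (f : Vec (Fin n) n) (c : Vec (Maybe (Fin R)) n) where

    arriving? : ∀ t → Dec (∃₂ λ a b → toℕ b ≡ t × Arc f a b)
    arriving? t = Fin.any? λ a → Fin.any? λ b → (toℕ b ≟ t) ×-dec arc? {f = f} a b

    label : ℕ → Label
    label t with arriving? t
    ... | no _            = nothing
    ... | yes (a , _) = Maybe.map (toℕ a ,_) (lookup c a)

    labels : ℕ → List Label
    labels zero    = []
    labels (suc k) = label k ∷ labels k

    length-labels : ∀ k → length (labels k) ≡ k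
    length-labels zero    = refl
    length-labels (suc k) = cong suc (length-labels k)

    Has-labels⁻ : ∀ k {t p col} → Has (labels k) t p col → label t ≡ just (p , col)
    Has-labels⁻ (suc k) e = go (label k) refl e
      where
      go : ∀ l {t p col} → l ≡ label k → Has (l ∷ labels k) t p col → label t ≡ just (p , col)
      go _ eq here      = trans (cong label (length-labels k)) (sym eq)
      go _ _  (there e) = Has-labels⁻ k e

    Has-labels⁺ : ∀ k {t p col} → t < k → label t ≡ just (p , col) → Has (labels k) t p col
    Has-labels⁺ (suc k) {t} t<k eq with t ≟ k
    ... | no ne    = there (Has-labels⁺ k (≤∧≢⇒< (≤-pred t<k) ne) eq)
    ... | yes refl = subst₂ (λ l v → Has (l ∷ labels t) v _ _) (sym eq) (length-labels t) here

    label-sound : ∀ {t p col} → label t ≡ just (p , col) →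
                  ∃₂ λ a b → toℕ a ≡ p × toℕ b ≡ t × Arc f a b × lookup c a ≡ just col
    label-sound {t} eq with arriving? t
    ... | yes (a , b , b≡ , arc) with lookup c a in e
    label-sound refl | yes (a , b , b≡ , arc) | just k = a , b , refl , b≡ , arc , e

    label-complete : ∀ {a b col} → Arc f a b → lookup c a ≡ just col → label (toℕ b) ≡ just (toℕ a , col)
    label-complete {a} {b} arc eq with arriving? (toℕ b)
    ... | no ne = contradiction (a , b , refl , arc) ne
    ... | yes (a' , b' , b≡ , arc') with toℕ-injective b≡
    ...   | refl with Arc-left-unique {f = f} arc arc'
    ...     | refl = cong (Maybe.map (toℕ a ,_)) eq

    labels-Rel : Rel f c (labels n)
    labels-Rel = mkRel (λ e → label-sound (Has-labels⁻ n e))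
                       (λ {a} {b} arc eq → Has-labels⁺ n (toℕ<n b) (label-complete arc eq))

  Rel-WF : {f : Vec (Fin n) n} {c : Vec (Maybe (Fin R)) n} {s : List Label} → Rel f c s → WF s
  Rel-WF {f = f} rel = mkWF fwd dst
    where
    fwd : ∀ {t p col} → Has _ t p col → p < t
    fwd e with sound rel e
    ... | a , b , refl , refl , arc , _ = proj₁ arc
    dst : ∀ {t t' p col col'} → Has _ t p col → Has _ t' p col' → t ≡ t'
    dst e e' with sound rel e | sound rel e'
    ... | a , b , refl , refl , arc , _ | a' , b' , a≡ , refl , arc' , _ with toℕ-injective a≡
    ...   | refl = cong toℕ (Arc-right-unique {f = f} arc arc')

  NCN⇒Path : ∀ {i} {f : Vec (Fin (suc i)) (suc i)} {c : Vec (Maybe (Fin R)) (suc i)} →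
    CrLess f c (suc J) → NeLess f c (suc m) → Path (replicate i nothing) (labels f c (suc i))
  NCN⇒Path {i} {f} {c} cr ne = WF⇒Path (λ t p col → Has (labels f c (suc i)) t p col)
    (λ h sub → Rel-Box rel cr ne h sub) (labels f c (suc i)) (Rel-WF rel) (λ e → e) top
    (length-labels f c (suc i)) no-events (λ _ → replicate-∌ i)
    where
    rel = labels-Rel f c
    no-events : ∀ {col t b} → X (top {r = R} {suc i}) col 0 t b → Has (labels f c (suc i)) t b col
    no-events ()

  -- The minimum of the block of `t`, found by following arriving arcs to the left; for `t` beyond
  -- the list the value `t` is a default.
  root : List Label → ℕ → ℕ
  root []      t = t
  root (l ∷ s) t with t ≟ length s
  ... | no _ = root s t
  root (nothing ∷ s)      t | yes _ = t
  root (just (p , _) ∷ s) t | yes _ = root s p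

  root-old : ∀ l s {t} → t < length s → root (l ∷ s) t ≡ root s t
  root-old l s {t} lt with t ≟ length s
  ... | yes refl = contradiction lt (<-irrefl refl)
  ... | no _     = refl

  root-nothing : ∀ s → root (nothing ∷ s) (length s) ≡ length s
  root-nothing s with length s ≟ length s
  ... | yes _ = refl
  ... | no ne = contradiction refl ne

  root-just : ∀ s p c → root (just (p , c) ∷ s) (length s) ≡ root s p
  root-just s p c with length s ≟ length s
  ... | yes _ = refl
  ... | no ne = contradiction refl ne

  root-≤ : ∀ s → WF s → ∀ t → root s t ≤ t
  root-≤ [] wf t = ≤-refl
  root-≤ (l ∷ s) wf t with t ≟ length s
  ... | no _ = root-≤ s (WF-tail wf) t
  root-≤ (nothing ∷ s) wf t | yes _ = ≤-refl
  root-≤ (just (p , _) ∷ s) wf t | yes refl = ≤-trans (root-≤ s (WF-tail wf) p) (<⇒≤ (forward wf here))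

  root-idem : ∀ s → WF s → ∀ {t} → t < length s → root s (root s t) ≡ root s t
  root-idem (l ∷ s) wf {t} t< with t ≟ length s
  ... | no ne = let lt = ≤∧≢⇒< (≤-pred t<) ne in
        trans (root-old l s (≤-<-trans (root-≤ s (WF-tail wf) t) lt)) (root-idem s (WF-tail wf) lt)
  root-idem (nothing ∷ s) wf t< | yes refl = root-nothing s
  root-idem (just (p , k) ∷ s) wf t< | yes refl = let lt = forward wf here in
    trans (root-old (just (p , k)) s (≤-<-trans (root-≤ s (WF-tail wf) p) lt)) (root-idem s (WF-tail wf) lt)

  -- `Arc` for a block map on all numbers, so that the list of labels can grow during the induction
  -- without a change of type.
  ArcN : (ℕ → ℕ) → ℕ → ℕ → Set
  ArcN F a b = a < b × F a ≡ F b × (∀ x → a < x → x < b → F x ≢ F a)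

  ArcN-cong : ∀ {F G a b} → (∀ x → x ≤ b → F x ≡ G x) → ArcN F a b → ArcN G a b
  ArcN-cong eq (lt , e , g) = lt
    , trans (sym (eq _ (<⇒≤ lt))) (trans e (eq _ ≤-refl))
    , λ x a<x x<b e' → g x a<x x<b (trans (eq x (<⇒≤ x<b)) (trans e' (sym (eq _ (<⇒≤ lt)))))

  succ-arc : ∀ {F a b} → a < b → F b ≡ F a → ∃ λ b' → b' ≤ b × ArcN F a b'
  succ-arc {F} {a} {b} lt eq
    with least (λ x → (suc a ≤? x) ×-dec (F x ≟ F a)) (suc b) (b , ≤-refl , lt , eq)
  ... | x , x≤b , (a<x , e) , min = x , ≤-pred x≤b , a<x , sym e , λ y a<y y<x e' → min y y<x (a<y , e')

  -- Attaching the newest vertex to `p` creates the arc from `p` only, since `p` was the last of its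
  -- block; arcs among earlier vertices involve only earlier roots and do not change.
  root-arcs : ∀ s → WF s → ∀ {a b} → b < length s →
    (ArcN (root s) a b → ∃ λ k → Has s b a k) × (∀ {k} → Has s b a k → ArcN (root s) a b)
  root-arcs (l ∷ s) wf {a} {b} b< = by-cases (b ≟ length s)
    where
    Goal : ℕ → Set
    Goal b = (ArcN (root (l ∷ s)) a b → ∃ λ k → Has (l ∷ s) b a k) × (∀ {k} → Has (l ∷ s) b a k → ArcN (root (l ∷ s)) a b)

    -- p has no arc to the right among the earlier vertices, so it ends its block there.
    last-of-block : ∀ {p k} → WF (just (p , k) ∷ s) → ∀ x → p < x → x < length s → root s x ≢ root s p
    last-of-block {p} {k} wf x p<x x< eq with succ-arc p<x eq
    ... | b' , b'≤x , arc with proj₁ (root-arcs s (WF-tail wf) (≤-<-trans b'≤x x<)) arc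
    ...   | k' , e = <-irrefl (distinct wf (there e) here) (≤-<-trans b'≤x x<)

    to : ∀ l → WF (l ∷ s) → ArcN (root (l ∷ s)) a (length s) → ∃ λ k → Has (l ∷ s) (length s) a k
    to nothing wf (lt , e , _) = contradiction (trans e (root-nothing s))
      (<⇒≢ (≤-<-trans (root-≤ (nothing ∷ s) wf a) lt))
    to (just (p , k)) wf (lt , e , g) with <-cmp a p
    ... | tri≈ _ refl _ = k , here
    -- Here `p` would be a member of the block strictly between `a` and the newest vertex.
    ... | tri< a<p _ _ = contradiction (trans (root-old _ s p<) (trans (sym (root-just s p k)) (sym e))) (g p a<p p<)
      where p< = forward wf here
    ... | tri> _ _ p<a = contradiction (trans (sym (root-old _ s lt)) (trans e (root-just s p k))) (last-of-block wf a p<a lt)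

    from : ∀ {k} → Has (l ∷ s) (length s) a k → ArcN (root (l ∷ s)) a (length s)
    from (there e) = contradiction (Has-< e) (<-irrefl refl)
    from {k} here = p< , trans (root-old _ s p<) (sym (root-just s a k)) ,
      λ x a<x x< e → last-of-block wf x a<x x< (trans (sym (root-old _ s x<)) (trans e (root-old _ s p<)))
      where p< = forward wf here

    by-cases : Dec (b ≡ length s) → Goal b
    by-cases (yes eq) = subst Goal (sym eq) (to l wf , from)
    by-cases (no ne)  =
        (λ arc → let (k , e) = proj₁ ih (ArcN-cong (λ x x≤b → root-old l s (≤-<-trans x≤b lt)) arc) in k , there e)
      , λ { here → contradiction refl ne
          ; (there e) → ArcN-cong (λ x x≤b → sym (root-old l s (≤-<-trans x≤b lt))) (proj₂ ih e) }
      where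
      lt = ≤∧≢⇒< (≤-pred b<) ne
      ih = root-arcs s (WF-tail wf) {a} {b} lt

  colour : List Label → ℕ → Maybe (Fin R)
  colour []                   p = nothing
  colour (nothing ∷ s)        p = colour s p
  colour (just (p' , k) ∷ s)  p with p ≟ p'
  ... | yes _ = just k
  ... | no _  = colour s p

  colour-sound : ∀ s {p k} → colour s p ≡ just k → ∃ λ t → Has s t p k
  colour-sound (nothing ∷ s) eq = let (t , e) = colour-sound s eq in t , there e
  colour-sound (just (p' , k') ∷ s) {p} eq with p ≟ p'
  colour-sound (just (p' , k') ∷ s) refl | yes refl = _ , here
  ... | no _ = let (t , e) = colour-sound s eq in t , there e

  colour-complete : ∀ s → WF s → ∀ {t p k} → Has s t p k → colour s p ≡ just k
  colour-complete (nothing ∷ s) wf (there e) = colour-complete s (WF-tail wf) e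
  colour-complete (just (p' , k') ∷ s) wf {p = p} e with p ≟ p' | e
  ... | yes refl | here    = refl
  ... | yes refl | there f = contradiction (Has-< f) (<-irrefl (distinct wf (there f) here))
  ... | no ne    | here    = contradiction refl ne
  ... | no _     | there f = colour-complete s (WF-tail wf) f

  module Decode {s : List Label} (wf : WF s) (len : length s ≡ n) where

    root< : ∀ (a : Fin n) → root s (toℕ a) < n
    root< a = ≤-<-trans (root-≤ s wf (toℕ a)) (toℕ<n a)

    roots : Vec (Fin n) n
    roots = tabulate λ a → fromℕ< (root< a)

    colours : Vec (Maybe (Fin R)) n
    colours = tabulate λ a → colour s (toℕ a)

    toℕ-roots : ∀ a → toℕ (lookup roots a) ≡ root s (toℕ a)
    toℕ-roots a = trans (cong toℕ (lookup∘tabulate _ a)) (toℕ-fromℕ< (root< a))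

    roots-partition : IsPartition roots
    roots-partition a = subst (_≤ toℕ a) (sym (toℕ-roots a)) (root-≤ s wf (toℕ a)) , toℕ-injective
      (trans (toℕ-roots (lookup roots a)) (trans (cong (root s) (toℕ-roots a))
        (trans (root-idem s wf (subst (toℕ a <_) (sym len) (toℕ<n a))) (sym (toℕ-roots a)))))

    roots-≡ : ∀ {a b} → lookup roots a ≡ lookup roots b → root s (toℕ a) ≡ root s (toℕ b)
    roots-≡ {a} {b} eq = trans (sym (toℕ-roots a)) (trans (cong toℕ eq) (toℕ-roots b))

    ≡-roots : ∀ {a b} → root s (toℕ a) ≡ root s (toℕ b) → lookup roots a ≡ lookup roots b
    ≡-roots {a} {b} eq = toℕ-injective (trans (toℕ-roots a) (trans eq (sym (toℕ-roots b))))

    arc⇒Has : ∀ {a b} → Arc roots a b → ∃ λ k → Has s (toℕ b) (toℕ a) k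
    arc⇒Has {a} {b} (lt , e , g) = proj₁ (root-arcs s wf (subst (toℕ b <_) (sym len) (toℕ<n b)))
      (lt , roots-≡ {a} {b} e , λ x a<x x<b eq →
        let x<n = <-trans x<b (toℕ<n b)
            x≡  = toℕ-fromℕ< x<n
        in g (fromℕ< x<n) (subst (toℕ a <_) (sym x≡) a<x) (subst (_< toℕ b) (sym x≡) x<b)
             (≡-roots {fromℕ< x<n} {a} (trans (cong (root s) x≡) eq)))

    Has⇒arc : ∀ {t p k} → Has s t p k → ∃₂ λ a b → toℕ a ≡ p × toℕ b ≡ t × Arc roots a b
    Has⇒arc {t} {p} e = a , b , a≡ , b≡ , arc
      where
      t<n = subst (t <_) len (Has-< e)
      p<n = <-trans (forward wf e) t<n
      a = fromℕ< p<n
      b = fromℕ< t<n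
      a≡ = toℕ-fromℕ< p<n
      b≡ = toℕ-fromℕ< t<n
      arc : Arc roots a b
      arc with subst₂ (ArcN (root s)) (sym a≡) (sym b≡) (proj₂ (root-arcs s wf (Has-< e)) e)
      ... | lt , eq , g = lt , ≡-roots {a} {b} eq , λ x a<x x<b eq' → g (toℕ x) a<x x<b (roots-≡ {x} {a} eq')

    lookup-colours : ∀ a → lookup colours a ≡ colour s (toℕ a)
    lookup-colours = lookup∘tabulate _

    decode-Rel : Rel roots colours s
    decode-Rel = mkRel snd-ok cmp-ok
      where
      snd-ok : ∀ {t p col} → Has s t p col →
               ∃₂ λ a b → toℕ a ≡ p × toℕ b ≡ t × Arc roots a b × lookup colours a ≡ just col
      snd-ok e = let (a , b , a≡ , b≡ , arc) = Has⇒arc e in a , b , a≡ , b≡ , arc ,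
        trans (lookup-colours a) (trans (cong (colour s) a≡) (colour-complete s wf e))
      cmp-ok : ∀ {a b col} → Arc roots a b → lookup colours a ≡ just col → Has s (toℕ b) (toℕ a) col
      cmp-ok {a} {b} arc eq with arc⇒Has arc
      ... | k , e = subst (Has s (toℕ b) (toℕ a))
        (just-injective (trans (sym (colour-complete s wf e)) (trans (sym (lookup-colours a)) eq))) e

    colours-colouring : IsArcColouring roots colours
    colours-colouring a =
        (λ { (b , arc) → let (k , e) = arc⇒Has arc in k , trans (lookup-colours a) (colour-complete s wf e) })
      , λ k eq → arc-from k eq
      where
      arc-from : ∀ k → lookup colours a ≡ just k → ∃ λ b → Arc roots a b
      arc-from k eq with colour-sound s (trans (sym (lookup-colours a)) eq)
      ... | t , e with Has⇒arc e
      ...   | a' , b , a≡ , _ , arc with toℕ-injective a≡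
      ...     | refl = b , arc

-- The list of candidates and the final count.

∈-allCandidates : ∀ {n r} (z : Candidate n r) → z ∈ allCandidates n r
∈-allCandidates {n} {r} (f , c) = ∃-∈-concatMap (λ f → map (f ,_) (allVecs (nothing ∷ map just (allFin r)) n))
  (∈-allVecs⁺ f (λ _ → ∈-allFin _)) (∈-map⁺ (f ,_) (∈-allVecs⁺ c (λ _ → ∈-colours _)))
  where
  ∈-colours : (k : Maybe (Fin r)) → k ∈ nothing ∷ map just (allFin r)
  ∈-colours nothing  = here refl
  ∈-colours (just k) = there (∈-map⁺ just (∈-allFin k))

allCandidates-unique : ∀ n r → Unique (allCandidates n r)
allCandidates-unique n r = unique-concatMap (λ f → map (f ,_) cs) (allVecs-unique (Unique.allFin⁺ n) n)
  (λ _ → Unique.map⁺ (λ { refl → refl }) (allVecs-unique colours-unique n)) disjoint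
  where
  colours = nothing ∷ map just (allFin r)
  colours-unique : Unique colours
  colours-unique = unique-∷ (λ x∈ → nothing∉ (∈-map⁻ just x∈)) (Unique.map⁺ (λ { refl → refl }) (Unique.allFin⁺ r))
    where
    nothing∉ : ¬ (∃ λ k → k ∈ allFin r × nothing ≡ just k)
    nothing∉ (_ , _ , ())
  cs = allVecs colours n
  disjoint : ∀ {f g z} → f ∈ allVecs (allFin n) n → g ∈ allVecs (allFin n) n →
             z ∈ map (f ,_) cs → z ∈ map (g ,_) cs → f ≡ g
  disjoint _ _ z∈ z∈′ with ∈-map⁻ _ z∈ | ∈-map⁻ _ z∈′
  ... | _ , _ , refl | _ , _ , eq = cong proj₁ eq

theorem3p5 : (j k r n : ℕ) → 2 ≤ j → 2 ≤ k → 1 ≤ r → 1 ≤ n →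
    (dec : Decidable (NCNObject j k {n} {r})) →
    length (filter dec (allCandidates n r))
    ≡ walks j k r (n ∸ 1) (zeroMatrix k r) (zeroMatrix k r)
theorem3p5 (suc J) (suc m) r (suc i) _ _ _ _ dec = trans (≤-antisym encode decode) (empty-states i)
  where
  open Paths J m r
  open Counting J m r
  open Labels J m r
  open Families J m r
  open Encoding J m r
  objects = filter dec (allCandidates (suc i) r)
  -- After the arrival at the last vertex `i` no arc remains open, so the tableau on the labels
  -- below `i` has to be empty.
  paths   = filter (empty? ∘ proj₁) (states i)

  Matches : Candidate (suc i) r → State i → Set
  Matches (f , c) (_ , s) = Rel f c s

  object : ∀ {z} → z ∈ objects → NCNObject (suc J) (suc m) z
  object z∈ = proj₂ (∈-filter⁻ dec {xs = allCandidates (suc i) r} z∈)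

  path : ∀ {U s} → (U , s) ∈ paths → U ≡ replicate i nothing × Path U s
  path z∈ = let (z∈′ , eq) = ∈-filter⁻ (empty? ∘ proj₁) {xs = states i} z∈ in eq , states⇒Path z∈′

  encode : length objects ≤ length paths
  encode = injection⇒length≤ Matches (Unique.filter⁺ dec (allCandidates-unique (suc i) r))
    (λ { {f , c} z∈ → let (_ , _ , cr , ne) = object z∈ in
         (replicate i nothing , labels f c (suc i))
       , ∈-filter⁺ (empty? ∘ proj₁) (Path⇒states (NCN⇒Path cr ne)) refl
       , labels-Rel f c })
    (λ { {f , c} {f' , c'} z∈ z∈′ rel rel' →
         let (part , col , _) = object z∈
             (part' , col' , _) = object z∈′
         in Rel-injective part col part' col' rel rel' })

  decode : length paths ≤ length objects
  decode = injection⇒length≤ (λ z x → Matches x z) (Unique.filter⁺ (empty? ∘ proj₁) (states-unique i)) realise unique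
    where
    realise : ∀ {z} → z ∈ paths → ∃ λ x → x ∈ objects × Matches x z
    realise {U , s} z∈ with path z∈
    ... | refl , P = (roots , colours)
        , ∈-filter⁺ dec (∈-allCandidates (roots , colours))
            (roots-partition , colours-colouring , Path-CrLess decode-Rel P , Path-NeLess decode-Rel P)
        , decode-Rel
      where open Decode (Path-WF P) (Path-length P)
    unique : ∀ {z z' x} → z ∈ paths → z' ∈ paths → Matches x z → Matches x z' → z ≡ z'
    unique {U , s} {U' , s'} z∈ z∈′ rel rel' with path z∈ | path z∈′
    ... | refl , P | refl , P' = cong (_ ,_) (Rel-functional (trans (Path-length P) (sym (Path-length P'))) rel rel')
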